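{- Let $s\in\mathbb C$ with $\operatorname{Re}(s)>1$. Then $$\frac{1}{\prod_{p\in\mathbb P}\left(1-\frac1{p^s}\right)}=\sum_{n=1}^\infty\frac1{n^s}=\zeta(s),$$ and moreover $$\zeta(s)=1+\sum_{p\in\mathbb P}\frac{1}{p^s\prod_{r\in\mathbb P,\ r\le p}\left(1-\frac1{r^s}\right)}.$$
   Context: $\mathbb P$ denotes the set of prime numbers and $\zeta$ the Riemann zeta function. -}

module Defs where

open import Data.Bool.Base using (if_then_else_)
open import Data.Integer.Base as ℤ using (ℤ; +_)
import Data.Integer.Properties as ℤP
open import Data.Nat.Base as ℕ using (ℕ; zero; suc; _!; s≤s; z≤n)
open import Data.Nat.Primality using (prime?)
open import Data.Nat.Properties as ℕP using (_!≢0)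
open import Data.Product.Base using (∃-syntax; _×_; _,_; proj₁; proj₂)
open import Data.Rational.Base
open import Data.Rational.Properties
open import Data.Rational.Solver using (module +-*-Solver)
import Data.Rational.Unnormalised.Base as ℚᵘ
import Data.Rational.Unnormalised.Properties as ℚᵘP
open import Data.Sum.Base using (inj₁; inj₂)
open import Relation.Binary.PropositionalEquality
open import Relation.Nullary.Decidable using (does)

1/suc : ℕ → ℚ
1/suc n = + 1 / suc n

0<½* : ∀ {ε} → 0ℚ < ε → 0ℚ < ½ * ε
0<½* {ε} 0<ε = subst (_< ½ * ε) (*-zeroʳ ½) (*-monoʳ-<-pos ½ 0<ε)

½+½ : ∀ ε → ½ * ε + ½ * ε ≡ ε
½+½ ε = trans (sym (*-distribʳ-+ ε ½ ½)) (*-identityˡ ε)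

0≤* : ∀ {p q} → 0ℚ ≤ p → 0ℚ ≤ q → 0ℚ ≤ p * q
0≤* {p} {q} 0≤p 0≤q =
  subst (_≤ p * q) (*-zeroʳ p) (*-monoˡ-≤-nonNeg p {{nonNegative 0≤p}} 0≤q)

*-mono-≤₀ : ∀ {p q r s} → 0ℚ ≤ p → 0ℚ ≤ s → p ≤ q → r ≤ s → p * r ≤ q * s
*-mono-≤₀ {p} {q} {r} {s} 0≤p 0≤s p≤q r≤s = ≤-trans
  (*-monoˡ-≤-nonNeg p {{nonNegative 0≤p}} r≤s)
  (*-monoʳ-≤-nonNeg s {{nonNegative 0≤s}} p≤q)

∣∣≤ : ∀ {p q} → p ≤ q → - p ≤ q → ∣ p ∣ ≤ q
∣∣≤ {p} p≤q -p≤q with ∣p∣≡p∨∣p∣≡-p p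
... | inj₁ eq = subst (_≤ _) (sym eq) p≤q
... | inj₂ eq = subst (_≤ _) (sym eq) -p≤q

p-q≤ : ∀ {p q r} → p ≤ r + q → p - q ≤ r
p-q≤ {p} {q} {r} h = subst (p - q ≤_)
  (solve 2 (λ r q → (r :+ q) :+ (:- q) := r) refl r q) (+-monoˡ-≤ (- q) h)
  where open +-*-Solver

∣-∣-comm : ∀ p q → ∣ p - q ∣ ≡ ∣ q - p ∣
∣-∣-comm p q = trans (sym (∣-p∣≡∣p∣ (p - q))) (cong ∣_∣
  (solve 2 (λ p q → :- (p :+ (:- q)) := q :+ (:- p)) refl p q))
  where open +-*-Solver

triangle : ∀ p q r → ∣ p - r ∣ ≤ ∣ p - q ∣ + ∣ q - r ∣
triangle p q r = subst (λ x → ∣ x ∣ ≤ ∣ p - q ∣ + ∣ q - r ∣)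
  (solve 3 (λ p q r → (p :+ (:- q)) :+ (q :+ (:- r)) := p :+ (:- r)) refl p q r)
  (∣p+q∣≤∣p∣+∣q∣ (p - q) (q - r))
  where open +-*-Solver

∣p∣≤∣p-q∣+∣q∣ : ∀ p q → ∣ p ∣ ≤ ∣ p - q ∣ + ∣ q ∣
∣p∣≤∣p-q∣+∣q∣ p q = subst (λ x → ∣ x ∣ ≤ ∣ p - q ∣ + ∣ q ∣)
  (solve 2 (λ p q → (p :+ (:- q)) :+ q := p) refl p q)
  (∣p+q∣≤∣p∣+∣q∣ (p - q) q)
  where open +-*-Solver

dist-+ : ∀ p q r s → ∣ (p + q) - (r + s) ∣ ≤ ∣ p - r ∣ + ∣ q - s ∣
dist-+ p q r s = subst (λ x → ∣ x ∣ ≤ ∣ p - r ∣ + ∣ q - s ∣)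
  (solve 4 (λ p q r s →
    (p :+ (:- r)) :+ (q :+ (:- s)) := (p :+ q) :+ (:- (r :+ s))) refl p q r s)
  (∣p+q∣≤∣p∣+∣q∣ (p - r) (q - s))
  where open +-*-Solver

dist-neg : ∀ p q → ∣ - p - - q ∣ ≡ ∣ p - q ∣
dist-neg p q = trans (cong ∣_∣
  (solve 2 (λ p q → (:- p) :+ (:- (:- q)) := :- (p :+ (:- q))) refl p q))
  (∣-p∣≡∣p∣ (p - q))
  where open +-*-Solver

dist-* : ∀ p q r s → ∣ p * q - r * s ∣ ≤ ∣ p ∣ * ∣ q - s ∣ + ∣ p - r ∣ * ∣ s ∣
dist-* p q r s = subst₂ _≤_
  (cong ∣_∣ (solve 4 (λ p q r s →
    p :* (q :+ (:- s)) :+ (p :+ (:- r)) :* s := p :* q :+ (:- (r :* s))) refl p q r s))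
  (cong₂ _+_ (∣p*q∣≡∣p∣*∣q∣ p (q - s)) (∣p*q∣≡∣p∣*∣q∣ (p - r) s))
  (∣p+q∣≤∣p∣+∣q∣ (p * (q - s)) ((p - r) * s))
  where open +-*-Solver

dist-∣∣ : ∀ p q → ∣ ∣ p ∣ - ∣ q ∣ ∣ ≤ ∣ p - q ∣
dist-∣∣ p q = ∣∣≤ (p-q≤ (∣p∣≤∣p-q∣+∣q∣ p q))
  (subst (_≤ ∣ p - q ∣)
    (solve 2 (λ a b → b :+ (:- a) := :- (a :+ (:- b))) refl ∣ p ∣ ∣ q ∣)
    (p-q≤ (subst (λ x → ∣ q ∣ ≤ x + ∣ p ∣) (∣-∣-comm q p) (∣p∣≤∣p-q∣+∣q∣ q p))))
  where open +-*-Solver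

0≤1/suc : ∀ n → 0ℚ ≤ 1/suc n
0≤1/suc n = <⇒≤ (positive⁻¹ (1/suc n) {{normalize-pos 1 (suc n)}})

toℚᵘ-1/suc : ∀ n → toℚᵘ (1/suc n) ℚᵘ.≃ ℚᵘ.mkℚᵘ (+ 1) n
toℚᵘ-1/suc n = toℚᵘ-fromℚᵘ (ℚᵘ.mkℚᵘ (+ 1) n)

1/suc-antitone : ∀ {m n} → m ℕ.≤ n → 1/suc n ≤ 1/suc m
1/suc-antitone {m} {n} m≤n = toℚᵘ-cancel-≤ (ℚᵘP.≤-respʳ-≃ (ℚᵘP.≃-sym (toℚᵘ-1/suc m))
  (ℚᵘP.≤-respˡ-≃ (ℚᵘP.≃-sym (toℚᵘ-1/suc n))
    (ℚᵘ.*≤* (ℤP.*-monoˡ-≤-nonNeg (+ 1) (ℤ.+≤+ (s≤s m≤n))))))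

1/suc-* : ∀ m n {k} → suc k ≡ suc m ℕ.* suc n → 1/suc k ≡ 1/suc m * 1/suc n
1/suc-* m n {k} refl = toℚᵘ-injective (begin
  toℚᵘ (1/suc k)                          ≈⟨ toℚᵘ-1/suc k ⟩
  ℚᵘ.mkℚᵘ (+ 1) k                         ≈⟨ ℚᵘP.≃-refl ⟩
  ℚᵘ.mkℚᵘ (+ 1) m ℚᵘ.* ℚᵘ.mkℚᵘ (+ 1) n    ≈⟨ ℚᵘP.*-cong (toℚᵘ-1/suc m) (toℚᵘ-1/suc n) ⟨
  toℚᵘ (1/suc m) ℚᵘ.* toℚᵘ (1/suc n)      ≈⟨ toℚᵘ-homo-* (1/suc m) (1/suc n) ⟨
  toℚᵘ (1/suc m * 1/suc n)                ∎)
  where open ℚᵘP.≃-Reasoning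

archimedean : ∀ ε → 0ℚ < ε → ∃[ M ] ∀ n → M ℕ.≤ n → 1/suc n ≤ ε
archimedean ε@(mkℚ (ℤ.+[1+ p ]) d _) _ = d , λ n d≤n → toℚᵘ-cancel-≤
  (ℚᵘP.≤-respˡ-≃ (ℚᵘP.≃-sym (toℚᵘ-1/suc n)) (ℚᵘ.*≤* (ℤ.+≤+
    (ℕP.*-mono-≤ {1} {suc p} (s≤s z≤n) (s≤s d≤n)))))
archimedean (mkℚ (ℤ.+0) d _) (*<* (ℤ.+<+ ()))
archimedean (mkℚ (ℤ.-[1+ p ]) d _) (*<* ())

divide : ∀ {ε B} → 0ℚ < ε → 0ℚ < B → ∃[ δ ] (0ℚ < δ × B * δ ≡ ε)
divide {ε} {B} 0<ε 0<B = ε * 1/B , positive⁻¹ _ {{pos*pos⇒pos ε {{positive 0<ε}} 1/B {{1/pos⇒pos B {{pB}}}}}} ,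
  trans (solve 3 (λ b e i → b :* (e :* i) := e :* (b :* i)) refl B ε 1/B)
    (trans (cong (ε *_) (*-inverseʳ B {{nz}})) (*-identityʳ ε))
  where
  open +-*-Solver
  pB : Positive B
  pB = positive 0<B
  nz : NonZero B
  nz = pos⇒nonZero B {{pB}}
  1/B : ℚ
  1/B = (1/ B) {{nz}}

-- Real numbers are Cauchy sequences of rationals, taken up to _≈ᴿ_.

Cauchy : (ℕ → ℚ) → Set
Cauchy a = ∀ ε → 0ℚ < ε → ∃[ N ] ∀ m n → N ℕ.≤ m → N ℕ.≤ n → ∣ a m - a n ∣ ≤ ε

record ℝ : Set where
  constructor mkℝ
  field
    seq    : ℕ → ℚ
    cauchy : Cauchy seq
open ℝ public

infix 4 _≈ᴿ_ _≤ᴿ_ _<ᴿ_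

_≈ᴿ_ : ℝ → ℝ → Set
x ≈ᴿ y = ∀ ε → 0ℚ < ε → ∃[ N ] ∀ n → N ℕ.≤ n → ∣ seq x n - seq y n ∣ ≤ ε

_≤ᴿ_ : ℝ → ℝ → Set
x ≤ᴿ y = ∀ ε → 0ℚ < ε → ∃[ N ] ∀ n → N ℕ.≤ n → seq x n ≤ seq y n + ε

_<ᴿ_ : ℝ → ℝ → Set
x <ᴿ y = ∃[ ε ] (0ℚ < ε × ∃[ N ] ∀ n → N ℕ.≤ n → seq x n + ε ≤ seq y n)

eventually₂ : ∀ {P Q : ℕ → ℕ → Set} →
  (∃[ N ] ∀ m n → N ℕ.≤ m → N ℕ.≤ n → P m n) →
  (∃[ N ] ∀ m n → N ℕ.≤ m → N ℕ.≤ n → Q m n) →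
  ∃[ N ] ∀ m n → N ℕ.≤ m → N ℕ.≤ n → P m n × Q m n
eventually₂ (M , p) (N , q) = M ℕ.⊔ N , λ m n hm hn →
  p m n (ℕP.≤-trans (ℕP.m≤m⊔n M N) hm) (ℕP.≤-trans (ℕP.m≤m⊔n M N) hn) ,
  q m n (ℕP.≤-trans (ℕP.m≤n⊔m M N) hm) (ℕP.≤-trans (ℕP.m≤n⊔m M N) hn)

eventuallyBounded : ∀ x → ∃[ B ] (0ℚ < B × ∃[ N ] ∀ n → N ℕ.≤ n → ∣ seq x n ∣ ≤ B)
eventuallyBounded x with cauchy x 1ℚ (positive⁻¹ 1ℚ)
... | N , h = 1ℚ + ∣ seq x N ∣ ,
  <-≤-trans (positive⁻¹ 1ℚ) (subst (_≤ 1ℚ + ∣ seq x N ∣) (+-identityʳ 1ℚ)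
    (+-monoʳ-≤ 1ℚ (0≤∣p∣ (seq x N)))) ,
  N , λ n N≤n → ≤-trans (∣p∣≤∣p-q∣+∣q∣ (seq x n) (seq x N))
    (+-monoˡ-≤ ∣ seq x N ∣ (h n N N≤n ℕP.≤-refl))

cauchy-const : ∀ q → Cauchy (λ _ → q)
cauchy-const q ε 0<ε = 0 , λ _ _ _ _ →
  subst (_≤ ε) (sym (cong ∣_∣ (+-inverseʳ q))) (<⇒≤ 0<ε)

cauchy-+ : ∀ x y → Cauchy (λ n → seq x n + seq y n)
cauchy-+ x y ε 0<ε with eventually₂ (cauchy x (½ * ε) (0<½* 0<ε)) (cauchy y (½ * ε) (0<½* 0<ε))
... | N , h = N , λ m n hm hn → let (p , q) = h m n hm hn in ≤-trans
  (dist-+ (seq x m) (seq y m) (seq x n) (seq y n))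
  (subst (_ ≤_) (½+½ ε) (+-mono-≤ p q))

cauchy-neg : ∀ x → Cauchy (λ n → - seq x n)
cauchy-neg x ε 0<ε with cauchy x ε 0<ε
... | N , h = N , λ m n hm hn →
  subst (_≤ ε) (sym (dist-neg (seq x m) (seq x n))) (h m n hm hn)

cauchy-∣∣ : ∀ x → Cauchy (λ n → ∣ seq x n ∣)
cauchy-∣∣ x ε 0<ε with cauchy x ε 0<ε
... | N , h = N , λ m n hm hn → ≤-trans (dist-∣∣ (seq x m) (seq x n)) (h m n hm hn)

cauchy-*-bounded : ∀ {a b} → Cauchy a → Cauchy b →
  ∀ A B → 0ℚ < A → 0ℚ < B →
  ∀ M₁ → (∀ n → M₁ ℕ.≤ n → ∣ a n ∣ ≤ A) →
  ∀ M₂ → (∀ n → M₂ ℕ.≤ n → ∣ b n ∣ ≤ B) →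
  ∀ ε δ → 0ℚ < δ → (A + B) * δ ≡ ε →
  ∃[ N ] ∀ m n → N ℕ.≤ m → N ℕ.≤ n → ∣ a m * b m - a n * b n ∣ ≤ ε
cauchy-*-bounded {a} {b} ca cb A B 0<A 0<B M₁ boundA M₂ boundB ε δ 0<δ eq =
  help (ca δ 0<δ) (cb δ 0<δ)
  where
  open +-*-Solver
  distrib : A * δ + δ * B ≡ (A + B) * δ
  distrib = solve 3 (λ a b d → a :* d :+ d :* b := (a :+ b) :* d) refl A B δ
  help : (∃[ N ] ∀ m n → N ℕ.≤ m → N ℕ.≤ n → ∣ a m - a n ∣ ≤ δ) →
         (∃[ N ] ∀ m n → N ℕ.≤ m → N ℕ.≤ n → ∣ b m - b n ∣ ≤ δ) →
         ∃[ N ] ∀ m n → N ℕ.≤ m → N ℕ.≤ n → ∣ a m * b m - a n * b n ∣ ≤ ε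
  help (N₁ , h₁) (N₂ , h₂) = N , λ m n hm hn → ≤-trans
    (dist-* (a m) (b m) (a n) (b n))
    (≤-trans
      (+-mono-≤
        (*-mono-≤₀ {∣ a m ∣} {A} {∣ b m - b n ∣} {δ} (0≤∣p∣ (a m)) (<⇒≤ 0<δ)
          (boundA m (≤N M₁≤ hm)) (h₂ m n (≤N N₂≤ hm) (≤N N₂≤ hn)))
        (*-mono-≤₀ {∣ a m - a n ∣} {δ} {∣ b n ∣} {B} (0≤∣p∣ (a m - a n)) (<⇒≤ 0<B)
          (h₁ m n (≤N N₁≤ hm) (≤N N₁≤ hn)) (boundB n (≤N M₂≤ hn))))
      (≤-reflexive (trans distrib eq)))
    where
    N = (N₁ ℕ.⊔ N₂) ℕ.⊔ (M₁ ℕ.⊔ M₂)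
    N₁≤ : N₁ ℕ.≤ N
    N₁≤ = ℕP.≤-trans (ℕP.m≤m⊔n N₁ N₂) (ℕP.m≤m⊔n (N₁ ℕ.⊔ N₂) (M₁ ℕ.⊔ M₂))
    N₂≤ : N₂ ℕ.≤ N
    N₂≤ = ℕP.≤-trans (ℕP.m≤n⊔m N₁ N₂) (ℕP.m≤m⊔n (N₁ ℕ.⊔ N₂) (M₁ ℕ.⊔ M₂))
    M₁≤ : M₁ ℕ.≤ N
    M₁≤ = ℕP.≤-trans (ℕP.m≤m⊔n M₁ M₂) (ℕP.m≤n⊔m (N₁ ℕ.⊔ N₂) (M₁ ℕ.⊔ M₂))
    M₂≤ : M₂ ℕ.≤ N
    M₂≤ = ℕP.≤-trans (ℕP.m≤n⊔m M₁ M₂) (ℕP.m≤n⊔m (N₁ ℕ.⊔ N₂) (M₁ ℕ.⊔ M₂))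
    ≤N : ∀ {i j} → i ℕ.≤ N → N ℕ.≤ j → i ℕ.≤ j
    ≤N = ℕP.≤-trans

cauchy-* : ∀ x y → Cauchy (λ n → seq x n * seq y n)
cauchy-* x y ε 0<ε = help (eventuallyBounded x) (eventuallyBounded y)
  where
  help : (∃[ B ] (0ℚ < B × ∃[ N ] ∀ n → N ℕ.≤ n → ∣ seq x n ∣ ≤ B)) →
         (∃[ B ] (0ℚ < B × ∃[ N ] ∀ n → N ℕ.≤ n → ∣ seq y n ∣ ≤ B)) →
         ∃[ N ] ∀ m n → N ℕ.≤ m → N ℕ.≤ n →
           ∣ seq x m * seq y m - seq x n * seq y n ∣ ≤ ε
  help (A , 0<A , M₁ , boundx) (B , 0<B , M₂ , boundy) =
    cauchy-*-bounded (cauchy x) (cauchy y) A B 0<A 0<B M₁ boundx M₂ boundy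
      ε (proj₁ δ) (proj₁ (proj₂ δ)) (proj₂ (proj₂ δ))
    where
    δ : ∃[ δ ] (0ℚ < δ × (A + B) * δ ≡ ε)
    δ = divide {ε} {A + B} 0<ε
      (positive⁻¹ (A + B) {{pos+pos⇒pos A {{positive 0<A}} B {{positive 0<B}}}})

infixl 6 _+ᴿ_ _-ᴿ_
infixl 7 _*ᴿ_
infix  8 -ᴿ_

fromℚ : ℚ → ℝ
fromℚ q = mkℝ (λ _ → q) (cauchy-const q)

_+ᴿ_ : ℝ → ℝ → ℝ
x +ᴿ y = mkℝ (λ n → seq x n + seq y n) (cauchy-+ x y)

_*ᴿ_ : ℝ → ℝ → ℝ
x *ᴿ y = mkℝ (λ n → seq x n * seq y n) (cauchy-* x y)

-ᴿ_ : ℝ → ℝ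
-ᴿ x = mkℝ (λ n → - seq x n) (cauchy-neg x)

_-ᴿ_ : ℝ → ℝ → ℝ
x -ᴿ y = x +ᴿ (-ᴿ y)

∣_∣ᴿ : ℝ → ℝ
∣ x ∣ᴿ = mkℝ (λ n → ∣ seq x n ∣) (cauchy-∣∣ x)

infix 4 _⟶ᴿ_

_⟶ᴿ_ : (ℕ → ℝ) → ℝ → Set
f ⟶ᴿ x = ∀ ε → 0ℚ < ε → ∃[ N ] ∀ n → N ℕ.≤ n → ∣ f n -ᴿ x ∣ᴿ ≤ᴿ fromℚ ε

Cauchyᴿ : (ℕ → ℝ) → Set
Cauchyᴿ f = ∀ ε → 0ℚ < ε →
  ∃[ N ] ∀ m n → N ℕ.≤ m → N ℕ.≤ n → ∣ f m -ᴿ f n ∣ᴿ ≤ᴿ fromℚ ε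

diagIndex : (ℕ → ℝ) → ℕ → ℕ
diagIndex f n = proj₁ (cauchy (f n) (1/suc n) (positive⁻¹ _ {{normalize-pos 1 (suc n)}}))

diag : (ℕ → ℝ) → ℕ → ℚ
diag f n = seq (f n) (diagIndex f n)

diag-close : ∀ f n i → diagIndex f n ℕ.≤ i → ∣ diag f n - seq (f n) i ∣ ≤ 1/suc n
diag-close f n i hi =
  proj₂ (cauchy (f n) (1/suc n) (positive⁻¹ _ {{normalize-pos 1 (suc n)}}))
    (diagIndex f n) i ℕP.≤-refl hi

cauchy-diag : ∀ f → Cauchyᴿ f → Cauchy (diag f)
cauchy-diag f c ε 0<ε = help (c q 0<q) (archimedean q 0<q)
  where
  open +-*-Solver
  q : ℚ
  q = ½ * (½ * ε)
  0<q : 0ℚ < q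
  0<q = 0<½* (0<½* 0<ε)
  4q : q + ((q + q) + q) ≡ ε
  4q = trans (solve 1 (λ q → q :+ ((q :+ q) :+ q) := (q :+ q) :+ (q :+ q)) refl q)
    (trans (cong₂ _+_ (½+½ (½ * ε)) (½+½ (½ * ε))) (½+½ ε))

  close : ∀ m n → 1/suc m ≤ q → 1/suc n ≤ q →
    (∃[ K ] ∀ i → K ℕ.≤ i → ∣ seq (f m) i - seq (f n) i ∣ ≤ q + q) →
    ∣ diag f m - diag f n ∣ ≤ ε
  close m n pm pn (K , hK) = ≤-trans (triangle (diag f m) (seq (f m) i) (diag f n))
    (≤-trans
      (+-mono-≤ (≤-trans (diag-close f m i jm≤i) pm)
        (≤-trans (triangle (seq (f m) i) (seq (f n) i) (diag f n))
          (+-mono-≤ (hK i K≤i)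
            (≤-trans (≤-reflexive (∣-∣-comm (seq (f n) i) (diag f n)))
              (≤-trans (diag-close f n i jn≤i) pn)))))
      (≤-reflexive 4q))
    where
    j i : ℕ
    j = diagIndex f m ℕ.⊔ diagIndex f n
    i = K ℕ.⊔ j
    K≤i : K ℕ.≤ i
    K≤i = ℕP.m≤m⊔n K j
    jm≤i : diagIndex f m ℕ.≤ i
    jm≤i = ℕP.≤-trans (ℕP.m≤m⊔n (diagIndex f m) (diagIndex f n)) (ℕP.m≤n⊔m K j)
    jn≤i : diagIndex f n ℕ.≤ i
    jn≤i = ℕP.≤-trans (ℕP.m≤n⊔m (diagIndex f m) (diagIndex f n)) (ℕP.m≤n⊔m K j)

  help : (∃[ N ] ∀ m n → N ℕ.≤ m → N ℕ.≤ n → ∣ f m -ᴿ f n ∣ᴿ ≤ᴿ fromℚ q) →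
         (∃[ M ] ∀ n → M ℕ.≤ n → 1/suc n ≤ q) →
         ∃[ N ] ∀ m n → N ℕ.≤ m → N ℕ.≤ n → ∣ diag f m - diag f n ∣ ≤ ε
  help (N , hN) (M , hM) = N ℕ.⊔ M , λ m n hm hn → close m n
    (hM m (ℕP.≤-trans (ℕP.m≤n⊔m N M) hm)) (hM n (ℕP.≤-trans (ℕP.m≤n⊔m N M) hn))
    (hN m n (ℕP.≤-trans (ℕP.m≤m⊔n N M) hm) (ℕP.≤-trans (ℕP.m≤m⊔n N M) hn) q 0<q)

-- The n-th approximant of the limit is a rational within 1/(n+1) of f n.
limᴿ : (f : ℕ → ℝ) → Cauchyᴿ f → ℝ
limᴿ f c = mkℝ (diag f) (cauchy-diag f c)

∑ℚ : ℕ → (ℕ → ℚ) → ℚ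
∑ℚ zero    f = 0ℚ
∑ℚ (suc N) f = ∑ℚ N f + f N

-- 1/(c+1) + 1/(c+2) + … + 1/(c+k)
harmonicBlock : ℕ → ℕ → ℚ
harmonicBlock c k = ∑ℚ k (λ i → + 1 / suc (c ℕ.+ i))

HB = harmonicBlock

HB-++ : ∀ c k l → HB c (k ℕ.+ l) ≡ HB c k + HB (c ℕ.+ k) l
HB-++ c k zero rewrite ℕP.+-identityʳ k = sym (+-identityʳ _)
HB-++ c k (suc l) rewrite ℕP.+-suc k l = trans
  (cong₂ _+_ (HB-++ c k l) (cong 1/suc (sym (ℕP.+-assoc c k l))))
  (+-assoc (HB c k) (HB (c ℕ.+ k) l) _)

×ℚ : ℕ → ℚ → ℚ
×ℚ n q = ∑ℚ n (λ _ → q)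

×ℚ-* : ∀ n p q → ×ℚ n (p * q) ≡ p * ×ℚ n q
×ℚ-* zero p q = sym (*-zeroʳ p)
×ℚ-* (suc n) p q = trans (cong (_+ p * q) (×ℚ-* n p q)) (sym (*-distribˡ-+ p (×ℚ n q) q))

×ℚ-as-/ : ∀ n → ×ℚ n 1ℚ ≡ + n / 1
×ℚ-as-/ zero = refl
×ℚ-as-/ (suc n) = trans (cong (_+ 1ℚ) (×ℚ-as-/ n)) (toℚᵘ-injective (begin
  toℚᵘ (+ n / 1 + 1ℚ)                ≈⟨ toℚᵘ-homo-+ (+ n / 1) 1ℚ ⟩
  toℚᵘ (+ n / 1) ℚᵘ.+ toℚᵘ 1ℚ        ≈⟨ ℚᵘP.+-cong (toℚᵘ-fromℚᵘ (ℚᵘ.mkℚᵘ (+ n) 0)) (toℚᵘ-fromℚᵘ (ℚᵘ.mkℚᵘ (+ 1) 0)) ⟩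
  ℚᵘ.mkℚᵘ (+ n) 0 ℚᵘ.+ ℚᵘ.mkℚᵘ (+ 1) 0 ≈⟨ ℚᵘ.*≡* (cong (ℤ._* + 1) (trans
                                            (cong₂ ℤ._+_ (ℤP.*-identityʳ (+ n)) refl)
                                            (cong +_ (ℕP.+-comm n 1)))) ⟩
  ℚᵘ.mkℚᵘ (+ suc n) 0                ≈⟨ toℚᵘ-fromℚᵘ (ℚᵘ.mkℚᵘ (+ suc n) 0) ⟨
  toℚᵘ (+ suc n / 1)                 ∎))
  where open ℚᵘP.≃-Reasoning

×ℚ-1/suc : ∀ n → ×ℚ (suc n) (1/suc n) ≡ 1ℚ
×ℚ-1/suc n = trans (cong (×ℚ (suc n)) (sym (*-identityʳ (1/suc n))))
  (trans (×ℚ-* (suc n) (1/suc n) 1ℚ)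
  (trans (cong (1/suc n *_) (×ℚ-as-/ (suc n)))
  (toℚᵘ-injective (begin
    toℚᵘ (1/suc n * (+ suc n / 1))               ≈⟨ toℚᵘ-homo-* (1/suc n) (+ suc n / 1) ⟩
    toℚᵘ (1/suc n) ℚᵘ.* toℚᵘ (+ suc n / 1)       ≈⟨ ℚᵘP.*-cong (toℚᵘ-1/suc n) (toℚᵘ-fromℚᵘ (ℚᵘ.mkℚᵘ (+ suc n) 0)) ⟩
    ℚᵘ.mkℚᵘ (+ 1) n ℚᵘ.* ℚᵘ.mkℚᵘ (+ suc n) 0     ≈⟨ ℚᵘ.*≡* (cong +_ (trans (ℕP.*-identityʳ _)
                                                      (trans (ℕP.+-identityʳ (suc n))
                                                      (sym (trans (ℕP.*-identityˡ _) (ℕP.*-identityʳ (suc n))))))) ⟩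
    ℚᵘ.mkℚᵘ (+ 1) 0                              ∎))))
  where open ℚᵘP.≃-Reasoning

∑ℚ-mono : ∀ n {f g : ℕ → ℚ} → (∀ i → i ℕ.< n → f i ≤ g i) → ∑ℚ n f ≤ ∑ℚ n g
∑ℚ-mono zero h = ≤-refl
∑ℚ-mono (suc n) h = +-mono-≤ (∑ℚ-mono n (λ i i<n → h i (ℕP.m≤n⇒m≤1+n i<n))) (h n ℕP.≤-refl)

×ℚ-block : ∀ m c → ×ℚ (suc m) (1/suc c * 1/suc m) ≡ 1/suc c
×ℚ-block m c = trans (×ℚ-* (suc m) (1/suc c) (1/suc m))
  (trans (cong (1/suc c *_) (×ℚ-1/suc m)) (*-identityʳ (1/suc c)))

HB-lower : ∀ m c → 1/suc c ≤ HB (c ℕ.* suc m) (suc m)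
HB-lower m c = ≤-trans (≤-reflexive (sym (×ℚ-block m c)))
  (∑ℚ-mono (suc m) {λ _ → 1/suc c * 1/suc m} {λ i → 1/suc (c ℕ.* suc m ℕ.+ i)} (λ i i<M →
    ≤-trans (≤-reflexive (sym (1/suc-* c m refl)))
      (1/suc-antitone (ℕP.≤-trans (ℕP.+-monoʳ-≤ (c ℕ.* suc m) (ℕP.≤-pred i<M))
        (ℕP.≤-reflexive (ℕP.+-comm (c ℕ.* suc m) m))))))

HB-upper : ∀ m c → HB (suc c ℕ.* suc m) (suc m) ≤ 1/suc c
HB-upper m c = ≤-trans
  (∑ℚ-mono (suc m) {λ i → 1/suc (suc c ℕ.* suc m ℕ.+ i)} {λ _ → 1/suc c * 1/suc m} (λ i i<M →
    ≤-trans (1/suc-antitone (ℕP.≤-trans (ℕP.n≤1+n _) (ℕP.m≤m+n (suc c ℕ.* suc m) i)))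
      (≤-reflexive (1/suc-* c m refl))))
  (≤-reflexive (×ℚ-block m c))

-- Refining the mesh of a right-endpoint sum by a factor m+1 increases it,
-- by at most 1/(a+1) - 1/(a+1+k).
HB-refine : ∀ m a k →
    HB (suc a) k ≤ HB (suc a ℕ.* suc m) (k ℕ.* suc m)
  × HB (suc a ℕ.* suc m) (k ℕ.* suc m) + 1/suc (a ℕ.+ k) ≤ HB (suc a) k + 1/suc a
HB-refine m a zero = ≤-refl , ≤-reflexive (cong (λ j → 0ℚ + 1/suc j) (ℕP.+-identityʳ a))
HB-refine m a (suc k) =
    ≤-trans (+-mono-≤ (proj₁ IH) (HB-lower m (suc a ℕ.+ k))) (≤-reflexive (sym split))
  , (begin
      HB (suc a ℕ.* suc m) (suc k ℕ.* suc m) + 1/suc (a ℕ.+ suc k)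
        ≡⟨ cong₂ _+_ split (cong 1/suc (ℕP.+-suc a k)) ⟩
      X + Y + Z                   ≤⟨ +-monoˡ-≤ Z (+-monoʳ-≤ X (HB-upper m (a ℕ.+ k))) ⟩
      X + 1/suc (a ℕ.+ k) + Z     ≤⟨ +-monoˡ-≤ Z (proj₂ IH) ⟩
      HB (suc a) k + 1/suc a + Z  ≡⟨ swap (HB (suc a) k) (1/suc a) Z ⟩
      HB (suc a) k + Z + 1/suc a  ∎)
  where
  open ≤-Reasoning
  IH = HB-refine m a k
  X = HB (suc a ℕ.* suc m) (k ℕ.* suc m)
  Y = HB ((suc a ℕ.+ k) ℕ.* suc m) (suc m)
  Z = 1/suc (suc a ℕ.+ k)
  swap : ∀ h r z → h + r + z ≡ h + z + r
  swap h r z = trans (+-assoc h r z) (trans (cong (_+_ h) (+-comm r z)) (sym (+-assoc h z r)))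
  split : HB (suc a ℕ.* suc m) (suc k ℕ.* suc m) ≡ X + Y
  split = trans (cong (HB (suc a ℕ.* suc m)) (ℕP.+-comm (suc m) (k ℕ.* suc m)))
    (trans (HB-++ (suc a ℕ.* suc m) (k ℕ.* suc m) (suc m))
      (cong (λ c → X + HB c (suc m)) (sym (ℕP.*-distribʳ-+ (suc m) (suc a) k))))

-- log n = ∫₁ⁿ dt/t.  The right-endpoint Riemann sum with mesh 1/N is
-- ∑_{0<i≤(n-1)N} (1/N) · 1/(1+i/N) = 1/(N+1) + … + 1/(nN);  here N = k + 1.
logApprox : ℕ → ℕ → ℚ
logApprox n k = harmonicBlock (suc k) ((n ℕ.∸ 1) ℕ.* suc k)

cauchy-logApprox : ∀ n → Cauchy (logApprox n)
cauchy-logApprox n ε 0<ε = help (archimedean ε 0<ε)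
  where
  D = n ℕ.∸ 1

  lower : ∀ k m → logApprox n k ≤ HB (suc k ℕ.* suc m) (D ℕ.* suc k ℕ.* suc m)
  lower k m = proj₁ (HB-refine m k (D ℕ.* suc k))

  upper : ∀ k m → HB (suc k ℕ.* suc m) (D ℕ.* suc k ℕ.* suc m) ≤ 1/suc k + logApprox n k
  upper k m = ≤-trans
    (≤-trans (≤-reflexive (sym (+-identityʳ X)))
      (≤-trans (+-monoʳ-≤ X (0≤1/suc (k ℕ.+ D ℕ.* suc k)))
        (proj₂ (HB-refine m k (D ℕ.* suc k)))))
    (≤-reflexive (+-comm (logApprox n k) (1/suc k)))
    where X = HB (suc k ℕ.* suc m) (D ℕ.* suc k ℕ.* suc m)

  common : ∀ k m → HB (suc k ℕ.* suc m) (D ℕ.* suc k ℕ.* suc m)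
                 ≡ HB (suc m ℕ.* suc k) (D ℕ.* suc m ℕ.* suc k)
  common k m = cong₂ HB (ℕP.*-comm (suc k) (suc m))
    (trans (ℕP.*-assoc D (suc k) (suc m))
      (trans (cong (D ℕ.*_) (ℕP.*-comm (suc k) (suc m))) (sym (ℕP.*-assoc D (suc m) (suc k)))))

  diff : ∀ k m → logApprox n k - logApprox n m ≤ 1/suc m
  diff k m = p-q≤ {logApprox n k} {logApprox n m} {1/suc m}
    (≤-trans (lower k m) (≤-trans (≤-reflexive (common k m)) (upper m k)))

  flip : ∀ p q → - (p - q) ≡ q - p
  flip p q = trans (neg-distrib-+ p (- q)) (trans (+-comm (- p) (- - q))
    (cong (_+ - p) (trans (sym (+-identityˡ (- - q))) (trans (cong (_+ - - q) (sym (+-inverseʳ q)))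
      (trans (+-assoc q (- q) (- - q)) (trans (cong (_+_ q) (+-inverseʳ (- q))) (+-identityʳ q)))))))

  help : (∃[ M ] ∀ n → M ℕ.≤ n → 1/suc n ≤ ε) →
    ∃[ N ] ∀ k m → N ℕ.≤ k → N ℕ.≤ m → ∣ logApprox n k - logApprox n m ∣ ≤ ε
  help (M , h) = M , λ k m hk hm → ∣∣≤ {logApprox n k - logApprox n m} {ε}
    (≤-trans (diff k m) (h m hm))
    (≤-trans (≤-reflexive (flip (logApprox n k) (logApprox n m))) (≤-trans (diff m k) (h k hk)))

-- The value at 0 is junk.
log : ℕ → ℝ
log n = mkℝ (logApprox n) (cauchy-logApprox n)

record ℂ : Set where
  constructor mkℂ
  field
    re im : ℝ
open ℂ public

infix  4 _≈_ _⟶_ _≈1/_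
infixl 6 _+ᶜ_ _-ᶜ_
infixl 7 _*ᶜ_
infixr 8 _^ⁿ_ _^_

_≈_ : ℂ → ℂ → Set
z ≈ w = re z ≈ᴿ re w × im z ≈ᴿ im w

fromℝ : ℝ → ℂ
fromℝ x = mkℂ x (fromℚ 0ℚ)

0ᶜ 1ᶜ : ℂ
0ᶜ = fromℝ (fromℚ 0ℚ)
1ᶜ = fromℝ (fromℚ 1ℚ)

_+ᶜ_ : ℂ → ℂ → ℂ
z +ᶜ w = mkℂ (re z +ᴿ re w) (im z +ᴿ im w)

_-ᶜ_ : ℂ → ℂ → ℂ
z -ᶜ w = mkℂ (re z -ᴿ re w) (im z -ᴿ im w)

_*ᶜ_ : ℂ → ℂ → ℂ
z *ᶜ w = mkℂ (re z *ᴿ re w -ᴿ im z *ᴿ im w) (re z *ᴿ im w +ᴿ im z *ᴿ re w)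

_⟶_ : (ℕ → ℂ) → ℂ → Set
f ⟶ z = (λ n → re (f n)) ⟶ᴿ re z × (λ n → im (f n)) ⟶ᴿ im z

-- w = 1/z; in particular z is invertible.
_≈1/_ : ℂ → ℂ → Set
w ≈1/ z = w *ᶜ z ≈ 1ᶜ

_^ⁿ_ : ℂ → ℕ → ℂ
z ^ⁿ zero  = 1ᶜ
z ^ⁿ suc k = z ^ⁿ k *ᶜ z

-- f 0 + … + f (N - 1)
∑ : ℕ → (ℕ → ℂ) → ℂ
∑ zero    f = 0ᶜ
∑ (suc N) f = ∑ N f +ᶜ f N

inv! : ℕ → ℚ
inv! k = (+ 1 / (k !)) {{k !≢0}}

expPartial : ℂ → ℕ → ℂ
expPartial z N = ∑ N (λ k → fromℝ (fromℚ (inv! k)) *ᶜ z ^ⁿ k)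

1/!-suc : ∀ k → inv! (suc k) ≡ inv! k * 1/suc k
1/!-suc k = go (k !) {{k !≢0}} {{suc k !≢0}}
  where
  go : ∀ a .{{p : ℕ.NonZero a}} .{{q : ℕ.NonZero (suc k ℕ.* a)}} →
       (+ 1 / (suc k ℕ.* a)) {{q}} ≡ (+ 1 / a) {{p}} * 1/suc k
  go (suc j) = trans (1/suc-* k j refl) (*-comm (1/suc k) (1/suc j))

0≤1/! : ∀ k → 0ℚ ≤ inv! k
0≤1/! k = go (k !) {{k !≢0}}
  where
  go : ∀ a .{{p : ℕ.NonZero a}} → 0ℚ ≤ (+ 1 / a) {{p}}
  go (suc j) = 0≤1/suc j

∥_∥ : ℂ → ℕ → ℚ
∥ z ∥ i = ∣ seq (re z) i ∣ + ∣ seq (im z) i ∣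

0≤∥∥ : ∀ z i → 0ℚ ≤ ∥ z ∥ i
0≤∥∥ z i = +-mono-≤ (0≤∣p∣ (seq (re z) i)) (0≤∣p∣ (seq (im z) i))

re≤∥∥ : ∀ z i → ∣ seq (re z) i ∣ ≤ ∥ z ∥ i
re≤∥∥ z i = ≤-trans (≤-reflexive (sym (+-identityʳ _)))
  (+-monoʳ-≤ ∣ seq (re z) i ∣ (0≤∣p∣ (seq (im z) i)))

im≤∥∥ : ∀ z i → ∣ seq (im z) i ∣ ≤ ∥ z ∥ i
im≤∥∥ z i = ≤-trans (≤-reflexive (sym (+-identityˡ _)))
  (+-monoˡ-≤ ∣ seq (im z) i ∣ (0≤∣p∣ (seq (re z) i)))

norm-* : ∀ a b c d →
  ∣ a * c - b * d ∣ + ∣ a * d + b * c ∣ ≤ (∣ a ∣ + ∣ b ∣) * (∣ c ∣ + ∣ d ∣)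
norm-* a b c d = ≤-trans
  (+-mono-≤ (∣p-q∣≤∣p∣+∣q∣ (a * c) (b * d)) (∣p+q∣≤∣p∣+∣q∣ (a * d) (b * c)))
  (≤-reflexive (trans
    (cong₂ _+_ (cong₂ _+_ (∣p*q∣≡∣p∣*∣q∣ a c) (∣p*q∣≡∣p∣*∣q∣ b d))
               (cong₂ _+_ (∣p*q∣≡∣p∣*∣q∣ a d) (∣p*q∣≡∣p∣*∣q∣ b c)))
    (expand (∣ a ∣) (∣ b ∣) (∣ c ∣) (∣ d ∣))))
  where
  open +-*-Solver
  expand : ∀ a b c d → a * c + b * d + (a * d + b * c) ≡ (a + b) * (c + d)
  expand = solve 4 (λ a b c d →
    a :* c :+ b :* d :+ (a :* d :+ b :* c) := (a :+ b) :* (c :+ d)) refl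

∥*∥ : ∀ z w i → ∥ z *ᶜ w ∥ i ≤ ∥ z ∥ i * ∥ w ∥ i
∥*∥ z w i = norm-* (seq (re z) i) (seq (im z) i) (seq (re w) i) (seq (im w) i)

pow : ℚ → ℕ → ℚ
pow B zero    = 1ℚ
pow B (suc k) = pow B k * B

0≤pow : ∀ {B} → 0ℚ ≤ B → ∀ k → 0ℚ ≤ pow B k
0≤pow 0≤B zero    = <⇒≤ (positive⁻¹ 1ℚ)
0≤pow 0≤B (suc k) = 0≤* (0≤pow 0≤B k) 0≤B

∥^∥ : ∀ z i B → ∥ z ∥ i ≤ B → ∀ k → ∥ z ^ⁿ k ∥ i ≤ pow B k
∥^∥ z i B h zero    = ≤-refl
∥^∥ z i B h (suc k) = ≤-trans (∥*∥ (z ^ⁿ k) z i)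
  (*-mono-≤₀ (0≤∥∥ (z ^ⁿ k) i) (≤-trans (0≤∥∥ z i) h) (∥^∥ z i B h k) h)

majorant : ℚ → ℕ → ℚ
majorant B k = inv! k * pow B k

∥expTerm∥ : ∀ z i B → ∥ z ∥ i ≤ B → ∀ k →
  ∥ fromℝ (fromℚ (inv! k)) *ᶜ z ^ⁿ k ∥ i ≤ majorant B k
∥expTerm∥ z i B h k = ≤-trans (∥*∥ (fromℝ (fromℚ (inv! k))) (z ^ⁿ k) i)
  (*-mono-≤₀ (0≤∥∥ (fromℝ (fromℚ (inv! k))) i) (0≤pow (≤-trans (0≤∥∥ z i) h) k)
    (≤-reflexive (trans (+-identityʳ ∣ inv! k ∣) (0≤p⇒∣p∣≡p (0≤1/! k))))
    (∥^∥ z i B h k))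

0≤majorant : ∀ {B} → 0ℚ ≤ B → ∀ k → 0ℚ ≤ majorant B k
0≤majorant 0≤B k = 0≤* (0≤1/! k) (0≤pow 0≤B k)

majorant-step : ∀ {B} → 0ℚ ≤ B → ∀ k → B * 1/suc k ≤ ½ → majorant B (suc k) ≤ ½ * majorant B k
majorant-step {B} 0≤B k h = begin
  inv! (suc k) * (pow B k * B)       ≡⟨ cong (_* (pow B k * B)) (1/!-suc k) ⟩
  inv! k * 1/suc k * (pow B k * B)   ≡⟨ shuffle (inv! k) (1/suc k) (pow B k) B ⟩
  B * 1/suc k * majorant B k         ≤⟨ *-monoʳ-≤-nonNeg (majorant B k) {{nonNegative (0≤majorant 0≤B k)}} h ⟩
  ½ * majorant B k                   ∎
  where
  open ≤-Reasoning
  open +-*-Solver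
  shuffle : ∀ f s p b → f * s * (p * b) ≡ b * s * (f * p)
  shuffle = solve 4 (λ f s p b → f :* s :* (p :* b) := b :* s :* (f :* p)) refl

½*1/suc : ∀ j → ½ * 1/suc j ≤ 1/suc (suc j)
½*1/suc j = ≤-trans (≤-reflexive (sym (1/suc-* 1 j {j ℕ.+ suc (j ℕ.+ 0)} refl)))
  (1/suc-antitone (ℕP.≤-trans (s≤s (ℕP.m≤m+n j (j ℕ.+ 0))) (ℕP.≤-reflexive (sym (ℕP.+-suc j (j ℕ.+ 0))))))

halving : (t : ℕ → ℚ) (K : ℕ) → (∀ k → 0ℚ ≤ t k) →
  (∀ k → K ℕ.≤ k → t (suc k) ≤ ½ * t k) →
  ∀ j → t (K ℕ.+ j) ≤ t K * 1/suc j
halving t K 0≤t h zero = ≤-reflexive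
  (trans (cong t (ℕP.+-identityʳ K)) (sym (*-identityʳ (t K))))
halving t K 0≤t h (suc j) = begin
  t (K ℕ.+ suc j)       ≡⟨ cong t (ℕP.+-suc K j) ⟩
  t (suc (K ℕ.+ j))     ≤⟨ h (K ℕ.+ j) (ℕP.m≤m+n K j) ⟩
  ½ * t (K ℕ.+ j)       ≤⟨ *-monoˡ-≤-nonNeg ½ (halving t K 0≤t h j) ⟩
  ½ * (t K * 1/suc j)   ≡⟨ trans (sym (*-assoc ½ (t K) (1/suc j)))
                             (trans (cong (_* 1/suc j) (*-comm ½ (t K))) (*-assoc (t K) ½ (1/suc j))) ⟩
  t K * (½ * 1/suc j)   ≤⟨ *-monoˡ-≤-nonNeg (t K) {{nonNegative (0≤t K)}} (½*1/suc j) ⟩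
  t K * 1/suc (suc j)   ∎
  where open ≤-Reasoning

tail : (t s : ℕ → ℚ) (K : ℕ) → (∀ k → 0ℚ ≤ t k) →
  (∀ k → K ℕ.≤ k → t (suc k) ≤ ½ * t k) →
  (∀ k → ∣ s (suc k) - s k ∣ ≤ t k) →
  ∀ m → K ℕ.≤ m → ∀ d → ∣ s (m ℕ.+ d) - s m ∣ + (t (m ℕ.+ d) + t (m ℕ.+ d)) ≤ t m + t m
tail t s K 0≤t h hs m K≤m zero = ≤-reflexive (begin
  ∣ s (m ℕ.+ 0) - s m ∣ + (t (m ℕ.+ 0) + t (m ℕ.+ 0))
    ≡⟨ cong (λ j → ∣ s j - s m ∣ + (t j + t j)) (ℕP.+-identityʳ m) ⟩
  ∣ s m - s m ∣ + (t m + t m) ≡⟨ cong (λ x → ∣ x ∣ + (t m + t m)) (+-inverseʳ (s m)) ⟩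
  0ℚ + (t m + t m) ≡⟨ +-identityˡ _ ⟩
  t m + t m ∎)
  where open ≡-Reasoning
tail t s K 0≤t h hs m K≤m (suc d) = begin
  ∣ s (m ℕ.+ suc d) - s m ∣ + (t (m ℕ.+ suc d) + t (m ℕ.+ suc d))
    ≡⟨ cong (λ j → ∣ s j - s m ∣ + (t j + t j)) (ℕP.+-suc m d) ⟩
  ∣ s (suc n) - s m ∣ + (t (suc n) + t (suc n))
    ≤⟨ +-mono-≤ (triangle (s (suc n)) (s n) (s m)) (+-mono-≤ step step) ⟩
  (∣ s (suc n) - s n ∣ + ∣ s n - s m ∣) + (½ * t n + ½ * t n)
    ≤⟨ +-mono-≤ (+-monoˡ-≤ ∣ s n - s m ∣ (hs n)) (≤-reflexive (½+½ (t n))) ⟩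
  (t n + ∣ s n - s m ∣) + t n
    ≡⟨ trans (cong (_+ t n) (+-comm (t n) ∣ s n - s m ∣)) (+-assoc ∣ s n - s m ∣ (t n) (t n)) ⟩
  ∣ s n - s m ∣ + (t n + t n)
    ≤⟨ tail t s K 0≤t h hs m K≤m d ⟩
  t m + t m ∎
  where
  open ≤-Reasoning
  n = m ℕ.+ d
  step : t (suc n) ≤ ½ * t n
  step = h n (ℕP.≤-trans K≤m (ℕP.m≤m+n m d))

cauchy-dominated : (S : ℕ → ℝ) (t : ℕ → ℚ) (K I : ℕ) → (∀ k → 0ℚ ≤ t k) →
  (∀ k → K ℕ.≤ k → t (suc k) ≤ ½ * t k) →
  (∀ i → I ℕ.≤ i → ∀ k → ∣ seq (S (suc k)) i - seq (S k) i ∣ ≤ t k) →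
  Cauchyᴿ S
cauchy-dominated S t K I 0≤t h hS ε 0<ε = help (divide 0<ε 0<C)
  where
  C : ℚ
  C = 1ℚ + (t K + t K)
  0≤2t : 0ℚ ≤ t K + t K
  0≤2t = +-mono-≤ (0≤t K) (0≤t K)
  0<C : 0ℚ < C
  0<C = <-≤-trans (positive⁻¹ 1ℚ)
    (≤-trans (≤-reflexive (sym (+-identityʳ 1ℚ))) (+-monoʳ-≤ 1ℚ 0≤2t))

  finish : ∀ {δ} → 0ℚ < δ → C * δ ≡ ε → (∃[ M ] ∀ n → M ℕ.≤ n → 1/suc n ≤ δ) →
    ∃[ N ] ∀ m n → N ℕ.≤ m → N ℕ.≤ n → ∣ S m -ᴿ S n ∣ᴿ ≤ᴿ fromℚ ε
  finish {δ} 0<δ eq (M , hM) = K ℕ.+ M , λ m n hm hn η 0<η → I , λ i hi →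
    ≤-trans (both m n hm hn i hi)
      (≤-trans (≤-reflexive (sym (+-identityʳ ε))) (+-monoʳ-≤ ε (<⇒≤ 0<η)))
    where
    small : ∀ m → K ℕ.+ M ℕ.≤ m → t m + t m ≤ ε
    small m hm = begin
      t m + t m                    ≡⟨ cong (λ j → t j + t j) (sym (ℕP.m+[n∸m]≡n K≤m)) ⟩
      t (K ℕ.+ j) + t (K ℕ.+ j)    ≤⟨ +-mono-≤ (halving t K 0≤t h j) (halving t K 0≤t h j) ⟩
      t K * 1/suc j + t K * 1/suc j ≡⟨ sym (*-distribʳ-+ (1/suc j) (t K) (t K)) ⟩
      (t K + t K) * 1/suc j        ≤⟨ *-mono-≤₀ 0≤2t (<⇒≤ 0<δ) 2t≤C (hM j M≤j) ⟩
      C * δ                        ≡⟨ eq ⟩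
      ε                            ∎
      where
      open ≤-Reasoning
      j = m ℕ.∸ K
      K≤m : K ℕ.≤ m
      K≤m = ℕP.≤-trans (ℕP.m≤m+n K M) hm
      M≤j : M ℕ.≤ j
      M≤j = ℕP.≤-trans (ℕP.≤-reflexive (sym (ℕP.m+n∸m≡n K M))) (ℕP.∸-monoˡ-≤ K hm)
      2t≤C : t K + t K ≤ C
      2t≤C = ≤-trans (≤-reflexive (sym (+-identityˡ _)))
        (+-monoˡ-≤ (t K + t K) (<⇒≤ (positive⁻¹ 1ℚ)))

    one : ∀ m n → K ℕ.+ M ℕ.≤ m → m ℕ.≤ n → ∀ i → I ℕ.≤ i → ∣ seq (S n) i - seq (S m) i ∣ ≤ ε
    one m n hm m≤n i hi = begin
      ∣ seq (S n) i - seq (S m) i ∣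
        ≡⟨ cong (λ j → ∣ seq (S j) i - seq (S m) i ∣) (sym (ℕP.m+[n∸m]≡n m≤n)) ⟩
      X            ≡⟨ sym (+-identityʳ X) ⟩
      X + 0ℚ       ≤⟨ +-monoʳ-≤ X (+-mono-≤ (0≤t (m ℕ.+ d)) (0≤t (m ℕ.+ d))) ⟩
      X + (t (m ℕ.+ d) + t (m ℕ.+ d))
        ≤⟨ tail t (λ k → seq (S k) i) K 0≤t h (hS i hi) m (ℕP.≤-trans (ℕP.m≤m+n K M) hm) d ⟩
      t m + t m    ≤⟨ small m hm ⟩
      ε            ∎
      where
      open ≤-Reasoning
      d = n ℕ.∸ m
      X = ∣ seq (S (m ℕ.+ d)) i - seq (S m) i ∣

    both : ∀ m n → K ℕ.+ M ℕ.≤ m → K ℕ.+ M ℕ.≤ n → ∀ i → I ℕ.≤ i →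
      ∣ seq (S m) i - seq (S n) i ∣ ≤ ε
    both m n hm hn i hi with ℕP.≤-total m n
    ... | inj₁ m≤n = ≤-trans (≤-reflexive (∣-∣-comm (seq (S m) i) (seq (S n) i))) (one m n hm m≤n i hi)
    ... | inj₂ n≤m = one n m hn n≤m i hi

  help : (∃[ δ ] (0ℚ < δ × C * δ ≡ ε)) →
    ∃[ N ] ∀ m n → N ℕ.≤ m → N ℕ.≤ n → ∣ S m -ᴿ S n ∣ᴿ ≤ᴿ fromℚ ε
  help (δ , 0<δ , eq) = finish 0<δ eq (archimedean δ 0<δ)

add-sub : ∀ p q → (p + q) - p ≡ q
add-sub p q = trans (cong (_- p) (+-comm p q))
  (trans (+-assoc q p (- p)) (trans (cong (_+_ q) (+-inverseʳ p)) (+-identityʳ q)))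

cauchy-exp : ∀ z → Cauchyᴿ (λ N → re (expPartial z N)) × Cauchyᴿ (λ N → im (expPartial z N))
cauchy-exp z = help (eventuallyBounded (re z)) (eventuallyBounded (im z))
  where
  Bounded : ℝ → Set
  Bounded x = ∃[ B ] (0ℚ < B × ∃[ N ] ∀ n → N ℕ.≤ n → ∣ seq x n ∣ ≤ B)

  help : Bounded (re z) → Bounded (im z) →
    Cauchyᴿ (λ N → re (expPartial z N)) × Cauchyᴿ (λ N → im (expPartial z N))
  help (A , 0<A , M₁ , boundA) (A′ , 0<A′ , M₂ , boundA′) =
    go (divide (positive⁻¹ ½) 0<B)
    where
    B : ℚ
    B = A + A′
    0<B : 0ℚ < B
    0<B = positive⁻¹ B {{pos+pos⇒pos A {{positive 0<A}} A′ {{positive 0<A′}}}}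
    0≤B : 0ℚ ≤ B
    0≤B = <⇒≤ 0<B
    I : ℕ
    I = M₁ ℕ.⊔ M₂
    bound : ∀ i → I ℕ.≤ i → ∥ z ∥ i ≤ B
    bound i hi = +-mono-≤ (boundA i (ℕP.≤-trans (ℕP.m≤m⊔n M₁ M₂) hi))
                          (boundA′ i (ℕP.≤-trans (ℕP.m≤n⊔m M₁ M₂) hi))
    term : ℕ → ℂ
    term k = fromℝ (fromℚ (inv! k)) *ᶜ z ^ⁿ k

    finish : ∀ δ → B * δ ≡ ½ → (∃[ K ] ∀ n → K ℕ.≤ n → 1/suc n ≤ δ) →
      Cauchyᴿ (λ N → re (expPartial z N)) × Cauchyᴿ (λ N → im (expPartial z N))
    finish δ eq (K , hK) =
      cauchy-dominated (λ N → re (expPartial z N)) (majorant B) K I (0≤majorant 0≤B) halves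
        (λ i hi k → ≤-trans
          (≤-reflexive (cong ∣_∣ (add-sub (seq (re (expPartial z k)) i) (seq (re (term k)) i))))
          (≤-trans (re≤∥∥ (term k) i) (∥expTerm∥ z i B (bound i hi) k))) ,
      cauchy-dominated (λ N → im (expPartial z N)) (majorant B) K I (0≤majorant 0≤B) halves
        (λ i hi k → ≤-trans
          (≤-reflexive (cong ∣_∣ (add-sub (seq (im (expPartial z k)) i) (seq (im (term k)) i))))
          (≤-trans (im≤∥∥ (term k) i) (∥expTerm∥ z i B (bound i hi) k)))
      where
      halves : ∀ k → K ℕ.≤ k → majorant B (suc k) ≤ ½ * majorant B k
      halves k hk = majorant-step 0≤B k (≤-trans
        (*-monoˡ-≤-nonNeg B {{nonNegative 0≤B}} (hK k hk)) (≤-reflexive eq))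

    go : (∃[ δ ] (0ℚ < δ × B * δ ≡ ½)) →
      Cauchyᴿ (λ N → re (expPartial z N)) × Cauchyᴿ (λ N → im (expPartial z N))
    go (δ , 0<δ , eq) = finish δ eq (archimedean δ 0<δ)

exp : ℂ → ℂ
exp z = mkℂ (limᴿ (λ N → re (expPartial z N)) (proj₁ (cauchy-exp z)))
            (limᴿ (λ N → im (expPartial z N)) (proj₂ (cauchy-exp z)))

-- Meaningful for n ≥ 1 only, since log 0 is junk.
_^_ : ℕ → ℂ → ℂ
n ^ s = exp (s *ᶜ fromℝ (log n))

-- ∑ℙ N f and ∏ℙ N f range over the primes p ≤ N.

∑ℙ : ℕ → (ℕ → ℂ) → ℂ
∑ℙ zero    f = 0ᶜ
∑ℙ (suc N) f = if does (prime? (suc N)) then ∑ℙ N f +ᶜ f (suc N) else ∑ℙ N f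

∏ℙ : ℕ → (ℕ → ℂ) → ℂ
∏ℙ zero    f = 1ᶜ
∏ℙ (suc N) f = if does (prime? (suc N)) then ∏ℙ N f *ᶜ f (suc N) else ∏ℙ N f

{-# OPTIONS --safe #-}
-- With a n = n⁻ˢ, everything follows from complete multiplicativity of a and
-- a telescoping bound |a (n + 1)| ≤ G n − G (n + 1) with G → 0.
--
-- The bound: for τ = 1 + δ ≤ Re s put F n = (n + 1) n^(-τ).  From eˣ ≥ 1 + x
-- and log (n + 1) − log n ≥ 1 / (n + 1) one gets F n − F (n + 1) ≥ δ (n + 1)^(-τ);
-- F → 0 because F n (1 + δ (1/3 + … + 1/(n + 1))) decreases.  Finally |e^z| is
-- at most a constant times e^(Re z), since e^(iy) times its conjugate is 1.
--
-- Euler's sieve: if A N = ∏_{p ≤ N} (1 − a p), then A N ζ is the sum of a n over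
-- the n without prime factors ≤ N, so A N ζ → 1.  The tail products
-- b N = ∏_{p > N} (1 − a p) converge, and A N b N = b 0 is the inverse of ζ.
-- Hence ζ b p is the inverse of A p, and the second series telescopes:
-- a p ζ b p = ζ b p − ζ b (p − 1), where b N → 1.

module Submission where

open import Algebra.Bundles using (CommutativeRing)
open import Algebra.Consequences.Setoid using (comm∧idˡ⇒id; comm∧invˡ⇒inv; comm∧distrˡ⇒distr)
import Algebra.Solver.Ring
open import Algebra.Solver.Ring.AlmostCommutativeRing
  using (AlmostCommutativeRing; fromCommutativeRing; _-Raw-AlmostCommutative⟶_)
open import Data.Bool.Base using (Bool; true; false; not; _∧_; if_then_else_)
import Data.Bool.Properties as BoolP
open import Data.List.Base using ([]; _∷_)
open import Data.List.Relation.Unary.All using (_∷_)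
import Data.Maybe.Base as Maybe
open import Data.Nat.Base as ℕ using (ℕ; zero; suc; NonZero; s≤s; z≤n)
open import Data.Nat.DivMod using (m≡m%n+[m/n]*n; m%n<n; m*n/n≡m; /-monoˡ-≤)
open import Data.Nat.Divisibility
  using (_∣_; _∤_; _∣?_; ∣⇒≤; ∣1⇒≡1; n∣m*n; m∣m*n; ∣m⇒∣m*n; ∣m+n∣m⇒∣n)
open import Data.Nat.Primality
  using (Prime; prime?; prime⇒nonZero; prime⇒irreducible; euclidsLemma; ¬prime[1])
open import Data.Nat.Primality.Factorisation using (PrimeFactorisation; factorise)
import Data.Nat.Properties as ℕP
open import Data.Product.Base using (Σ-syntax; ∃-syntax; _×_; _,_; proj₁; proj₂)
open import Data.Rational.Base hiding (NonZero; _≃_)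
import Data.Rational.Properties as ℚP
open import Data.Rational.Solver using (module +-*-Solver)
open import Data.Sum.Base using (inj₁; inj₂)
open import Defs
open import Function.Bundles using (mk⇔)
open import Level using (0ℓ)
open import Relation.Binary.Bundles using (Preorder; Setoid)
open import Relation.Binary.PropositionalEquality using (_≡_; refl; sym; trans; cong; cong₂; subst)
import Relation.Binary.Reasoning.Preorder
import Relation.Binary.Reasoning.Setoid
open import Relation.Nullary.Decidable
  using (Dec; yes; no; does; dec-true; dec-false; does-⇔; dec⇒maybe)
open import Relation.Nullary.Negation using (¬_; contradiction)

-- Real numbers

-- The reals are Cauchy sequences with no decidable order and no square root or reciprocal function
-- at hand, and this shapes the proof. Every inverse is exhibited by a product equal to 1, so no
-- factor 1 - a p has to be shown nonzero. Complex size is measured by |Re| + |Im|, at the price of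
-- a factor 2 on the unit circle. The strict inequality 1 < Re s supplies a rational δ, and every
-- division in the estimates is a division of rationals.
--
-- F n is close to n^(-δ), which is δ times the integral of x^(-τ) from n to infinity; it is a
-- discrete version of the integral test. The shift n + 1 makes it telescope: (n + 1)(1 + τ/(n + 1))
-- = (n + 2) + δ, where 1 + τ/(n + 1) is the ratio of consecutive powers guaranteed by eˣ ≥ 1 + x.
-- That F tends to 0 is drawn from the divergence of the harmonic series, without comparing n^(-δ)
-- with anything explicit.
--
-- The same G bounds the tails of the series and, doubled, the distance of the tail products from 1,
-- so the product needs no logarithms.

Eventually : (ℕ → Set) → Set
Eventually P = ∃[ N ] ∀ n → N ℕ.≤ n → P n

always : {P : ℕ → Set} → (∀ n → P n) → Eventually P
always p = 0 , λ n _ → p n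

eventually-map : {P Q : ℕ → Set} → (∀ n → P n → Q n) → Eventually P → Eventually Q
eventually-map f (N , p) = N , λ n hn → f n (p n hn)

eventually-zip : {P Q R : ℕ → Set} → (∀ n → P n → Q n → R n) →
  Eventually P → Eventually Q → Eventually R
eventually-zip f (M , p) (N , q) = M ℕ.⊔ N , λ n hn →
  f n (p n (ℕP.≤-trans (ℕP.m≤m⊔n M N) hn)) (q n (ℕP.≤-trans (ℕP.m≤n⊔m M N) hn))

0<1 : 0ℚ < 1ℚ
0<1 = ℚP.positive⁻¹ 1ℚ

0<+ : ∀ {p q} → 0ℚ < p → 0ℚ < q → 0ℚ < p + q
0<+ = ℚP.+-mono-<

-- Records rather than the functions of Defs, so that the two sides can be
-- inferred by unification.

infix 4 _≃_ _≼_

record _≃_ (x y : ℝ) : Set where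
  constructor mk≃
  field un≃ : x ≈ᴿ y

record _≼_ (x y : ℝ) : Set where
  constructor mk≼
  field un≼ : x ≤ᴿ y
open _≼_

pointwise : ∀ {x y} → (∀ n → seq x n ≡ seq y n) → x ≃ y
pointwise {x} {y} h = mk≃ λ ε 0<ε → always λ n →
  subst (λ q → ∣ seq x n - q ∣ ≤ ε) (h n)
    (subst (_≤ ε) (sym (cong ∣_∣ (ℚP.+-inverseʳ (seq x n)))) (ℚP.<⇒≤ 0<ε))

≃-refl : ∀ {x} → x ≃ x
≃-refl = pointwise λ _ → refl

≡⇒≃ : ∀ {x y} → x ≡ y → x ≃ y
≡⇒≃ refl = ≃-refl

≃-sym : ∀ {x y} → x ≃ y → y ≃ x
≃-sym {x} {y} (mk≃ h) = mk≃ λ ε 0<ε →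
  eventually-map (λ n → subst (_≤ ε) (∣-∣-comm (seq x n) (seq y n))) (h ε 0<ε)

≃-trans : ∀ {x y z} → x ≃ y → y ≃ z → x ≃ z
≃-trans {x} {y} {z} (mk≃ h) (mk≃ k) = mk≃ λ ε 0<ε →
  eventually-zip (λ n p q → ℚP.≤-trans (triangle (seq x n) (seq y n) (seq z n))
    (subst (_ ≤_) (½+½ ε) (ℚP.+-mono-≤ p q))) (h _ (0<½* 0<ε)) (k _ (0<½* 0<ε))

opaque
  quotient : ∀ {ε B} → 0ℚ < ε → 0ℚ < B → ∃[ δ ] (0ℚ < δ × B * δ ≡ ε)
  quotient = divide

-- Bounds on p and s are enough, since `dist-*` writes the difference as p (q - s) + (p - r) s.
*-close : ∀ {A B δ ε} p q r s → 0ℚ ≤ δ → 0ℚ ≤ B → (A + B) * δ ≡ ε →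
  ∣ p ∣ ≤ A → ∣ s ∣ ≤ B → ∣ p - r ∣ ≤ δ → ∣ q - s ∣ ≤ δ → ∣ p * q - r * s ∣ ≤ ε
*-close {A} {B} {δ} {ε} p q r s 0≤δ 0≤B eq hp hs hpr hqs = begin
  ∣ p * q - r * s ∣                        ≤⟨ dist-* p q r s ⟩
  ∣ p ∣ * ∣ q - s ∣ + ∣ p - r ∣ * ∣ s ∣
    ≤⟨ ℚP.+-mono-≤ (*-mono-≤₀ {∣ p ∣} {A} (ℚP.0≤∣p∣ p) 0≤δ hp hqs)
                   (*-mono-≤₀ {∣ p - r ∣} {δ} (ℚP.0≤∣p∣ (p - r)) 0≤B hpr hs) ⟩
  A * δ + δ * B                            ≡⟨ cong (A * δ +_) (ℚP.*-comm δ B) ⟩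
  A * δ + B * δ                            ≡⟨ ℚP.*-distribʳ-+ δ A B ⟨
  (A + B) * δ                              ≡⟨ eq ⟩
  ε                                        ∎
  where open ℚP.≤-Reasoning

Bounded : ℝ → Set
Bounded x = ∃[ B ] (0ℚ < B × Eventually λ n → ∣ seq x n ∣ ≤ B)

-- The operations of Defs made opaque: comparing unfolded reals would compare
-- their Cauchy proofs.

infixl 6 _⊕_ _⊝_
infixl 7 _⊗_
infix  8 ⊖_

opaque
  _⊕_ _⊗_ : ℝ → ℝ → ℝ
  _⊕_ = _+ᴿ_
  _⊗_ = _*ᴿ_

  ⊖_ abs : ℝ → ℝ
  ⊖ x = -ᴿ x
  abs x = ∣ x ∣ᴿ

  ι : ℚ → ℝ
  ι = fromℚ

_⊝_ : ℝ → ℝ → ℝ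
x ⊝ y = x ⊕ ⊖ y

opaque
  unfolding _⊕_ _⊗_ ⊖_ abs ι

  ⊕-cong : ∀ {x y u v} → x ≃ y → u ≃ v → x ⊕ u ≃ y ⊕ v
  ⊕-cong {x} {y} {u} {v} (mk≃ h) (mk≃ k) = mk≃ λ ε 0<ε →
    eventually-zip (λ n p q → ℚP.≤-trans (dist-+ (seq x n) (seq u n) (seq y n) (seq v n))
      (subst (_ ≤_) (½+½ ε) (ℚP.+-mono-≤ p q))) (h _ (0<½* 0<ε)) (k _ (0<½* 0<ε))

  ⊖-cong : ∀ {x y} → x ≃ y → ⊖ x ≃ ⊖ y
  ⊖-cong {x} {y} (mk≃ h) = mk≃ λ ε 0<ε →
    eventually-map (λ n → subst (_≤ ε) (sym (dist-neg (seq x n) (seq y n)))) (h ε 0<ε)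

  abs-cong : ∀ {x y} → x ≃ y → abs x ≃ abs y
  abs-cong {x} {y} (mk≃ h) = mk≃ λ ε 0<ε →
    eventually-map (λ n → ℚP.≤-trans (dist-∣∣ (seq x n) (seq y n))) (h ε 0<ε)

  ⊗-cong : ∀ {x y u v} → x ≃ y → u ≃ v → x ⊗ u ≃ y ⊗ v
  ⊗-cong {x} {y} {u} {v} (mk≃ h) (mk≃ k) = mk≃ λ ε 0<ε →
    go (eventuallyBounded x) (eventuallyBounded v) 0<ε
    where
    go : Bounded x → Bounded v → ∀ {ε} → 0ℚ < ε →
      Eventually λ n → ∣ seq x n * seq u n - seq y n * seq v n ∣ ≤ ε
    go (A , 0<A , bx) (B , 0<B , bv) {ε} 0<ε = close (quotient 0<ε (0<+ 0<A 0<B))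
      where
      close : ∃[ δ ] (0ℚ < δ × (A + B) * δ ≡ ε) →
        Eventually λ n → ∣ seq x n * seq u n - seq y n * seq v n ∣ ≤ ε
      close (δ , 0<δ , eq) = eventually-zip
        (λ n (hx , hv) (hxy , huv) →
          *-close (seq x n) (seq u n) (seq y n) (seq v n) (ℚP.<⇒≤ 0<δ) (ℚP.<⇒≤ 0<B) eq hx hv hxy huv)
        (eventually-zip (λ _ → _,_) bx bv)
        (eventually-zip (λ _ → _,_) (h δ 0<δ) (k δ 0<δ))


  ⊕-assoc : ∀ x y z → x ⊕ y ⊕ z ≃ x ⊕ (y ⊕ z)
  ⊕-assoc x y z = pointwise λ n → ℚP.+-assoc (seq x n) (seq y n) (seq z n)

  ⊕-comm : ∀ x y → x ⊕ y ≃ y ⊕ x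
  ⊕-comm x y = pointwise λ n → ℚP.+-comm (seq x n) (seq y n)

  ⊕-identityˡ : ∀ x → ι 0ℚ ⊕ x ≃ x
  ⊕-identityˡ x = pointwise λ n → ℚP.+-identityˡ (seq x n)

  ⊕-inverseˡ : ∀ x → ⊖ x ⊕ x ≃ ι 0ℚ
  ⊕-inverseˡ x = pointwise λ n → ℚP.+-inverseˡ (seq x n)

  ⊗-assoc : ∀ x y z → x ⊗ y ⊗ z ≃ x ⊗ (y ⊗ z)
  ⊗-assoc x y z = pointwise λ n → ℚP.*-assoc (seq x n) (seq y n) (seq z n)

  ⊗-comm : ∀ x y → x ⊗ y ≃ y ⊗ x
  ⊗-comm x y = pointwise λ n → ℚP.*-comm (seq x n) (seq y n)

  ⊗-identityˡ : ∀ x → ι 1ℚ ⊗ x ≃ x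
  ⊗-identityˡ x = pointwise λ n → ℚP.*-identityˡ (seq x n)

  ⊗-distribˡ-⊕ : ∀ x y z → x ⊗ (y ⊕ z) ≃ x ⊗ y ⊕ x ⊗ z
  ⊗-distribˡ-⊕ x y z = pointwise λ n → ℚP.*-distribˡ-+ (seq x n) (seq y n) (seq z n)

  ι-+ : ∀ p q → ι (p + q) ≃ ι p ⊕ ι q
  ι-+ p q = pointwise λ _ → refl

  ι-* : ∀ p q → ι (p * q) ≃ ι p ⊗ ι q
  ι-* p q = pointwise λ _ → refl

  ι-neg : ∀ p → ι (- p) ≃ ⊖ ι p
  ι-neg p = pointwise λ _ → refl

ℝ-setoid : Setoid 0ℓ 0ℓ
ℝ-setoid = record
  { Carrier = ℝ
  ; _≈_ = _≃_
  ; isEquivalence = record { refl = ≃-refl ; sym = ≃-sym ; trans = ≃-trans }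
  }

ℝ-commutativeRing : CommutativeRing 0ℓ 0ℓ
ℝ-commutativeRing = record
  { Carrier = ℝ
  ; _≈_ = _≃_
  ; _+_ = _⊕_
  ; _*_ = _⊗_
  ; -_ = ⊖_
  ; 0# = ι 0ℚ
  ; 1# = ι 1ℚ
  ; isCommutativeRing = record
    { isRing = record
      { +-isAbelianGroup = record
        { isGroup = record
          { isMonoid = record
            { isSemigroup = record
              { isMagma = record
                { isEquivalence = Setoid.isEquivalence ℝ-setoid
                ; ∙-cong = ⊕-cong
                }
              ; assoc = ⊕-assoc
              }
            ; identity = comm∧idˡ⇒id ℝ-setoid ⊕-comm ⊕-identityˡ
            }
          ; inverse = comm∧invˡ⇒inv ℝ-setoid ⊕-comm ⊕-inverseˡ
          ; ⁻¹-cong = ⊖-cong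
          }
        ; comm = ⊕-comm
        }
      ; *-cong = ⊗-cong
      ; *-assoc = ⊗-assoc
      ; *-identity = comm∧idˡ⇒id ℝ-setoid ⊗-comm ⊗-identityˡ
      ; distrib = comm∧distrˡ⇒distr ℝ-setoid ⊕-cong ⊗-comm ⊗-distribˡ-⊕
      }
    ; *-comm = ⊗-comm
    }
  }

ℝ-almostCommutativeRing : AlmostCommutativeRing 0ℓ 0ℓ
ℝ-almostCommutativeRing = fromCommutativeRing ℝ-commutativeRing

ι-homomorphism : CommutativeRing.rawRing ℚP.+-*-commutativeRing
  -Raw-AlmostCommutative⟶ ℝ-almostCommutativeRing
ι-homomorphism = record
  { ⟦_⟧ = ι ; +-homo = ι-+ ; *-homo = ι-* ; -‿homo = ι-neg ; 0-homo = ≃-refl ; 1-homo = ≃-refl }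

ι-cong : ∀ {p q} → p ≡ q → ι p ≃ ι q
ι-cong p≡q = ≡⇒≃ (cong ι p≡q)

-- Equality of reals cannot be decided, so coefficients are rationals, compared there and mapped in
-- by `ι`. This also admits constants such as ½.
module ℝ-Solver = Algebra.Solver.Ring
  (CommutativeRing.rawRing ℚP.+-*-commutativeRing) ℝ-almostCommutativeRing ι-homomorphism
  (λ p q → Maybe.map ι-cong (dec⇒maybe (p ℚP.≟ q)))

-- The order on the reals

≼-pointwise : ∀ {x y} → Eventually (λ n → seq x n ≤ seq y n) → x ≼ y
≼-pointwise {x} {y} h = mk≼ λ ε 0<ε →
  eventually-map (λ n p → ℚP.≤-trans p
    (ℚP.≤-trans (ℚP.≤-reflexive (sym (ℚP.+-identityʳ (seq y n)))) (ℚP.+-monoʳ-≤ (seq y n) (ℚP.<⇒≤ 0<ε)))) h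

p≤∣p∣ : ∀ p → p ≤ ∣ p ∣
p≤∣p∣ p with ℚP.≤-total 0ℚ p
... | inj₁ 0≤p = ℚP.≤-reflexive (sym (ℚP.0≤p⇒∣p∣≡p 0≤p))
... | inj₂ p≤0 = ℚP.≤-trans p≤0 (ℚP.0≤∣p∣ p)

∣p∣*∣p∣≡p*p : ∀ p → ∣ p ∣ * ∣ p ∣ ≡ p * p
∣p∣*∣p∣≡p*p p with ℚP.∣p∣≡p∨∣p∣≡-p p
... | inj₁ e = cong₂ _*_ e e
... | inj₂ e = trans (cong₂ _*_ e e) (solve 1 (λ p → (:- p) :* (:- p) := p :* p) refl p)
  where open +-*-Solver

≤q+∣p-q∣ : ∀ p q → p ≤ q + ∣ p - q ∣
≤q+∣p-q∣ p q = subst (_≤ q + ∣ p - q ∣)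
  (solve 2 (λ p q → q :+ (p :+ :- q) := p) refl p q) (ℚP.+-monoʳ-≤ q (p≤∣p∣ (p - q)))
  where open +-*-Solver

≼-reflexive : ∀ {x y} → x ≃ y → x ≼ y
≼-reflexive {x} {y} (mk≃ h) = mk≼ λ ε 0<ε →
  eventually-map (λ n p → ℚP.≤-trans (≤q+∣p-q∣ (seq x n) (seq y n)) (ℚP.+-monoʳ-≤ (seq y n) p)) (h ε 0<ε)

≼-refl : ∀ {x} → x ≼ x
≼-refl = ≼-reflexive ≃-refl

≼-trans : ∀ {x y z} → x ≼ y → y ≼ z → x ≼ z
≼-trans {x} {y} {z} (mk≼ h) (mk≼ k) = mk≼ λ ε 0<ε →
  eventually-zip (λ n p q → ℚP.≤-trans p (ℚP.≤-trans (ℚP.+-monoˡ-≤ _ q)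
    (ℚP.≤-reflexive (trans (ℚP.+-assoc (seq z n) _ _) (cong (seq z n +_) (½+½ ε))))))
    (h _ (0<½* 0<ε)) (k _ (0<½* 0<ε))

≼-antisym : ∀ {x y} → x ≼ y → y ≼ x → x ≃ y
≼-antisym {x} {y} (mk≼ h) (mk≼ k) = mk≃ λ ε 0<ε →
  eventually-zip (λ n p q → ∣∣≤ (p-q≤ {seq x n} {seq y n} (subst (seq x n ≤_) (ℚP.+-comm (seq y n) ε) p))
    (subst (_≤ ε) (solve 2 (λ x y → y :+ :- x := :- (x :+ :- y)) refl (seq x n) (seq y n))
      (p-q≤ {seq y n} {seq x n} (subst (seq y n ≤_) (ℚP.+-comm (seq x n) ε) q)))) (h ε 0<ε) (k ε 0<ε)
  where open +-*-Solver

opaque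
  unfolding _⊕_ _⊗_ ⊖_ abs ι

  ⊕-mono : ∀ {x y u v} → x ≼ y → u ≼ v → x ⊕ u ≼ y ⊕ v
  ⊕-mono {x} {y} {u} {v} (mk≼ h) (mk≼ k) = mk≼ λ ε 0<ε →
    eventually-zip (λ n p q → ℚP.≤-trans (ℚP.+-mono-≤ p q) (ℚP.≤-reflexive
      (trans (solve 3 (λ a b e → a :+ e :+ (b :+ e) := a :+ b :+ (e :+ e)) refl (seq y n) (seq v n) (½ * ε))
        (cong (seq y n + seq v n +_) (½+½ ε))))) (h _ (0<½* 0<ε)) (k _ (0<½* 0<ε))
    where open +-*-Solver

  abs-nonneg : ∀ x → ι 0ℚ ≼ abs x
  abs-nonneg x = ≼-pointwise (always λ n → ℚP.0≤∣p∣ (seq x n))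

  x≼abs : ∀ x → x ≼ abs x
  x≼abs x = ≼-pointwise (always λ n → p≤∣p∣ (seq x n))

  abs-⊖ : ∀ x → abs (⊖ x) ≃ abs x
  abs-⊖ x = pointwise λ n → ℚP.∣-p∣≡∣p∣ (seq x n)

  abs-⊕ : ∀ x y → abs (x ⊕ y) ≼ abs x ⊕ abs y
  abs-⊕ x y = ≼-pointwise (always λ n → ℚP.∣p+q∣≤∣p∣+∣q∣ (seq x n) (seq y n))

  abs-⊗ : ∀ x y → abs (x ⊗ y) ≃ abs x ⊗ abs y
  abs-⊗ x y = pointwise λ n → ℚP.∣p*q∣≡∣p∣*∣q∣ (seq x n) (seq y n)

  abs⊗abs-nonneg : ∀ x y → ι 0ℚ ≼ abs x ⊗ abs y
  abs⊗abs-nonneg x y = ≼-pointwise (always λ n → 0≤* (ℚP.0≤∣p∣ (seq x n)) (ℚP.0≤∣p∣ (seq y n)))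

  abs-≼ : ∀ {x y} → x ≼ y → ⊖ x ≼ y → abs x ≼ y
  abs-≼ (mk≼ h) (mk≼ k) = mk≼ λ ε 0<ε → eventually-zip (λ _ → ∣∣≤) (h ε 0<ε) (k ε 0<ε)

  ι-mono : ∀ {p q} → p ≤ q → ι p ≼ ι q
  ι-mono p≤q = ≼-pointwise (always λ _ → p≤q)

  abs-bound : ∀ x → ∃[ B ] (0ℚ < B × abs x ≼ ι B)
  abs-bound x = proj₁ b , proj₁ (proj₂ b) , ≼-pointwise (proj₂ (proj₂ b))
    where
    b : Bounded x
    b = eventuallyBounded x

  ≼-limit : ∀ {x y} → (∀ ε → 0ℚ < ε → x ≼ y ⊕ ι ε) → x ≼ y
  ≼-limit {x} {y} h = mk≼ λ ε 0<ε → eventually-map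
    (λ n p → ℚP.≤-trans p (ℚP.≤-reflexive
      (trans (ℚP.+-assoc (seq y n) (½ * ε) (½ * ε)) (cong (seq y n +_) (½+½ ε)))))
    (un≼ (h _ (0<½* 0<ε)) _ (0<½* 0<ε))

  -- A square root is avoided by arguing on approximants: |p| > 1 + ε would give p² ≥ |p| > 1 + ε,
  -- because |p| > 1. The slack ε is therefore kept unchanged.
  abs-≤-1 : ∀ {x} → x ⊗ x ≼ ι 1ℚ → abs x ≼ ι 1ℚ
  abs-≤-1 {x} (mk≼ h) = mk≼ λ ε 0<ε → eventually-map (λ n → root 0<ε (seq x n)) (h ε 0<ε)
    where
    root : ∀ {ε} → 0ℚ < ε → ∀ p → p * p ≤ 1ℚ + ε → ∣ p ∣ ≤ 1ℚ + ε
    root {ε} 0<ε p p²≤ with ∣ p ∣ ℚP.≤? 1ℚ + ε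
    ... | yes q = q
    ... | no ¬q = contradiction (ℚP.<-≤-trans small big) (ℚP.<-irrefl refl)
      where
      1<b : 1ℚ < 1ℚ + ε
      1<b = ℚP.<-respˡ-≡ (ℚP.+-identityʳ 1ℚ) (ℚP.+-monoʳ-< 1ℚ 0<ε)
      b<p : 1ℚ + ε < ∣ p ∣
      b<p = ℚP.≰⇒> ¬q
      0≤b : 0ℚ ≤ 1ℚ + ε
      0≤b = ℚP.<⇒≤ (ℚP.<-trans 0<1 1<b)
      big : ∣ p ∣ * ∣ p ∣ ≤ 1ℚ + ε
      big = ℚP.≤-trans (ℚP.≤-reflexive (∣p∣*∣p∣≡p*p p)) p²≤
      small : 1ℚ + ε < ∣ p ∣ * ∣ p ∣
      small = ℚP.<-≤-trans b<p (ℚP.≤-trans (ℚP.≤-reflexive (sym (ℚP.*-identityʳ ∣ p ∣)))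
        (ℚP.*-monoˡ-≤-nonNeg ∣ p ∣ {{nonNegative (ℚP.0≤∣p∣ p)}} (ℚP.<⇒≤ (ℚP.<-trans 1<b b<p))))

≼-preorder : Preorder 0ℓ 0ℓ 0ℓ
≼-preorder = record
  { Carrier = ℝ
  ; _≈_ = _≃_
  ; _≲_ = _≼_
  ; isPreorder = record
    { isEquivalence = Setoid.isEquivalence ℝ-setoid
    ; reflexive = ≼-reflexive
    ; trans = ≼-trans
    }
  }

module ≼-Reasoning = Relation.Binary.Reasoning.Preorder ≼-preorder

⊕-monoˡ : ∀ x {y z} → y ≼ z → x ⊕ y ≼ x ⊕ z
⊕-monoˡ x = ⊕-mono ≼-refl

⊕-monoʳ : ∀ x {y z} → y ≼ z → y ⊕ x ≼ z ⊕ x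
⊕-monoʳ x h = ⊕-mono h ≼-refl

⊖-anti : ∀ {x y} → x ≼ y → ⊖ y ≼ ⊖ x
⊖-anti {x} {y} h = begin
  ⊖ y               ≈⟨ solve 2 (λ x y → :- y := x :+ (:- x :+ :- y)) ≃-refl x y ⟩
  x ⊕ (⊖ x ⊕ ⊖ y)   ≲⟨ ⊕-monoʳ _ h ⟩
  y ⊕ (⊖ x ⊕ ⊖ y)   ≈⟨ solve 2 (λ x y → y :+ (:- x :+ :- y) := :- x) ≃-refl x y ⟩
  ⊖ x               ∎
  where
  open ≼-Reasoning
  open ℝ-Solver

0≼⊝ : ∀ {x y} → x ≼ y → ι 0ℚ ≼ y ⊝ x
0≼⊝ {x} {y} h = ≼-trans (≼-reflexive (solve 1 (λ x → con 0ℚ := x :- x) ≃-refl x)) (⊕-monoʳ (⊖ x) h)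
  where open ℝ-Solver

0≼⊝⇒≼ : ∀ {x y} → ι 0ℚ ≼ y ⊝ x → x ≼ y
0≼⊝⇒≼ {x} {y} h = begin
  x                ≈⟨ solve 1 (λ x → x := x :+ con 0ℚ) ≃-refl x ⟩
  x ⊕ ι 0ℚ         ≲⟨ ⊕-monoˡ x h ⟩
  x ⊕ (y ⊝ x)      ≈⟨ solve 2 (λ x y → x :+ (y :- x) := y) ≃-refl x y ⟩
  y                ∎
  where
  open ≼-Reasoning
  open ℝ-Solver

abs-nonneg-≃ : ∀ {x} → ι 0ℚ ≼ x → abs x ≃ x
abs-nonneg-≃ {x} h = ≼-antisym (abs-≼ ≼-refl ⊖x≼x) (x≼abs x)
  where
  open ≼-Reasoning
  open ℝ-Solver
  ⊖x≼x : ⊖ x ≼ x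
  ⊖x≼x = begin
    ⊖ x      ≲⟨ ⊖-anti h ⟩
    ⊖ ι 0ℚ   ≈⟨ solve 0 (:- con 0ℚ := con 0ℚ) ≃-refl ⟩
    ι 0ℚ     ≲⟨ h ⟩
    x        ∎

⊕-nonneg : ∀ {x y} → ι 0ℚ ≼ x → ι 0ℚ ≼ y → ι 0ℚ ≼ x ⊕ y
⊕-nonneg h k = ≼-trans (≼-reflexive (≃-sym (⊕-identityˡ (ι 0ℚ)))) (⊕-mono h k)

-- Approximants of a nonnegative real may be negative, so both factors are replaced by their
-- absolute values, whose approximants have nonnegative products.
⊗-nonneg : ∀ {x y} → ι 0ℚ ≼ x → ι 0ℚ ≼ y → ι 0ℚ ≼ x ⊗ y
⊗-nonneg {x} {y} h k = ≼-trans (abs⊗abs-nonneg x y)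
  (≼-reflexive (⊗-cong (abs-nonneg-≃ h) (abs-nonneg-≃ k)))

⊗-monoˡ : ∀ {x y z} → ι 0ℚ ≼ x → y ≼ z → x ⊗ y ≼ x ⊗ z
⊗-monoˡ {x} {y} {z} h k = 0≼⊝⇒≼ (≼-trans (⊗-nonneg h (0≼⊝ k))
  (≼-reflexive (solve 3 (λ x y z → x :* (z :- y) := x :* z :- x :* y) ≃-refl x y z)))
  where open ℝ-Solver

⊗-monoʳ : ∀ {x y z} → ι 0ℚ ≼ x → y ≼ z → y ⊗ x ≼ z ⊗ x
⊗-monoʳ {x} {y} {z} h k = ≼-trans (≼-reflexive (⊗-comm y x))
  (≼-trans (⊗-monoˡ h k) (≼-reflexive (⊗-comm x z)))

⊗-mono : ∀ {x y u v} → ι 0ℚ ≼ x → ι 0ℚ ≼ v → x ≼ y → u ≼ v → x ⊗ u ≼ y ⊗ v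
⊗-mono 0≼x 0≼v h k = ≼-trans (⊗-monoˡ 0≼x k) (⊗-monoʳ 0≼v h)

ι-nonneg : ∀ {p} → 0ℚ ≤ p → ι 0ℚ ≼ ι p
ι-nonneg = ι-mono

0≼1 : ι 0ℚ ≼ ι 1ℚ
0≼1 = ι-nonneg (ℚP.<⇒≤ 0<1)

-- Complex numbers

infix 4 _≅_

record _≅_ (z w : ℂ) : Set where
  constructor mk≅
  field
    re≃ : re z ≃ re w
    im≃ : im z ≃ im w
open _≅_ using (re≃)

infixl 6 _⊞_ _⊟_
infixl 7 _⊠_
infix  8 ⊟_

opaque
  _⊞_ _⊠_ : ℂ → ℂ → ℂ
  z ⊞ w = mkℂ (re z ⊕ re w) (im z ⊕ im w)
  z ⊠ w = mkℂ (re z ⊗ re w ⊝ im z ⊗ im w) (re z ⊗ im w ⊕ im z ⊗ re w)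

  ⊟_ conj : ℂ → ℂ
  ⊟ z = mkℂ (⊖ re z) (⊖ im z)
  conj z = mkℂ (re z) (⊖ im z)

  ρ : ℝ → ℂ
  ρ x = mkℂ x (ι 0ℚ)

  -- The ℓ¹ norm: equivalent to the modulus, submultiplicative, and free of square roots.
  norm : ℂ → ℝ
  norm z = abs (re z) ⊕ abs (im z)

_⊟_ : ℂ → ℂ → ℂ
z ⊟ w = z ⊞ ⊟ w

κ : ℚ → ℂ
κ q = ρ (ι q)

≅-refl : ∀ {z} → z ≅ z
≅-refl = mk≅ ≃-refl ≃-refl

≅-sym : ∀ {z w} → z ≅ w → w ≅ z
≅-sym (mk≅ a b) = mk≅ (≃-sym a) (≃-sym b)

≅-trans : ∀ {z w v} → z ≅ w → w ≅ v → z ≅ v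
≅-trans (mk≅ a b) (mk≅ c d) = mk≅ (≃-trans a c) (≃-trans b d)

≡⇒≅ : ∀ {z w} → z ≡ w → z ≅ w
≡⇒≅ refl = ≅-refl

opaque
  unfolding _⊞_ _⊠_ ⊟_ conj ρ norm

  ⊞-cong : ∀ {z w u v} → z ≅ w → u ≅ v → z ⊞ u ≅ w ⊞ v
  ⊞-cong (mk≅ a b) (mk≅ c d) = mk≅ (⊕-cong a c) (⊕-cong b d)

  ⊠-cong : ∀ {z w u v} → z ≅ w → u ≅ v → z ⊠ u ≅ w ⊠ v
  ⊠-cong (mk≅ a b) (mk≅ c d) = mk≅
    (⊕-cong (⊗-cong a c) (⊖-cong (⊗-cong b d))) (⊕-cong (⊗-cong a d) (⊗-cong b c))

  ⊟-cong : ∀ {z w} → z ≅ w → ⊟ z ≅ ⊟ w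
  ⊟-cong (mk≅ a b) = mk≅ (⊖-cong a) (⊖-cong b)

  ρ-cong : ∀ {x y} → x ≃ y → ρ x ≅ ρ y
  ρ-cong h = mk≅ h ≃-refl

  norm-cong : ∀ {z w} → z ≅ w → norm z ≃ norm w
  norm-cong (mk≅ a b) = ⊕-cong (abs-cong a) (abs-cong b)

  ⊞-assoc : ∀ z w v → z ⊞ w ⊞ v ≅ z ⊞ (w ⊞ v)
  ⊞-assoc z w v = mk≅ (⊕-assoc _ _ _) (⊕-assoc _ _ _)

  ⊞-comm : ∀ z w → z ⊞ w ≅ w ⊞ z
  ⊞-comm z w = mk≅ (⊕-comm _ _) (⊕-comm _ _)

  ⊞-identityˡ : ∀ z → κ 0ℚ ⊞ z ≅ z
  ⊞-identityˡ z = mk≅ (⊕-identityˡ _) (⊕-identityˡ _)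

  ⊞-inverseˡ : ∀ z → ⊟ z ⊞ z ≅ κ 0ℚ
  ⊞-inverseˡ z = mk≅ (⊕-inverseˡ _) (⊕-inverseˡ _)

  ⊠-comm : ∀ z w → z ⊠ w ≅ w ⊠ z
  ⊠-comm (mkℂ a b) (mkℂ c d) = mk≅
    (solve 4 (λ a b c d → a :* c :- b :* d := c :* a :- d :* b) ≃-refl a b c d)
    (solve 4 (λ a b c d → a :* d :+ b :* c := c :* b :+ d :* a) ≃-refl a b c d)
    where open ℝ-Solver

  ⊠-assoc : ∀ z w v → z ⊠ w ⊠ v ≅ z ⊠ (w ⊠ v)
  ⊠-assoc (mkℂ a b) (mkℂ c d) (mkℂ e f) = mk≅
    (solve 6 (λ a b c d e f →
      (a :* c :- b :* d) :* e :- (a :* d :+ b :* c) :* f :=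
      a :* (c :* e :- d :* f) :- b :* (c :* f :+ d :* e)) ≃-refl a b c d e f)
    (solve 6 (λ a b c d e f →
      (a :* c :- b :* d) :* f :+ (a :* d :+ b :* c) :* e :=
      a :* (c :* f :+ d :* e) :+ b :* (c :* e :- d :* f)) ≃-refl a b c d e f)
    where open ℝ-Solver

  ⊠-identityˡ : ∀ z → κ 1ℚ ⊠ z ≅ z
  ⊠-identityˡ (mkℂ a b) = mk≅
    (solve 2 (λ a b → con 1ℚ :* a :- con 0ℚ :* b := a) ≃-refl a b)
    (solve 2 (λ a b → con 1ℚ :* b :+ con 0ℚ :* a := b) ≃-refl a b)
    where open ℝ-Solver

  ⊠-distribˡ-⊞ : ∀ z w v → z ⊠ (w ⊞ v) ≅ z ⊠ w ⊞ z ⊠ v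
  ⊠-distribˡ-⊞ (mkℂ a b) (mkℂ c d) (mkℂ e f) = mk≅
    (solve 6 (λ a b c d e f →
      a :* (c :+ e) :- b :* (d :+ f) := (a :* c :- b :* d) :+ (a :* e :- b :* f)) ≃-refl a b c d e f)
    (solve 6 (λ a b c d e f →
      a :* (d :+ f) :+ b :* (c :+ e) := (a :* d :+ b :* c) :+ (a :* f :+ b :* e)) ≃-refl a b c d e f)
    where open ℝ-Solver

  ρ-⊕ : ∀ x y → ρ (x ⊕ y) ≅ ρ x ⊞ ρ y
  ρ-⊕ x y = mk≅ ≃-refl (≃-sym (⊕-identityˡ _))

  ρ-⊗ : ∀ x y → ρ (x ⊗ y) ≅ ρ x ⊠ ρ y
  ρ-⊗ x y = mk≅
    (solve 2 (λ x y → x :* y := x :* y :- con 0ℚ :* con 0ℚ) ≃-refl x y)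
    (solve 2 (λ x y → con 0ℚ := x :* con 0ℚ :+ con 0ℚ :* y) ≃-refl x y)
    where open ℝ-Solver

  ρ-⊖ : ∀ x → ρ (⊖ x) ≅ ⊟ ρ x
  ρ-⊖ x = mk≅ ≃-refl (solve 0 (con 0ℚ := :- con 0ℚ) ≃-refl)
    where open ℝ-Solver

  re-ρ : ∀ x → re (ρ x) ≃ x
  re-ρ x = ≃-refl

  conj-⊞ : ∀ z w → conj (z ⊞ w) ≅ conj z ⊞ conj w
  conj-⊞ z w = mk≅ ≃-refl (solve 2 (λ b d → :- (b :+ d) := (:- b) :+ (:- d)) ≃-refl (im z) (im w))
    where open ℝ-Solver

  conj-⊟ : ∀ z → ⊟ conj z ≅ conj (⊟ z)
  conj-⊟ z = ≅-refl

  conj-⊠ : ∀ z w → conj (z ⊠ w) ≅ conj z ⊠ conj w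
  conj-⊠ z w = mk≅
    (solve 4 (λ a b c d → a :* c :- b :* d := a :* c :- (:- b) :* (:- d)) ≃-refl (re z) (im z) (re w) (im w))
    (solve 4 (λ a b c d → :- (a :* d :+ b :* c) := a :* (:- d) :+ (:- b) :* c) ≃-refl
      (re z) (im z) (re w) (im w))
    where open ℝ-Solver

  conj-ρ : ∀ x → conj (ρ x) ≅ ρ x
  conj-ρ x = mk≅ ≃-refl (solve 0 (:- con 0ℚ := con 0ℚ) ≃-refl)
    where open ℝ-Solver

  re-⊠-conj : ∀ z → re (z ⊠ conj z) ≃ re z ⊗ re z ⊕ im z ⊗ im z
  re-⊠-conj z = solve 2 (λ a b → a :* a :- b :* (:- b) := a :* a :+ b :* b) ≃-refl (re z) (im z)
    where open ℝ-Solver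

  conj-imaginary : ∀ {z} → re z ≃ ι 0ℚ → conj z ≅ ⊟ z
  conj-imaginary {z} h = mk≅
    (≃-trans h (≃-trans (solve 0 (con 0ℚ := :- con 0ℚ) ≃-refl) (⊖-cong (≃-sym h)))) ≃-refl
    where open ℝ-Solver

  re-⊟ : ∀ z w → re (z ⊟ w) ≃ re z ⊝ re w
  re-⊟ z w = ≃-refl

  im-⊟ : ∀ z w → im (z ⊟ w) ≃ im z ⊝ im w
  im-⊟ z w = ≃-refl

  re-⊟ρ⊠ : ∀ z x → re (⊟ z ⊠ ρ x) ≃ ⊖ (re z ⊗ x)
  re-⊟ρ⊠ z x = solve 3 (λ a b x → (:- a) :* x :- (:- b) :* con 0ℚ := :- (a :* x)) ≃-refl (re z) (im z) x
    where open ℝ-Solver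

  norm-nonneg : ∀ z → ι 0ℚ ≼ norm z
  norm-nonneg z = ⊕-nonneg (abs-nonneg (re z)) (abs-nonneg (im z))

  norm-⊞ : ∀ z w → norm (z ⊞ w) ≼ norm z ⊕ norm w
  norm-⊞ z w = ≼-trans (⊕-mono (abs-⊕ (re z) (re w)) (abs-⊕ (im z) (im w)))
    (≼-reflexive (solve 4 (λ a b c d → a :+ c :+ (b :+ d) := a :+ b :+ (c :+ d)) ≃-refl
      (abs (re z)) (abs (im z)) (abs (re w)) (abs (im w))))
    where open ℝ-Solver

  norm-⊟ : ∀ z → norm (⊟ z) ≃ norm z
  norm-⊟ z = ⊕-cong (abs-⊖ (re z)) (abs-⊖ (im z))

  norm-conj : ∀ z → norm (conj z) ≃ norm z
  norm-conj z = ⊕-cong ≃-refl (abs-⊖ (im z))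

  norm-⊠ : ∀ z w → norm (z ⊠ w) ≼ norm z ⊗ norm w
  norm-⊠ (mkℂ a b) (mkℂ c d) = begin
    abs (a ⊗ c ⊝ b ⊗ d) ⊕ abs (a ⊗ d ⊕ b ⊗ c)
      ≲⟨ ⊕-mono (abs-⊕ (a ⊗ c) (⊖ (b ⊗ d))) (abs-⊕ (a ⊗ d) (b ⊗ c)) ⟩
    abs (a ⊗ c) ⊕ abs (⊖ (b ⊗ d)) ⊕ (abs (a ⊗ d) ⊕ abs (b ⊗ c))
      ≈⟨ ⊕-cong (⊕-cong (abs-⊗ a c) (≃-trans (abs-⊖ (b ⊗ d)) (abs-⊗ b d)))
                (⊕-cong (abs-⊗ a d) (abs-⊗ b c)) ⟩
    abs a ⊗ abs c ⊕ abs b ⊗ abs d ⊕ (abs a ⊗ abs d ⊕ abs b ⊗ abs c)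
      ≈⟨ solve 4 (λ a b c d → a :* c :+ b :* d :+ (a :* d :+ b :* c) := (a :+ b) :* (c :+ d)) ≃-refl
           (abs a) (abs b) (abs c) (abs d) ⟩
    (abs a ⊕ abs b) ⊗ (abs c ⊕ abs d) ∎
    where
    open ≼-Reasoning
    open ℝ-Solver

  norm-ρ : ∀ x → norm (ρ x) ≃ abs x
  norm-ρ x = ≃-trans (⊕-cong ≃-refl (abs-nonneg-≃ ≼-refl))
    (solve 1 (λ x → x :+ con 0ℚ := x) ≃-refl (abs x))
    where open ℝ-Solver

  norm-parts : ∀ {z x} → abs (re z) ≼ x → abs (im z) ≼ x → norm z ≼ x ⊕ x
  norm-parts = ⊕-mono

  re≼norm : ∀ z → abs (re z) ≼ norm z
  re≼norm z = ≼-trans (≼-reflexive (solve 1 (λ x → x := x :+ con 0ℚ) ≃-refl (abs (re z))))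
    (⊕-monoˡ _ (abs-nonneg (im z)))
    where open ℝ-Solver

  im≼norm : ∀ z → abs (im z) ≼ norm z
  im≼norm z = ≼-trans (≼-reflexive (≃-sym (⊕-identityˡ _))) (⊕-monoʳ _ (abs-nonneg (re z)))

ℂ-setoid : Setoid 0ℓ 0ℓ
ℂ-setoid = record
  { Carrier = ℂ
  ; _≈_ = _≅_
  ; isEquivalence = record { refl = ≅-refl ; sym = ≅-sym ; trans = ≅-trans }
  }

module ≅-Reasoning = Relation.Binary.Reasoning.Setoid ℂ-setoid

ℂ-commutativeRing : CommutativeRing 0ℓ 0ℓ
ℂ-commutativeRing = record
  { Carrier = ℂ
  ; _≈_ = _≅_
  ; _+_ = _⊞_
  ; _*_ = _⊠_
  ; -_ = ⊟_
  ; 0# = κ 0ℚ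
  ; 1# = κ 1ℚ
  ; isCommutativeRing = record
    { isRing = record
      { +-isAbelianGroup = record
        { isGroup = record
          { isMonoid = record
            { isSemigroup = record
              { isMagma = record
                { isEquivalence = Setoid.isEquivalence ℂ-setoid
                ; ∙-cong = ⊞-cong
                }
              ; assoc = ⊞-assoc
              }
            ; identity = comm∧idˡ⇒id ℂ-setoid ⊞-comm ⊞-identityˡ
            }
          ; inverse = comm∧invˡ⇒inv ℂ-setoid ⊞-comm ⊞-inverseˡ
          ; ⁻¹-cong = ⊟-cong
          }
        ; comm = ⊞-comm
        }
      ; *-cong = ⊠-cong
      ; *-assoc = ⊠-assoc
      ; *-identity = comm∧idˡ⇒id ℂ-setoid ⊠-comm ⊠-identityˡ
      ; distrib = comm∧distrˡ⇒distr ℂ-setoid ⊞-cong ⊠-comm ⊠-distribˡ-⊞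
      }
    ; *-comm = ⊠-comm
    }
  }

ℂ-almostCommutativeRing : AlmostCommutativeRing 0ℓ 0ℓ
ℂ-almostCommutativeRing = fromCommutativeRing ℂ-commutativeRing

κ-homomorphism : CommutativeRing.rawRing ℚP.+-*-commutativeRing
  -Raw-AlmostCommutative⟶ ℂ-almostCommutativeRing
κ-homomorphism = record
  { ⟦_⟧ = κ
  ; +-homo = λ p q → ≅-trans (ρ-cong (ι-+ p q)) (ρ-⊕ (ι p) (ι q))
  ; *-homo = λ p q → ≅-trans (ρ-cong (ι-* p q)) (ρ-⊗ (ι p) (ι q))
  ; -‿homo = λ p → ≅-trans (ρ-cong (ι-neg p)) (ρ-⊖ (ι p))
  ; 0-homo = ≅-refl
  ; 1-homo = ≅-refl
  }

κ-cong : ∀ {p q} → p ≡ q → κ p ≅ κ q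
κ-cong refl = ≅-refl

module ℂ-Solver = Algebra.Solver.Ring
  (CommutativeRing.rawRing ℚP.+-*-commutativeRing) ℂ-almostCommutativeRing κ-homomorphism
  (λ p q → Maybe.map κ-cong (dec⇒maybe (p ℚP.≟ q)))

norm-κ : ∀ {p} → 0ℚ ≤ p → norm (κ p) ≃ ι p
norm-κ h = ≃-trans (norm-ρ _) (abs-nonneg-≃ (ι-nonneg h))

norm-bound : ∀ z → ∃[ B ] (0ℚ < B × norm z ≼ ι B)
norm-bound z = go (abs-bound (norm z))
  where
  go : ∃[ B ] (0ℚ < B × abs (norm z) ≼ ι B) → ∃[ B ] (0ℚ < B × norm z ≼ ι B)
  go (B , 0<B , h) = B , 0<B , ≼-trans (x≼abs _) h

≃-from-abs : ∀ {x y} → (∀ ε → 0ℚ < ε → abs (x ⊝ y) ≼ ι ε) → x ≃ y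
≃-from-abs {x} {y} h = ≼-antisym (below h)
  (below λ ε 0<ε → ≼-trans (≼-reflexive (≃-trans (≃-sym (abs-⊖ _))
    (abs-cong (solve 2 (λ x y → :- (y :- x) := x :- y) ≃-refl x y)))) (h ε 0<ε))
  where
  open ℝ-Solver
  below : ∀ {x y} → (∀ ε → 0ℚ < ε → abs (x ⊝ y) ≼ ι ε) → x ≼ y
  below {x} {y} h = ≼-limit λ ε 0<ε → begin
    x               ≈⟨ solve 2 (λ x y → x := y :+ (x :- y)) ≃-refl x y ⟩
    y ⊕ (x ⊝ y)     ≲⟨ ⊕-monoˡ y (≼-trans (x≼abs _) (h ε 0<ε)) ⟩
    y ⊕ ι ε         ∎
    where open ≼-Reasoning

≅-from-norm : ∀ {z w} → (∀ ε → 0ℚ < ε → norm (z ⊟ w) ≼ ι ε) → z ≅ w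
≅-from-norm {z} {w} h = mk≅
  (≃-from-abs λ ε 0<ε → ≼-trans (≼-reflexive (abs-cong (≃-sym (re-⊟ z w))))
    (≼-trans (re≼norm (z ⊟ w)) (h ε 0<ε)))
  (≃-from-abs λ ε 0<ε → ≼-trans (≼-reflexive (abs-cong (≃-sym (im-⊟ z w))))
    (≼-trans (im≼norm (z ⊟ w)) (h ε 0<ε)))

norm-dist-comm : ∀ z w → norm (z ⊟ w) ≃ norm (w ⊟ z)
norm-dist-comm z w = ≃-trans (≃-sym (norm-⊟ (z ⊟ w)))
  (norm-cong (solve 2 (λ z w → :- (z :- w) := w :- z) ≅-refl z w))
  where open ℂ-Solver

norm-triangle : ∀ z w v → norm (z ⊟ v) ≼ norm (z ⊟ w) ⊕ norm (w ⊟ v)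
norm-triangle z w v = ≼-trans
  (≼-reflexive (norm-cong (solve 3 (λ z w v → z :- v := (z :- w) :+ (w :- v)) ≅-refl z w v)))
  (norm-⊞ (z ⊟ w) (w ⊟ v))
  where open ℂ-Solver

-- Limits

infix 4 _⇝_

record _⇝_ (f : ℕ → ℂ) (z : ℂ) : Set where
  constructor mk⇝
  field un⇝ : ∀ ε → 0ℚ < ε → Eventually λ n → norm (f n ⊟ z) ≼ ι ε
open _⇝_

Null : (ℕ → ℝ) → Set
Null b = ∀ ε → 0ℚ < ε → Eventually λ n → b n ≼ ι ε

Cauchyᶜ : (ℕ → ℂ) → Set
Cauchyᶜ f = ∀ ε → 0ℚ < ε → ∃[ N ] ∀ m n → N ℕ.≤ m → N ℕ.≤ n → norm (f m ⊟ f n) ≼ ι ε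

ι-½+½ : ∀ ε → ι (½ * ε) ⊕ ι (½ * ε) ≼ ι ε
ι-½+½ ε = ≼-reflexive (≃-trans (≃-sym (ι-+ (½ * ε) (½ * ε))) (ι-cong (½+½ ε)))

eventually-∃ : {P : ℕ → Set} → Eventually P → ∃[ n ] P n
eventually-∃ (N , p) = N , p N ℕP.≤-refl

null-⊕ : ∀ {a b} → Null a → Null b → Null (λ n → a n ⊕ b n)
null-⊕ h k ε 0<ε = eventually-zip (λ n p q → ≼-trans (⊕-mono p q) (ι-½+½ ε))
  (h _ (0<½* 0<ε)) (k _ (0<½* 0<ε))

null-⊗ : ∀ {a x} → Null a → Null (λ n → abs x ⊗ a n)
null-⊗ {a} {x} h ε 0<ε = go (abs-bound x)
  where
  go : ∃[ B ] (0ℚ < B × abs x ≼ ι B) → Eventually λ n → abs x ⊗ a n ≼ ι ε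
  go (B , 0<B , x≼B) = go₂ (quotient 0<ε 0<B)
    where
    go₂ : ∃[ δ ] (0ℚ < δ × B * δ ≡ ε) → Eventually λ n → abs x ⊗ a n ≼ ι ε
    go₂ (δ , 0<δ , eq) = eventually-map (λ n p → ≼-trans
      (≼-trans (⊗-monoˡ (abs-nonneg x) p) (⊗-monoʳ (ι-nonneg (ℚP.<⇒≤ 0<δ)) x≼B))
      (≼-reflexive (≃-trans (≃-sym (ι-* B δ)) (ι-cong eq)))) (h δ 0<δ)

null-≼ : ∀ {a b} → Eventually (λ n → a n ≼ b n) → Null b → Null a
null-≼ h k ε 0<ε = eventually-zip (λ n → ≼-trans) h (k ε 0<ε)

⇝-squeeze : ∀ {f z b} → Null b → Eventually (λ n → norm (f n ⊟ z) ≼ b n) → f ⇝ z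
⇝-squeeze h k = mk⇝ (null-≼ k h)

⇝-unique : ∀ {f z w} → f ⇝ z → f ⇝ w → z ≅ w
⇝-unique {f} {z} {w} (mk⇝ h) (mk⇝ k) = ≅-from-norm λ ε 0<ε → go ε (eventually-∃
  (eventually-zip (λ _ → _,_) (h _ (0<½* 0<ε)) (k _ (0<½* 0<ε))))
  where
  go : ∀ ε → ∃[ n ] (norm (f n ⊟ z) ≼ ι (½ * ε) × norm (f n ⊟ w) ≼ ι (½ * ε)) → norm (z ⊟ w) ≼ ι ε
  go ε (n , p , q) = begin
    norm (z ⊟ w)                       ≲⟨ norm-triangle z (f n) w ⟩
    norm (z ⊟ f n) ⊕ norm (f n ⊟ w)    ≲⟨ ⊕-mono (≼-trans (≼-reflexive (norm-dist-comm z (f n))) p) q ⟩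
    ι (½ * ε) ⊕ ι (½ * ε)              ≲⟨ ι-½+½ ε ⟩
    ι ε                                ∎
    where open ≼-Reasoning

⊟-cong₂ : ∀ {z w u v} → z ≅ w → u ≅ v → z ⊟ u ≅ w ⊟ v
⊟-cong₂ h k = ⊞-cong h (⊟-cong k)

⇝-cong : ∀ {f g z w} → Eventually (λ n → f n ≅ g n) → z ≅ w → f ⇝ z → g ⇝ w
⇝-cong h k (mk⇝ l) = mk⇝ λ ε 0<ε → eventually-zip
  (λ n e p → ≼-trans (≼-reflexive (norm-cong (⊟-cong₂ (≅-sym e) (≅-sym k)))) p) h (l ε 0<ε)

norm-0 : norm (κ 0ℚ) ≼ ι 0ℚ
norm-0 = ≼-reflexive (norm-κ ℚP.≤-refl)

⇝-const : ∀ {z} → (λ _ → z) ⇝ z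
⇝-const {z} = mk⇝ λ ε 0<ε → always λ n → ≼-trans
  (≼-reflexive (norm-cong (solve 1 (λ z → z :- z := con 0ℚ) ≅-refl z)))
  (≼-trans norm-0 (ι-mono (ℚP.<⇒≤ 0<ε)))
  where open ℂ-Solver

⇝-null : ∀ {f z} → f ⇝ z → Null (λ n → norm (f n ⊟ z))
⇝-null = un⇝

⇝-⊞ : ∀ {f g z w} → f ⇝ z → g ⇝ w → (λ n → f n ⊞ g n) ⇝ z ⊞ w
⇝-⊞ {f} {g} {z} {w} h k = ⇝-squeeze (null-⊕ (⇝-null h) (⇝-null k)) (always λ n → ≼-trans
  (≼-reflexive (norm-cong (solve 4 (λ f g z w → f :+ g :- (z :+ w) := (f :- z) :+ (g :- w)) ≅-refl
    (f n) (g n) z w)))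
  (norm-⊞ (f n ⊟ z) (g n ⊟ w)))
  where open ℂ-Solver

-- f g − z w = (f − z) w + z (g − w) + (f − z) (g − w)
⇝-⊠ : ∀ {f g z w} → f ⇝ z → g ⇝ w → (λ n → f n ⊠ g n) ⇝ z ⊠ w
⇝-⊠ {f} {g} {z} {w} h k = ⇝-squeeze
  (null-⊕ (null-⊕ (null-⊗ {x = norm w} (⇝-null h)) (null-⊗ {x = norm z} (⇝-null k)))
    (null-⊗ {x = ι 1ℚ} (⇝-null k)))
  (eventually-map bound (un⇝ h 1ℚ 0<1))
  where
  open ℂ-Solver
  open ≼-Reasoning
  abs-norm : ∀ z → norm z ≃ abs (norm z)
  abs-norm z = ≃-sym (abs-nonneg-≃ (norm-nonneg z))
  bound : ∀ n → norm (f n ⊟ z) ≼ ι 1ℚ → norm (f n ⊠ g n ⊟ z ⊠ w) ≼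
    abs (norm w) ⊗ norm (f n ⊟ z) ⊕ abs (norm z) ⊗ norm (g n ⊟ w) ⊕ abs (ι 1ℚ) ⊗ norm (g n ⊟ w)
  bound n p = begin
    norm (f n ⊠ g n ⊟ z ⊠ w)
      ≈⟨ norm-cong (solve 4 (λ f g z w → f :* g :- z :* w :=
           w :* (f :- z) :+ z :* (g :- w) :+ (f :- z) :* (g :- w)) ≅-refl (f n) (g n) z w) ⟩
    norm (w ⊠ (f n ⊟ z) ⊞ z ⊠ (g n ⊟ w) ⊞ (f n ⊟ z) ⊠ (g n ⊟ w))
      ≲⟨ ≼-trans (norm-⊞ _ _) (⊕-monoʳ _ (norm-⊞ _ _)) ⟩
    norm (w ⊠ (f n ⊟ z)) ⊕ norm (z ⊠ (g n ⊟ w)) ⊕ norm ((f n ⊟ z) ⊠ (g n ⊟ w))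
      ≲⟨ ⊕-mono (⊕-mono (norm-⊠ _ _) (norm-⊠ _ _)) (norm-⊠ _ _) ⟩
    norm w ⊗ norm (f n ⊟ z) ⊕ norm z ⊗ norm (g n ⊟ w) ⊕ norm (f n ⊟ z) ⊗ norm (g n ⊟ w)
      ≲⟨ ⊕-mono (≼-reflexive (⊕-cong (⊗-cong (abs-norm w) ≃-refl) (⊗-cong (abs-norm z) ≃-refl)))
           (⊗-monoʳ (norm-nonneg _) (≼-trans p (x≼abs _))) ⟩
    abs (norm w) ⊗ norm (f n ⊟ z) ⊕ abs (norm z) ⊗ norm (g n ⊟ w) ⊕ abs (ι 1ℚ) ⊗ norm (g n ⊟ w) ∎

⇝-⊠ˡ : ∀ w {f z} → f ⇝ z → (λ n → w ⊠ f n) ⇝ w ⊠ z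
⇝-⊠ˡ w = ⇝-⊠ ⇝-const

⇝-conj : ∀ {f z} → f ⇝ z → (λ n → conj (f n)) ⇝ conj z
⇝-conj {f} {z} (mk⇝ h) = mk⇝ λ ε 0<ε → eventually-map (λ n p → ≼-trans (≼-reflexive (begin
  norm (conj (f n) ⊟ conj z)   ≈⟨ norm-cong (⊞-cong ≅-refl (conj-⊟ z)) ⟩
  norm (conj (f n) ⊞ conj (⊟ z)) ≈⟨ norm-cong (conj-⊞ (f n) (⊟ z)) ⟨
  norm (conj (f n ⊟ z))        ≈⟨ norm-conj _ ⟩
  norm (f n ⊟ z)               ∎)) p) (h ε 0<ε)
  where
  open import Relation.Binary.Reasoning.Setoid ℝ-setoid

⇝-subsequence : ∀ {f z} (φ : ℕ → ℕ) → (∀ N → Eventually λ n → N ℕ.≤ φ n) → f ⇝ z → (λ n → f (φ n)) ⇝ z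
⇝-subsequence {f} {z} φ hφ (mk⇝ h) = mk⇝ λ ε 0<ε → go (h ε 0<ε)
  where
  go : ∀ {ε} → Eventually (λ n → norm (f n ⊟ z) ≼ ι ε) → Eventually (λ n → norm (f (φ n) ⊟ z) ≼ ι ε)
  go (N , p) = eventually-map (λ n → p (φ n)) (hφ N)

⇝-norm : ∀ {f z w x} → f ⇝ z → Eventually (λ n → norm (f n ⊟ w) ≼ x) → norm (z ⊟ w) ≼ x
⇝-norm {f} {z} {w} {x} (mk⇝ h) k = ≼-limit λ ε 0<ε →
  go ε (eventually-∃ (eventually-zip (λ _ → _,_) (h ε 0<ε) k))
  where
  open ≼-Reasoning
  go : ∀ ε → ∃[ n ] (norm (f n ⊟ z) ≼ ι ε × norm (f n ⊟ w) ≼ x) → norm (z ⊟ w) ≼ x ⊕ ι ε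
  go ε (n , p , q) = begin
    norm (z ⊟ w)                      ≲⟨ norm-triangle z (f n) w ⟩
    norm (z ⊟ f n) ⊕ norm (f n ⊟ w)   ≲⟨ ⊕-mono (≼-trans (≼-reflexive (norm-dist-comm z (f n))) p) q ⟩
    ι ε ⊕ x                           ≈⟨ ⊕-comm (ι ε) x ⟩
    x ⊕ ι ε                           ∎

re-⇝-lower : ∀ {f z y} → f ⇝ z → Eventually (λ n → y ≼ re (f n)) → y ≼ re z
re-⇝-lower {f} {z} {y} (mk⇝ h) k = ≼-limit λ ε 0<ε →
  go ε (eventually-∃ (eventually-zip (λ _ → _,_) (h ε 0<ε) k))
  where
  open ≼-Reasoning
  open ℝ-Solver
  go : ∀ ε → ∃[ n ] (norm (f n ⊟ z) ≼ ι ε × y ≼ re (f n)) → y ≼ re z ⊕ ι ε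
  go ε (n , p , q) = begin
    y                          ≲⟨ q ⟩
    re (f n)                   ≈⟨ solve 2 (λ a b → a := b :+ (a :- b)) ≃-refl (re (f n)) (re z) ⟩
    re z ⊕ (re (f n) ⊝ re z)   ≲⟨ ⊕-monoˡ _ (x≼abs _) ⟩
    re z ⊕ abs (re (f n) ⊝ re z) ≈⟨ ⊕-cong ≃-refl (abs-cong (≃-sym (re-⊟ (f n) z))) ⟩
    re z ⊕ abs (re (f n ⊟ z))  ≲⟨ ⊕-monoˡ _ (≼-trans (re≼norm (f n ⊟ z)) p) ⟩
    re z ⊕ ι ε                 ∎

-- Completeness

opaque
  unfolding _⊕_ ⊖_ abs ι

  lim : ∀ f → Cauchyᴿ f → ℝ
  lim = limᴿ

  -- The i-th approximants of f n and of the limit are compared through a later index j. The detour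
  -- costs four quarters of ε: one since f n is Cauchy, two for |f n - f i| at j (the Cauchy bound
  -- and the slack of `_≤ᴿ_`), one for the distance from f i at j to the diagonal.
  lim-close : ∀ f (c : Cauchyᴿ f) ε → 0ℚ < ε → Eventually λ n → abs (f n ⊝ lim f c) ≼ ι ε
  lim-close f c ε 0<ε = go (c q 0<q) (archimedean q 0<q)
    where
    q : ℚ
    q = ½ * (½ * ε)
    0<q : 0ℚ < q
    0<q = 0<½* (0<½* 0<ε)
    4q : q + ((q + q) + q) ≡ ε
    4q = trans (solve 1 (λ q → q :+ ((q :+ q) :+ q) := (q :+ q) :+ (q :+ q)) refl q)
      (trans (cong₂ _+_ (½+½ (½ * ε)) (½+½ (½ * ε))) (½+½ ε))
      where open +-*-Solver

    close : ∀ n M → (∀ i → M ℕ.≤ i → 1/suc i ≤ q) →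
      (∃[ L ] ∀ i j → L ℕ.≤ i → L ℕ.≤ j → ∣ seq (f n) i - seq (f n) j ∣ ≤ q) →
      (∃[ K ] ∀ m → K ℕ.≤ m → ∣ f n -ᴿ f m ∣ᴿ ≤ᴿ fromℚ q) →
      Eventually λ i → ∣ seq (f n) i - diag f i ∣ ≤ ε
    close n M hM (L , hL) (K , hK) = L ℕ.⊔ (M ℕ.⊔ K) , λ i hi →
      let L≤i = ℕP.m⊔n≤o⇒m≤o L _ hi
          M≤i = ℕP.m⊔n≤o⇒m≤o M K (ℕP.m⊔n≤o⇒n≤o L _ hi)
          K≤i = ℕP.m⊔n≤o⇒n≤o M K (ℕP.m⊔n≤o⇒n≤o L _ hi)
      in at i L≤i M≤i (hK i K≤i q 0<q)
      where
      at : ∀ i → L ℕ.≤ i → M ℕ.≤ i →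
        Eventually (λ j → ∣ seq (f n) j - seq (f i) j ∣ ≤ q + q) → ∣ seq (f n) i - diag f i ∣ ≤ ε
      at i L≤i M≤i (J , hJ) = ℚP.≤-trans (triangle (seq (f n) i) (seq (f n) j) (diag f i))
        (ℚP.≤-trans
          (ℚP.+-mono-≤ (hL i j L≤i L≤j)
            (ℚP.≤-trans (triangle (seq (f n) j) (seq (f i) j) (diag f i))
              (ℚP.+-mono-≤ (hJ j J≤j)
                (ℚP.≤-trans (ℚP.≤-reflexive (∣-∣-comm (seq (f i) j) (diag f i)))
                  (ℚP.≤-trans (diag-close f i j D≤j) (hM i M≤i))))))
          (ℚP.≤-reflexive 4q))
        where
        j : ℕ
        j = L ℕ.⊔ (J ℕ.⊔ diagIndex f i)
        L≤j : L ℕ.≤ j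
        L≤j = ℕP.m≤m⊔n L _
        J≤j : J ℕ.≤ j
        J≤j = ℕP.≤-trans (ℕP.m≤m⊔n J _) (ℕP.m≤n⊔m L _)
        D≤j : diagIndex f i ℕ.≤ j
        D≤j = ℕP.≤-trans (ℕP.m≤n⊔m J _) (ℕP.m≤n⊔m L _)

    go : (∃[ N ] ∀ m n → N ℕ.≤ m → N ℕ.≤ n → ∣ f m -ᴿ f n ∣ᴿ ≤ᴿ fromℚ q) →
         (∃[ M ] ∀ i → M ℕ.≤ i → 1/suc i ≤ q) →
         Eventually λ n → abs (f n ⊝ lim f c) ≼ ι ε
    go (N , hN) (M , hM) = N , λ n N≤n → ≼-pointwise
      (close n M hM (cauchy (f n) q 0<q) (N , λ m N≤m → hN n m N≤n N≤m))

  abs-≼⇒∣∣≤ : ∀ {x y ε} → abs (x ⊝ y) ≼ ι ε → ∣ x -ᴿ y ∣ᴿ ≤ᴿ fromℚ ε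
  abs-≼⇒∣∣≤ (mk≼ h) = h

⇝-parts : ∀ {f z} → (∀ ε → 0ℚ < ε → Eventually λ n → abs (re (f n) ⊝ re z) ≼ ι ε) →
  (∀ ε → 0ℚ < ε → Eventually λ n → abs (im (f n) ⊝ im z) ≼ ι ε) → f ⇝ z
⇝-parts {f} {z} h k = mk⇝ λ ε 0<ε → eventually-zip
  (λ n p q → ≼-trans (parts n) (≼-trans (⊕-mono p q) (ι-½+½ ε))) (h _ (0<½* 0<ε)) (k _ (0<½* 0<ε))
  where
  opaque
    unfolding norm
    parts : ∀ n → norm (f n ⊟ z) ≼ abs (re (f n) ⊝ re z) ⊕ abs (im (f n) ⊝ im z)
    parts n = ≼-reflexive (⊕-cong (abs-cong (re-⊟ (f n) z)) (abs-cong (im-⊟ (f n) z)))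

module _ {f : ℕ → ℂ} where

  dist-re : ∀ m z → abs (re (f m) ⊝ re z) ≼ norm (f m ⊟ z)
  dist-re m z = ≼-trans (≼-reflexive (abs-cong (≃-sym (re-⊟ (f m) z)))) (re≼norm _)

  dist-im : ∀ m z → abs (im (f m) ⊝ im z) ≼ norm (f m ⊟ z)
  dist-im m z = ≼-trans (≼-reflexive (abs-cong (≃-sym (im-⊟ (f m) z)))) (im≼norm _)

  ⇝⇒⟶ : ∀ {z} → f ⇝ z → f ⟶ z
  ⇝⇒⟶ {z} (mk⇝ h) =
    (λ ε 0<ε → eventually-map (λ n p → abs-≼⇒∣∣≤ (≼-trans (dist-re n z) p)) (h ε 0<ε)) ,
    (λ ε 0<ε → eventually-map (λ n p → abs-≼⇒∣∣≤ (≼-trans (dist-im n z) p)) (h ε 0<ε))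

  opaque
    complete : Cauchyᶜ f → ∃[ z ] f ⇝ z
    complete c = mkℂ (lim (λ n → re (f n)) cauchy-re) (lim (λ n → im (f n)) cauchy-im) ,
      ⇝-parts (lim-close (λ n → re (f n)) cauchy-re) (lim-close (λ n → im (f n)) cauchy-im)
      where
      cauchy-re : Cauchyᴿ (λ n → re (f n))
      cauchy-re ε 0<ε = proj₁ (c ε 0<ε) , λ m n hm hn →
        abs-≼⇒∣∣≤ (≼-trans (dist-re m (f n)) (proj₂ (c ε 0<ε) m n hm hn))
      cauchy-im : Cauchyᴿ (λ n → im (f n))
      cauchy-im ε 0<ε = proj₁ (c ε 0<ε) , λ m n hm hn →
        abs-≼⇒∣∣≤ (≼-trans (dist-im m (f n)) (proj₂ (c ε 0<ε) m n hm hn))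

-- The exponential function

opaque
  unfolding _⊕_ _⊗_ ⊖_ ι

  +ᴿ≡⊕ : ∀ x y → x +ᴿ y ≡ x ⊕ y
  +ᴿ≡⊕ x y = refl

  *ᴿ≡⊗ : ∀ x y → x *ᴿ y ≡ x ⊗ y
  *ᴿ≡⊗ x y = refl

  -ᴿ≡⊖ : ∀ x → -ᴿ x ≡ ⊖ x
  -ᴿ≡⊖ x = refl

  fromℚ≡ι : ∀ q → fromℚ q ≡ ι q
  fromℚ≡ι q = refl

-ᴿ≡⊝ : ∀ x y → x -ᴿ y ≡ x ⊝ y
-ᴿ≡⊝ x y = trans (+ᴿ≡⊕ x (-ᴿ y)) (cong (x ⊕_) (-ᴿ≡⊖ y))

opaque
  unfolding _⊞_ _⊠_ ⊟_ ρ

  +ᶜ≡⊞ : ∀ z w → z +ᶜ w ≡ z ⊞ w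
  +ᶜ≡⊞ z w = cong₂ mkℂ (+ᴿ≡⊕ (re z) (re w)) (+ᴿ≡⊕ (im z) (im w))

  -ᶜ≡⊟ : ∀ z w → z -ᶜ w ≡ z ⊟ w
  -ᶜ≡⊟ z w = cong₂ mkℂ (-ᴿ≡⊝ (re z) (re w)) (-ᴿ≡⊝ (im z) (im w))

  *ᶜ≡⊠ : ∀ z w → z *ᶜ w ≡ z ⊠ w
  *ᶜ≡⊠ z w = cong₂ mkℂ
    (trans (-ᴿ≡⊝ (re z *ᴿ re w) (im z *ᴿ im w)) (cong₂ _⊝_ (*ᴿ≡⊗ (re z) (re w)) (*ᴿ≡⊗ (im z) (im w))))
    (trans (+ᴿ≡⊕ (re z *ᴿ im w) (im z *ᴿ re w)) (cong₂ _⊕_ (*ᴿ≡⊗ (re z) (im w)) (*ᴿ≡⊗ (im z) (re w))))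

  fromℝ≡ρ : ∀ x → fromℝ x ≡ ρ x
  fromℝ≡ρ x = cong (mkℂ x) (fromℚ≡ι 0ℚ)

fromℚ≡κ : ∀ q → fromℝ (fromℚ q) ≡ κ q
fromℚ≡κ q = trans (fromℝ≡ρ (fromℚ q)) (cong ρ (fromℚ≡ι q))

sum : ℕ → (ℕ → ℂ) → ℂ
sum zero    f = κ 0ℚ
sum (suc N) f = sum N f ⊞ f N

∑≡sum : ∀ N f → ∑ N f ≡ sum N f
∑≡sum zero    f = fromℚ≡κ 0ℚ
∑≡sum (suc N) f = trans (+ᶜ≡⊞ (∑ N f) (f N)) (cong (_⊞ f N) (∑≡sum N f))

sum-cong : ∀ N {f g} → (∀ i → i ℕ.< N → f i ≅ g i) → sum N f ≅ sum N g
sum-cong zero    h = ≅-refl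
sum-cong (suc N) h = ⊞-cong (sum-cong N λ i i<N → h i (ℕP.m<n⇒m<1+n i<N)) (h N ℕP.≤-refl)

sum-⊞ : ∀ N f g → sum N (λ i → f i ⊞ g i) ≅ sum N f ⊞ sum N g
sum-⊞ zero    f g = ≅-sym (⊞-identityˡ (κ 0ℚ))
sum-⊞ (suc N) f g = ≅-trans (⊞-cong (sum-⊞ N f g) ≅-refl)
  (solve 4 (λ a b c d → a :+ b :+ (c :+ d) := a :+ c :+ (b :+ d)) ≅-refl (sum N f) (sum N g) (f N) (g N))
  where open ℂ-Solver

sum-⊠ˡ : ∀ N z f → sum N (λ i → z ⊠ f i) ≅ z ⊠ sum N f
sum-⊠ˡ zero    z f = solve 1 (λ z → con 0ℚ := z :* con 0ℚ) ≅-refl z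
  where open ℂ-Solver
sum-⊠ˡ (suc N) z f = ≅-trans (⊞-cong (sum-⊠ˡ N z f) ≅-refl) (≅-sym (⊠-distribˡ-⊞ z (sum N f) (f N)))

sum-⊠ʳ : ∀ N z f → sum N (λ i → f i ⊠ z) ≅ sum N f ⊠ z
sum-⊠ʳ N z f = ≅-trans (sum-cong N λ i _ → ⊠-comm (f i) z) (≅-trans (sum-⊠ˡ N z f) (⊠-comm z (sum N f)))

sum-suc : ∀ N f → sum (suc N) f ≅ f 0 ⊞ sum N (λ i → f (suc i))
sum-suc zero    f = ⊞-comm (κ 0ℚ) (f 0)
sum-suc (suc N) f = ≅-trans (⊞-cong (sum-suc N f) ≅-refl) (⊞-assoc (f 0) _ (f (suc N)))

norm-sum : ∀ N {f b} → (∀ i → i ℕ.< N → norm (f i) ≼ ι (b i)) → norm (sum N f) ≼ ι (∑ℚ N b)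
norm-sum zero    h = norm-0
norm-sum (suc N) {f} {b} h = ≼-trans (norm-⊞ (sum N f) (f N))
  (≼-trans (⊕-mono (norm-sum N λ i i<N → h i (ℕP.m<n⇒m<1+n i<N)) (h N ℕP.≤-refl))
    (≼-reflexive (≃-sym (ι-+ (∑ℚ N b) (b N)))))

-- A sum of ones, so that `nat (suc n)` computes to `nat n + 1ℚ`.
nat : ℕ → ℚ
nat n = ×ℚ n 1ℚ

nat-+ : ∀ m n → nat (m ℕ.+ n) ≡ nat m + nat n
nat-+ m zero    = trans (cong nat (ℕP.+-identityʳ m)) (sym (ℚP.+-identityʳ (nat m)))
nat-+ m (suc n) = trans (cong nat (ℕP.+-suc m n))
  (trans (cong (_+ 1ℚ) (nat-+ m n)) (ℚP.+-assoc (nat m) (nat n) 1ℚ))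

1/suc*nat : ∀ n → 1/suc n * nat (suc n) ≡ 1ℚ
1/suc*nat n = trans (sym (×ℚ-* (suc n) (1/suc n) 1ℚ))
  (trans (cong (×ℚ (suc n)) (ℚP.*-identityʳ (1/suc n))) (×ℚ-1/suc n))

κ-+ : ∀ p q → κ (p + q) ≅ κ p ⊞ κ q
κ-+ p q = ≅-trans (ρ-cong (ι-+ p q)) (ρ-⊕ (ι p) (ι q))

κ-* : ∀ p q → κ (p * q) ≅ κ p ⊠ κ q
κ-* p q = ≅-trans (ρ-cong (ι-* p q)) (ρ-⊗ (ι p) (ι q))

-- This is z^k / k!, in the recursive form that makes (k + 1) e(k + 1) = z e(k) immediate;
-- `^ⁿ-expTerm` identifies it with the terms of the defining series.
expTerm : ℂ → ℕ → ℂ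
expTerm z zero    = κ 1ℚ
expTerm z (suc k) = κ (1/suc k) ⊠ (z ⊠ expTerm z k)

expSum : ℂ → ℕ → ℂ
expSum z N = sum N (expTerm z)

expTerm-cong : ∀ {z w} → z ≅ w → ∀ k → expTerm z k ≅ expTerm w k
expTerm-cong h zero    = ≅-refl
expTerm-cong h (suc k) = ⊠-cong ≅-refl (⊠-cong h (expTerm-cong h k))

nat⊠expTerm : ∀ z k → κ (nat (suc k)) ⊠ expTerm z (suc k) ≅ z ⊠ expTerm z k
nat⊠expTerm z k = begin
  κ (nat (suc k)) ⊠ (κ (1/suc k) ⊠ (z ⊠ expTerm z k))
    ≈⟨ solve 3 (λ n i t → n :* (i :* t) := i :* n :* t) ≅-refl _ _ _ ⟩
  κ (1/suc k) ⊠ κ (nat (suc k)) ⊠ (z ⊠ expTerm z k)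
    ≈⟨ ⊠-cong (≅-trans (≅-sym (κ-* (1/suc k) (nat (suc k)))) (κ-cong (1/suc*nat k))) ≅-refl ⟩
  κ 1ℚ ⊠ (z ⊠ expTerm z k)   ≈⟨ ⊠-identityˡ _ ⟩
  z ⊠ expTerm z k            ∎
  where
  open ≅-Reasoning
  open ℂ-Solver

^ⁿ-expTerm : ∀ z k → fromℝ (fromℚ (inv! k)) *ᶜ z ^ⁿ k ≅ expTerm z k
^ⁿ-expTerm z k = ≅-trans (≡⇒≅ (trans (*ᶜ≡⊠ (fromℝ (fromℚ (inv! k))) (z ^ⁿ k))
  (cong (_⊠ z ^ⁿ k) (fromℚ≡κ (inv! k))))) (go k)
  where
  open ≅-Reasoning
  open ℂ-Solver
  go : ∀ k → κ (inv! k) ⊠ z ^ⁿ k ≅ expTerm z k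
  go zero    = ≅-trans (⊠-cong ≅-refl (≡⇒≅ (fromℚ≡κ 1ℚ))) (⊠-identityˡ (κ 1ℚ))
  go (suc k) = begin
    κ (inv! (suc k)) ⊠ z ^ⁿ suc k
      ≈⟨ ⊠-cong (≅-trans (κ-cong (1/!-suc k)) (κ-* (inv! k) (1/suc k))) (≡⇒≅ (*ᶜ≡⊠ (z ^ⁿ k) z)) ⟩
    κ (inv! k) ⊠ κ (1/suc k) ⊠ (z ^ⁿ k ⊠ z)
      ≈⟨ solve 4 (λ a b p z → a :* b :* (p :* z) := b :* (z :* (a :* p))) ≅-refl _ _ _ _ ⟩
    κ (1/suc k) ⊠ (z ⊠ (κ (inv! k) ⊠ z ^ⁿ k))
      ≈⟨ ⊠-cong ≅-refl (⊠-cong ≅-refl (go k)) ⟩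
    expTerm z (suc k) ∎

expPartial≅expSum : ∀ z N → expPartial z N ≅ expSum z N
expPartial≅expSum z N = ≅-trans (≡⇒≅ (∑≡sum N _)) (sum-cong N λ k _ → ^ⁿ-expTerm z k)

opaque
  Exp : ℂ → ℂ
  Exp = exp

opaque
  unfolding lim Exp

  re-Exp : ∀ z → re (Exp z) ≡ lim (λ N → re (expPartial z N)) (proj₁ (cauchy-exp z))
  re-Exp z = refl

  im-Exp : ∀ z → im (Exp z) ≡ lim (λ N → im (expPartial z N)) (proj₂ (cauchy-exp z))
  im-Exp z = refl

expPartial-⇝ : ∀ z → expPartial z ⇝ Exp z
expPartial-⇝ z = ⇝-parts
  (subst (λ x → ∀ ε → 0ℚ < ε → Eventually λ n → abs (re (expPartial z n) ⊝ x) ≼ ι ε) (sym (re-Exp z))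
    (lim-close (λ N → re (expPartial z N)) (proj₁ (cauchy-exp z))))
  (subst (λ x → ∀ ε → 0ℚ < ε → Eventually λ n → abs (im (expPartial z n) ⊝ x) ≼ ι ε) (sym (im-Exp z))
    (lim-close (λ N → im (expPartial z N)) (proj₂ (cauchy-exp z))))

expSum-⇝ : ∀ z → expSum z ⇝ Exp z
expSum-⇝ z = ⇝-cong (always (expPartial≅expSum z)) ≅-refl (expPartial-⇝ z)

Exp-cong : ∀ {z w} → z ≅ w → Exp z ≅ Exp w
Exp-cong {z} {w} h = ⇝-unique
  (⇝-cong (always λ N → sum-cong N λ k _ → expTerm-cong h k) ≅-refl (expSum-⇝ z)) (expSum-⇝ w)

-- The addition formula, by Cauchy products

convolution : ℂ → ℂ → ℕ → ℂ
convolution z w n = sum (suc n) (λ j → expTerm z j ⊠ expTerm w (n ℕ.∸ j))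

-- The Leibniz rule in place of binomial coefficients: split n + 1 as j + (n + 1 - j) in the j-th
-- summand. The factor j turns e(j) into z e(j - 1), the other factor lowers the second index, and
-- each half loses the end term where its factor is 0.
nat⊠convolution : ∀ z w n → κ (nat (suc n)) ⊠ convolution z w (suc n) ≅ (z ⊞ w) ⊠ convolution z w n
nat⊠convolution z w n = begin
  κ (nat (suc n)) ⊠ convolution z w (suc n)
    ≈⟨ sum-⊠ˡ (suc (suc n)) _ _ ⟨
  sum (suc (suc n)) (λ j → κ (nat (suc n)) ⊠ (e j ⊠ f (suc n ℕ.∸ j)))
    ≈⟨ sum-cong (suc (suc n)) (λ j j< → split j (ℕP.≤-pred j<)) ⟩
  sum (suc (suc n)) (λ j → a j ⊞ b j)   ≈⟨ sum-⊞ (suc (suc n)) a b ⟩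
  sum (suc (suc n)) a ⊞ sum (suc (suc n)) b
    ≈⟨ ⊞-cong (≅-trans (sum-suc (suc n) a) (⊞-cong a₀ (sum-cong (suc n) λ j _ → aₛ j)))
              (⊞-cong (sum-cong (suc n) λ j j< → b≤ j (ℕP.≤-pred j<)) bₙ) ⟩
  (κ 0ℚ ⊞ sum (suc n) (λ j → z ⊠ g j)) ⊞ (sum (suc n) (λ j → w ⊠ g j) ⊞ κ 0ℚ)
    ≈⟨ ⊞-cong (⊞-cong ≅-refl (sum-⊠ˡ (suc n) z g)) (⊞-cong (sum-⊠ˡ (suc n) w g) ≅-refl) ⟩
  (κ 0ℚ ⊞ z ⊠ convolution z w n) ⊞ (w ⊠ convolution z w n ⊞ κ 0ℚ)
    ≈⟨ solve 3 (λ z w c → (con 0ℚ :+ z :* c) :+ (w :* c :+ con 0ℚ) := (z :+ w) :* c) ≅-refl z w _ ⟩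
  (z ⊞ w) ⊠ convolution z w n ∎
  where
  open ≅-Reasoning
  open ℂ-Solver
  e f g a b : ℕ → ℂ
  e = expTerm z
  f = expTerm w
  g j = e j ⊠ f (n ℕ.∸ j)
  a j = κ (nat j) ⊠ e j ⊠ f (suc n ℕ.∸ j)
  b j = e j ⊠ (κ (nat (suc n ℕ.∸ j)) ⊠ f (suc n ℕ.∸ j))

  split : ∀ j → j ℕ.≤ suc n → κ (nat (suc n)) ⊠ (e j ⊠ f (suc n ℕ.∸ j)) ≅ a j ⊞ b j
  split j j≤ = ≅-trans
    (⊠-cong (≅-trans (κ-cong (trans (cong nat (sym (ℕP.m+[n∸m]≡n j≤))) (nat-+ j (suc n ℕ.∸ j))))
                     (κ-+ (nat j) (nat (suc n ℕ.∸ j)))) ≅-refl)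
    (solve 4 (λ p q x y → (p :+ q) :* (x :* y) := p :* x :* y :+ x :* (q :* y)) ≅-refl _ _ _ _)

  a₀ : a 0 ≅ κ 0ℚ
  a₀ = solve 2 (λ x y → con 0ℚ :* x :* y := con 0ℚ) ≅-refl _ _

  aₛ : ∀ j → a (suc j) ≅ z ⊠ g j
  aₛ j = ≅-trans (⊠-cong (nat⊠expTerm z j) ≅-refl) (⊠-assoc z (e j) (f (n ℕ.∸ j)))

  b≤ : ∀ j → j ℕ.≤ n → b j ≅ w ⊠ g j
  b≤ j j≤n = ≅-trans
    (⊠-cong ≅-refl (≅-trans (≡⇒≅ (cong (λ k → κ (nat k) ⊠ f k) (ℕP.+-∸-assoc 1 j≤n)))
      (nat⊠expTerm w (n ℕ.∸ j))))
    (solve 3 (λ x w y → x :* (w :* y) := w :* (x :* y)) ≅-refl _ _ _)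

  bₙ : b (suc n) ≅ κ 0ℚ
  bₙ = ≅-trans (⊠-cong ≅-refl (⊠-cong (κ-cong (cong nat (ℕP.n∸n≡0 n))) ≅-refl))
    (solve 2 (λ x y → x :* (con 0ℚ :* y) := con 0ℚ) ≅-refl _ _)

-- Both sides start at 1 and satisfy (n + 1) x(n + 1) = (z + w) x(n); the factor n + 1 is cancelled
-- by its rational inverse.
convolution≅expTerm : ∀ z w n → convolution z w n ≅ expTerm (z ⊞ w) n
convolution≅expTerm z w zero = solve 0 (con 0ℚ :+ con 1ℚ :* con 1ℚ := con 1ℚ) ≅-refl
  where open ℂ-Solver
convolution≅expTerm z w (suc n) = begin
  c                                                  ≈⟨ ⊠-identityˡ c ⟨
  κ 1ℚ ⊠ c                                           ≈⟨ ⊠-cong (κ-cong (1/suc*nat n)) ≅-refl ⟨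
  κ (1/suc n * nat (suc n)) ⊠ c                      ≈⟨ ⊠-cong (κ-* (1/suc n) (nat (suc n))) ≅-refl ⟩
  κ (1/suc n) ⊠ κ (nat (suc n)) ⊠ c                  ≈⟨ ⊠-assoc _ _ c ⟩
  κ (1/suc n) ⊠ (κ (nat (suc n)) ⊠ c)                ≈⟨ ⊠-cong ≅-refl (nat⊠convolution z w n) ⟩
  κ (1/suc n) ⊠ ((z ⊞ w) ⊠ convolution z w n)        ≈⟨ ⊠-cong ≅-refl (⊠-cong ≅-refl (convolution≅expTerm z w n)) ⟩
  expTerm (z ⊞ w) (suc n)                            ∎
  where
  open ≅-Reasoning
  c : ℂ
  c = convolution z w (suc n)

-- The left side adds the triangle i + j < N by rows. Passing to N + 1 adds the antidiagonal i + j =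
-- N, which is `convolution z w N`; the new row N contributes nothing else.
expSum-triangle : ∀ z w N → sum N (λ j → expTerm z j ⊠ expSum w (N ℕ.∸ j)) ≅ expSum (z ⊞ w) N
expSum-triangle z w zero    = ≅-refl
expSum-triangle z w (suc N) = begin
  sum (suc N) (λ j → e j ⊠ expSum w (suc N ℕ.∸ j))
    ≈⟨ sum-cong (suc N) (λ j j< → ≅-trans (≡⇒≅ (cong (λ k → e j ⊠ expSum w k) (ℕP.+-∸-assoc 1 (ℕP.≤-pred j<))))
         (⊠-distribˡ-⊞ (e j) _ _)) ⟩
  sum (suc N) (λ j → e j ⊠ expSum w (N ℕ.∸ j) ⊞ e j ⊠ expTerm w (N ℕ.∸ j))
    ≈⟨ sum-⊞ (suc N) _ _ ⟩
  sum N (λ j → e j ⊠ expSum w (N ℕ.∸ j)) ⊞ e N ⊠ expSum w (N ℕ.∸ N) ⊞ convolution z w N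
    ≈⟨ ⊞-cong (⊞-cong (expSum-triangle z w N) (⊠-cong ≅-refl (≡⇒≅ (cong (expSum w) (ℕP.n∸n≡0 N)))))
              (convolution≅expTerm z w N) ⟩
  expSum (z ⊞ w) N ⊞ e N ⊠ κ 0ℚ ⊞ expTerm (z ⊞ w) N
    ≈⟨ solve 3 (λ s x t → s :+ x :* con 0ℚ :+ t := s :+ t) ≅-refl _ _ _ ⟩
  expSum (z ⊞ w) (suc N) ∎
  where
  open ≅-Reasoning
  open ℂ-Solver
  e : ℕ → ℂ
  e = expTerm z

∑ℚ-*ˡ : ∀ n c f → ∑ℚ n (λ i → c * f i) ≡ c * ∑ℚ n f
∑ℚ-*ˡ zero    c f = sym (ℚP.*-zeroʳ c)
∑ℚ-*ˡ (suc n) c f = trans (cong (_+ c * f n) (∑ℚ-*ˡ n c f)) (sym (ℚP.*-distribˡ-+ c (∑ℚ n f) (f n)))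

p≤p+q : ∀ p {q} → 0ℚ ≤ q → p ≤ p + q
p≤p+q p {q} 0≤q = subst (_≤ p + q) (ℚP.+-identityʳ p) (ℚP.+-monoʳ-≤ p 0≤q)

∑ℚ-grow : ∀ {f} → (∀ i → 0ℚ ≤ f i) → ∀ m n → ∑ℚ m f ≤ ∑ℚ (m ℕ.+ n) f
∑ℚ-grow {f} 0≤f m zero    = ℚP.≤-reflexive (cong (λ k → ∑ℚ k f) (sym (ℕP.+-identityʳ m)))
∑ℚ-grow {f} 0≤f m (suc n) = ℚP.≤-trans (∑ℚ-grow 0≤f m n) (ℚP.≤-trans
  (p≤p+q (∑ℚ (m ℕ.+ n) f) (0≤f (m ℕ.+ n)))
  (ℚP.≤-reflexive (cong (λ k → ∑ℚ k f) (sym (ℕP.+-suc m n)))))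

∑ℚ-nonneg : ∀ {f} → (∀ i → 0ℚ ≤ f i) → ∀ n → 0ℚ ≤ ∑ℚ n f
∑ℚ-nonneg 0≤f = ∑ℚ-grow 0≤f 0

pow-+ : ∀ B m n → pow B (m ℕ.+ n) ≡ pow B m * pow B n
pow-+ B m zero    = trans (cong (pow B) (ℕP.+-identityʳ m)) (sym (ℚP.*-identityʳ (pow B m)))
pow-+ B m (suc n) = trans (cong (pow B) (ℕP.+-suc m n))
  (trans (cong (_* B) (pow-+ B m n)) (ℚP.*-assoc (pow B m) (pow B n) B))

pow-* : ∀ A B k → pow (A * B) k ≡ pow A k * pow B k
pow-* A B zero    = refl
pow-* A B (suc k) = trans (cong (_* (A * B)) (pow-* A B k))
  (solve 4 (λ p q a b → p :* q :* (a :* b) := p :* a :* (q :* b)) refl (pow A k) (pow B k) A B)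
  where open +-*-Solver

0≤½ : 0ℚ ≤ ½
0≤½ = ℚP.<⇒≤ (ℚP.positive⁻¹ ½)

pow½-antitone : ∀ m n → pow ½ (m ℕ.+ n) ≤ pow ½ m
pow½-antitone m zero    = ℚP.≤-reflexive (cong (pow ½) (ℕP.+-identityʳ m))
pow½-antitone m (suc n) = ℚP.≤-trans (ℚP.≤-reflexive (cong (pow ½) (ℕP.+-suc m n)))
  (ℚP.≤-trans (halve (0≤pow 0≤½ (m ℕ.+ n))) (pow½-antitone m n))
  where
  halve : ∀ {p} → 0ℚ ≤ p → p * ½ ≤ p
  halve {p} 0≤p = ℚP.≤-trans
    (ℚP.*-monoˡ-≤-nonNeg p {{nonNegative 0≤p}} (p≤p+q ½ 0≤½))
    (ℚP.≤-reflexive (ℚP.*-identityʳ p))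

majorant-halve : ∀ A k → majorant A k ≡ pow ½ k * majorant (A + A) k
majorant-halve A k = trans (cong (λ a → inv! k * pow a k) A≡)
  (trans (cong (inv! k *_) (pow-* ½ (A + A) k))
    (solve 3 (λ i p q → i :* (p :* q) := p :* (i :* q)) refl (inv! k) (pow ½ k) (pow (A + A) k)))
  where
  open +-*-Solver
  A≡ : A ≡ ½ * (A + A)
  A≡ = trans (sym (½+½ A)) (sym (ℚP.*-distribˡ-+ ½ A A))

0≤+ : ∀ {p q} → 0ℚ ≤ p → 0ℚ ≤ q → 0ℚ ≤ p + q
0≤+ = ℚP.+-mono-≤

-- Once B/(k + 1) ≤ ½ each term is at most half the one before, so everything from such an index K
-- on adds at most 2 t(K) to the sum of the first K terms.
majorant-sum-bound : ∀ {B} → 0ℚ < B → ∃[ C ] (0ℚ ≤ C × ∀ N → ∑ℚ N (majorant B) ≤ C)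
majorant-sum-bound {B} 0<B = go (quotient (ℚP.positive⁻¹ ½) 0<B)
  where
  0≤B : 0ℚ ≤ B
  0≤B = ℚP.<⇒≤ 0<B
  t s : ℕ → ℚ
  t = majorant B
  s N = ∑ℚ N t
  0≤t : ∀ k → 0ℚ ≤ t k
  0≤t = 0≤majorant 0≤B

  from : ∀ K → (∀ k → K ℕ.≤ k → t (suc k) ≤ ½ * t k) → ∃[ C ] (0ℚ ≤ C × ∀ N → s N ≤ C)
  from K h = s K + (t K + t K) , 0≤+ (∑ℚ-nonneg 0≤t K) (0≤+ (0≤t K) (0≤t K)) , λ N → begin
    s N                                        ≤⟨ ∑ℚ-grow 0≤t N K ⟩
    s (N ℕ.+ K)                                ≡⟨ cong s (ℕP.+-comm N K) ⟩
    s (K ℕ.+ N)                                ≤⟨ ≤q+∣p-q∣ (s (K ℕ.+ N)) (s K) ⟩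
    s K + ∣ s (K ℕ.+ N) - s K ∣                ≤⟨ ℚP.+-monoʳ-≤ (s K) (drop N) ⟩
    s K + (t K + t K)                          ∎
    where
    open ℚP.≤-Reasoning
    drop : ∀ N → ∣ s (K ℕ.+ N) - s K ∣ ≤ t K + t K
    drop N = ℚP.≤-trans
      (p≤p+q ∣ s (K ℕ.+ N) - s K ∣ (0≤+ (0≤t (K ℕ.+ N)) (0≤t (K ℕ.+ N))))
      (tail t s K 0≤t h (λ k → ℚP.≤-reflexive (trans (cong ∣_∣ (add-sub (s k) (t k))) (ℚP.0≤p⇒∣p∣≡p (0≤t k))))
        K ℕP.≤-refl N)

  go : ∃[ δ ] (0ℚ < δ × B * δ ≡ ½) → ∃[ C ] (0ℚ ≤ C × ∀ N → s N ≤ C)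
  go (δ , 0<δ , eq) = go₂ (archimedean δ 0<δ)
    where
    go₂ : ∃[ K ] (∀ n → K ℕ.≤ n → 1/suc n ≤ δ) → ∃[ C ] (0ℚ ≤ C × ∀ N → s N ≤ C)
    go₂ (K , hK) = from K λ k K≤k → majorant-step 0≤B k (ℚP.≤-trans
      (ℚP.*-monoˡ-≤-nonNeg B {{nonNegative 0≤B}} (hK k K≤k)) (ℚP.≤-reflexive eq))

norm-expTerm : ∀ {z A} → norm z ≼ ι A → ∀ k → norm (expTerm z k) ≼ ι (majorant A k)
norm-expTerm {z} {A} h zero    = ≼-reflexive (norm-κ (ℚP.<⇒≤ 0<1))
norm-expTerm {z} {A} h (suc k) = begin
  norm (κ (1/suc k) ⊠ (z ⊠ expTerm z k))
    ≲⟨ ≼-trans (norm-⊠ _ _) (⊗-monoˡ (norm-nonneg _) (norm-⊠ _ _)) ⟩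
  norm (κ (1/suc k)) ⊗ (norm z ⊗ norm (expTerm z k))
    ≲⟨ ⊗-mono (norm-nonneg _) (⊗-nonneg 0≼A 0≼m) (≼-reflexive (norm-κ (0≤1/suc k)))
         (⊗-mono (norm-nonneg _) 0≼m h (norm-expTerm h k)) ⟩
  ι (1/suc k) ⊗ (ι A ⊗ ι (majorant A k))
    ≈⟨ ≃-trans (ι-* (1/suc k) (A * majorant A k)) (⊗-cong ≃-refl (ι-* A (majorant A k))) ⟨
  ι (1/suc k * (A * majorant A k))  ≈⟨ ι-cong step ⟨
  ι (majorant A (suc k))            ∎
  where
  open ≼-Reasoning
  0≼m : ι 0ℚ ≼ ι (majorant A k)
  0≼m = ≼-trans (norm-nonneg _) (norm-expTerm h k)
  0≼A : ι 0ℚ ≼ ι A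
  0≼A = ≼-trans (norm-nonneg _) h
  step : majorant A (suc k) ≡ 1/suc k * (A * majorant A k)
  step = trans (cong (_* (pow A k * A)) (1/!-suc k))
    (solve 4 (λ f s p a → f :* s :* (p :* a) := s :* (a :* (f :* p))) refl (inv! k) (1/suc k) (pow A k) A)
    where open +-*-Solver

-- 1/2^k is split off each majorant term by doubling the argument of the majorant.
expSum-tail : ∀ {w B} → 0ℚ ≤ B → norm w ≼ ι B → ∀ M j →
  norm (expSum w (M ℕ.+ j) ⊟ expSum w M) ≼ ι (pow ½ M * ∑ℚ (M ℕ.+ j) (majorant (B + B)))
expSum-tail {w} {B} 0≤B h M zero = ≼-trans
  (≼-reflexive (norm-cong (≅-trans (≡⇒≅ (cong (λ k → expSum w k ⊟ expSum w M) (ℕP.+-identityʳ M)))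
    (solve 1 (λ x → x :- x := con 0ℚ) ≅-refl (expSum w M)))))
  (≼-trans norm-0 (ι-mono (0≤* (0≤pow 0≤½ M) (∑ℚ-nonneg (0≤majorant (0≤+ 0≤B 0≤B)) (M ℕ.+ 0)))))
  where open ℂ-Solver
expSum-tail {w} {B} 0≤B h M (suc j) = begin
  norm (expSum w (M ℕ.+ suc j) ⊟ expSum w M)
    ≈⟨ norm-cong (≅-trans (≡⇒≅ (cong (λ k → expSum w k ⊟ expSum w M) (ℕP.+-suc M j)))
         (solve 3 (λ a b c → a :+ b :- c := (a :- c) :+ b) ≅-refl (expSum w n) (expTerm w n) (expSum w M))) ⟩
  norm ((expSum w n ⊟ expSum w M) ⊞ expTerm w n)
    ≲⟨ ≼-trans (norm-⊞ _ _) (⊕-mono (expSum-tail 0≤B h M j) (norm-expTerm h n)) ⟩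
  ι (pow ½ M * S) ⊕ ι (majorant B n)
    ≲⟨ ⊕-monoˡ _ (ι-mono (ℚP.≤-trans (ℚP.≤-reflexive (majorant-halve B n))
         (ℚP.*-monoʳ-≤-nonNeg (majorant (B + B) n) {{nonNegative (0≤m n)}} (pow½-antitone M j)))) ⟩
  ι (pow ½ M * S) ⊕ ι (pow ½ M * majorant (B + B) n)
    ≈⟨ ι-+ _ _ ⟨
  ι (pow ½ M * S + pow ½ M * majorant (B + B) n)
    ≈⟨ ι-cong (trans (sym (ℚP.*-distribˡ-+ (pow ½ M) S (majorant (B + B) n)))
         (cong (λ k → pow ½ M * ∑ℚ k (majorant (B + B))) (sym (ℕP.+-suc M j)))) ⟩
  ι (pow ½ M * ∑ℚ (M ℕ.+ suc j) (majorant (B + B))) ∎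
  where
  open ≼-Reasoning
  open ℂ-Solver
  n : ℕ
  n = M ℕ.+ j
  S : ℚ
  S = ∑ℚ n (majorant (B + B))
  0≤m : ∀ k → 0ℚ ≤ majorant (B + B) k
  0≤m = 0≤majorant (0≤+ 0≤B 0≤B)

-- Square minus triangle: row j leaves e(j) times the part of the series of w from N - j on.
-- `majorant-halve` takes 2^(-j) out of e(j) and `expSum-tail` takes 2^(-(N - j)) out of the rest,
-- so every row carries the same factor 2^(-N), and the remaining sums over the doubled arguments
-- are bounded by C and D.
expSum-product : ∀ {z w A B C D} → 0ℚ ≤ A → 0ℚ ≤ B → 0ℚ ≤ D →
  norm z ≼ ι A → norm w ≼ ι B →
  (∀ N → ∑ℚ N (majorant (A + A)) ≤ C) → (∀ N → ∑ℚ N (majorant (B + B)) ≤ D) →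
  ∀ N → norm (expSum z N ⊠ expSum w N ⊟ expSum (z ⊞ w) N) ≼ ι (pow ½ N * D * C)
expSum-product {z} {w} {A} {B} {C} {D} 0≤A 0≤B 0≤D hz hw hC hD N = begin
  norm (expSum z N ⊠ expSum w N ⊟ expSum (z ⊞ w) N)
    ≈⟨ norm-cong (⊞-cong (sum-⊠ʳ N (expSum w N) e)
         (≅-trans (neg-sum N _) (⊟-cong (expSum-triangle z w N)))) ⟨
  norm (sum N (λ j → e j ⊠ expSum w N) ⊞ sum N (λ j → ⊟ (e j ⊠ expSum w (N ℕ.∸ j))))
    ≈⟨ norm-cong (sum-⊞ N _ _) ⟨
  norm (sum N (λ j → e j ⊠ expSum w N ⊟ e j ⊠ expSum w (N ℕ.∸ j)))
    ≲⟨ norm-sum N (λ j j<N → row j (ℕP.<⇒≤ j<N)) ⟩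
  ι (∑ℚ N (λ j → pow ½ N * D * majorant (A + A) j))
    ≲⟨ ι-mono (ℚP.≤-trans (ℚP.≤-reflexive (∑ℚ-*ˡ N (pow ½ N * D) (majorant (A + A))))
         (ℚP.*-monoˡ-≤-nonNeg (pow ½ N * D) {{nonNegative (0≤* (0≤pow 0≤½ N) 0≤D)}} (hC N))) ⟩
  ι (pow ½ N * D * C) ∎
  where
  open ≼-Reasoning
  e : ℕ → ℂ
  e = expTerm z

  neg-sum : ∀ N f → sum N (λ j → ⊟ f j) ≅ ⊟ sum N f
  neg-sum zero    f = solve 0 (con 0ℚ := :- con 0ℚ) ≅-refl
    where open ℂ-Solver
  neg-sum (suc N) f = ≅-trans (⊞-cong (neg-sum N f) ≅-refl)
    (solve 2 (λ a b → :- a :+ :- b := :- (a :+ b)) ≅-refl (sum N f) (f N))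
    where open ℂ-Solver

  rational : ∀ j → j ℕ.≤ N →
    majorant A j * (pow ½ (N ℕ.∸ j) * D) ≡ pow ½ N * D * majorant (A + A) j
  rational j j≤N = trans (cong (_* (pow ½ (N ℕ.∸ j) * D)) (majorant-halve A j))
    (trans (solve 4 (λ p m q d → p :* m :* (q :* d) := p :* q :* d :* m) refl
      (pow ½ j) (majorant (A + A) j) (pow ½ (N ℕ.∸ j)) D)
      (cong (λ p → p * D * majorant (A + A) j)
        (trans (sym (pow-+ ½ j (N ℕ.∸ j))) (cong (pow ½) (ℕP.m+[n∸m]≡n j≤N)))))
    where open +-*-Solver

  row : ∀ j → j ℕ.≤ N →
    norm (e j ⊠ expSum w N ⊟ e j ⊠ expSum w (N ℕ.∸ j)) ≼ ι (pow ½ N * D * majorant (A + A) j)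
  row j j≤N = begin
    norm (e j ⊠ expSum w N ⊟ e j ⊠ expSum w M)
      ≈⟨ norm-cong (solve 3 (λ x y u → x :* y :- x :* u := x :* (y :- u)) ≅-refl (e j) (expSum w N) (expSum w M)) ⟩
    norm (e j ⊠ (expSum w N ⊟ expSum w M))
      ≈⟨ norm-cong (≡⇒≅ (cong (λ k → e j ⊠ (expSum w k ⊟ expSum w M)) (sym (ℕP.m∸n+n≡m j≤N)))) ⟩
    norm (e j ⊠ (expSum w (M ℕ.+ j) ⊟ expSum w M))
      ≲⟨ norm-⊠ _ _ ⟩
    norm (e j) ⊗ norm (expSum w (M ℕ.+ j) ⊟ expSum w M)
      ≲⟨ ⊗-mono (norm-nonneg _) (ι-nonneg (0≤* (0≤pow 0≤½ M) 0≤D)) (norm-expTerm hz j)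
           (≼-trans (expSum-tail 0≤B hw M j)
             (ι-mono (ℚP.*-monoˡ-≤-nonNeg (pow ½ M) {{nonNegative (0≤pow 0≤½ M)}} (hD (M ℕ.+ j))))) ⟩
    ι (majorant A j) ⊗ ι (pow ½ M * D)
      ≈⟨ ι-* _ _ ⟨
    ι (majorant A j * (pow ½ M * D))
      ≈⟨ ι-cong (rational j j≤N) ⟩
    ι (pow ½ N * D * majorant (A + A) j) ∎
    where
    open ℂ-Solver
    M : ℕ
    M = N ℕ.∸ j

-- `halving` started at index 0 gives 2^(-n) ≤ 1/(n + 1).
null-pow½ : Null (λ N → ι (pow ½ N))
null-pow½ ε 0<ε = eventually-map
  (λ n p → ι-mono (ℚP.≤-trans (halving (pow ½) 0 (0≤pow 0≤½)
    (λ k _ → ℚP.≤-reflexive (ℚP.*-comm (pow ½ k) ½)) n)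
    (ℚP.≤-trans (ℚP.≤-reflexive (ℚP.*-identityˡ (1/suc n))) p)))
  (archimedean ε 0<ε)

⇝-close : ∀ {f g z} → Null (λ n → norm (f n ⊟ g n)) → f ⇝ z → g ⇝ z
⇝-close {f} {g} {z} h k = ⇝-squeeze (null-⊕ h (⇝-null k)) (always λ n → ≼-trans
  (norm-triangle (g n) (f n) z) (⊕-monoʳ _ (≼-reflexive (norm-dist-comm (g n) (f n)))))

Exp-⊞ : ∀ z w → Exp (z ⊞ w) ≅ Exp z ⊠ Exp w
Exp-⊞ z w = bounds (norm-bound z) (norm-bound w)
  where
  bounds : ∃[ A ] (0ℚ < A × norm z ≼ ι A) → ∃[ B ] (0ℚ < B × norm w ≼ ι B) →
    Exp (z ⊞ w) ≅ Exp z ⊠ Exp w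
  bounds (A , 0<A , hz) (B , 0<B , hw) =
    sums (majorant-sum-bound (0<+ 0<A 0<A)) (majorant-sum-bound (0<+ 0<B 0<B))
    where
    sums : ∃[ C ] (0ℚ ≤ C × ∀ N → ∑ℚ N (majorant (A + A)) ≤ C) →
           ∃[ D ] (0ℚ ≤ D × ∀ N → ∑ℚ N (majorant (B + B)) ≤ D) → Exp (z ⊞ w) ≅ Exp z ⊠ Exp w
    sums (C , 0≤C , hC) (D , 0≤D , hD) = ⇝-unique (expSum-⇝ (z ⊞ w))
      (⇝-close (null-≼ (always λ N → ≼-trans
          (expSum-product (ℚP.<⇒≤ 0<A) (ℚP.<⇒≤ 0<B) 0≤D hz hw hC hD N)
          (≼-reflexive (shape N)))
        (null-⊗ {x = ι (D * C)} null-pow½)) (⇝-⊠ (expSum-⇝ z) (expSum-⇝ w)))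
      where
      shape : ∀ N → ι (pow ½ N * D * C) ≃ abs (ι (D * C)) ⊗ ι (pow ½ N)
      shape N = ≃-trans (ι-cong (trans (ℚP.*-assoc (pow ½ N) D C) (ℚP.*-comm (pow ½ N) (D * C))))
        (≃-trans (ι-* (D * C) (pow ½ N))
          (⊗-cong (≃-sym (abs-nonneg-≃ (ι-nonneg (0≤* 0≤D 0≤C)))) ≃-refl))

-- The real exponential and the size of e^z

opaque
  unfolding _⊕_ _⊗_ ι

  square-nonneg : ∀ x → ι 0ℚ ≼ x ⊗ x
  square-nonneg x = ≼-pointwise (always λ n → subst (0ℚ ≤_) (∣p∣*∣p∣≡p*p (seq x n))
    (0≤* (ℚP.0≤∣p∣ (seq x n)) (ℚP.0≤∣p∣ (seq x n))))

conj-expTerm : ∀ z k → expTerm (conj z) k ≅ conj (expTerm z k)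
conj-expTerm z zero    = ≅-sym (conj-ρ (ι 1ℚ))
conj-expTerm z (suc k) = begin
  κ (1/suc k) ⊠ (conj z ⊠ expTerm (conj z) k)
    ≈⟨ ⊠-cong (≅-sym (conj-ρ (ι (1/suc k)))) (⊠-cong ≅-refl (conj-expTerm z k)) ⟩
  conj (κ (1/suc k)) ⊠ (conj z ⊠ conj (expTerm z k))
    ≈⟨ ⊠-cong ≅-refl (conj-⊠ z (expTerm z k)) ⟨
  conj (κ (1/suc k)) ⊠ conj (z ⊠ expTerm z k)
    ≈⟨ conj-⊠ _ _ ⟨
  conj (expTerm z (suc k)) ∎
  where open ≅-Reasoning

conj-sum : ∀ N f → sum N (λ i → conj (f i)) ≅ conj (sum N f)
conj-sum zero    f = ≅-sym (conj-ρ (ι 0ℚ))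
conj-sum (suc N) f = ≅-trans (⊞-cong (conj-sum N f) ≅-refl) (≅-sym (conj-⊞ (sum N f) (f N)))

Exp-conj : ∀ z → Exp (conj z) ≅ conj (Exp z)
Exp-conj z = ⇝-unique (expSum-⇝ (conj z))
  (⇝-cong (always λ N → ≅-sym (≅-trans (sum-cong N λ k _ → conj-expTerm z k) (conj-sum N (expTerm z))))
    ≅-refl (⇝-conj (expSum-⇝ z)))

Exp-0 : Exp (κ 0ℚ) ≅ κ 1ℚ
-- The partial sums equal 1 only from index 1 on; the empty one is 0.
Exp-0 = ⇝-unique (expSum-⇝ (κ 0ℚ)) (⇝-cong (1 , λ { (suc n) _ → ≅-sym (constant n) }) ≅-refl ⇝-const)
  where
  open ℂ-Solver
  constant : ∀ n → expSum (κ 0ℚ) (suc n) ≅ κ 1ℚ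
  constant zero    = ⊞-identityˡ (κ 1ℚ)
  constant (suc n) = ≅-trans (⊞-cong (constant n) ≅-refl)
    (solve 2 (λ a b → con 1ℚ :+ a :* (con 0ℚ :* b) := con 1ℚ) ≅-refl (κ (1/suc n)) (expTerm (κ 0ℚ) n))

Exp-inverse : ∀ z → Exp (⊟ z) ⊠ Exp z ≅ κ 1ℚ
Exp-inverse z = ≅-trans (≅-sym (Exp-⊞ (⊟ z) z)) (≅-trans (Exp-cong (⊞-inverseˡ z)) Exp-0)

expᴿ : ℝ → ℝ
expᴿ x = re (Exp (ρ x))

opaque
  unfolding conj ρ

  conj-fixed⇒real : ∀ {z} → conj z ≅ z → z ≅ ρ (re z)
  conj-fixed⇒real {z} (mk≅ _ h) = mk≅ ≃-refl (begin
    im z                             ≈⟨ solve 1 (λ y → y := con ½ :* (y :+ y)) ≃-refl (im z) ⟩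
    ι ½ ⊗ (im z ⊕ im z)              ≈⟨ ⊗-cong ≃-refl (⊕-cong h ≃-refl) ⟨
    ι ½ ⊗ (⊖ im z ⊕ im z)            ≈⟨ solve 1 (λ y → con ½ :* (:- y :+ y) := con 0ℚ) ≃-refl (im z) ⟩
    ι 0ℚ                             ∎)
    where
    open import Relation.Binary.Reasoning.Setoid ℝ-setoid
    open ℝ-Solver

-- Conjugation commutes with `Exp` and fixes `ρ x`, hence fixes `Exp (ρ x)`.
Exp-ρ : ∀ x → Exp (ρ x) ≅ ρ (expᴿ x)
Exp-ρ x = conj-fixed⇒real (≅-trans (≅-sym (Exp-conj (ρ x))) (Exp-cong (conj-ρ x)))

expᴿ-cong : ∀ {x y} → x ≃ y → expᴿ x ≃ expᴿ y
expᴿ-cong h = re≃ (Exp-cong (ρ-cong h))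

expᴿ-⊕ : ∀ x y → expᴿ (x ⊕ y) ≃ expᴿ x ⊗ expᴿ y
expᴿ-⊕ x y = ≃-trans (re≃ (begin
  Exp (ρ (x ⊕ y))             ≈⟨ Exp-cong (ρ-⊕ x y) ⟩
  Exp (ρ x ⊞ ρ y)             ≈⟨ Exp-⊞ (ρ x) (ρ y) ⟩
  Exp (ρ x) ⊠ Exp (ρ y)       ≈⟨ ⊠-cong (Exp-ρ x) (Exp-ρ y) ⟩
  ρ (expᴿ x) ⊠ ρ (expᴿ y)     ≈⟨ ρ-⊗ _ _ ⟨
  ρ (expᴿ x ⊗ expᴿ y)         ∎)) (re-ρ _)
  where open ≅-Reasoning

-- A square, that of `expᴿ` at x/2; for negative x the series has terms of both signs and does not
-- show it.
expᴿ-nonneg : ∀ x → ι 0ℚ ≼ expᴿ x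
expᴿ-nonneg x = begin
  ι 0ℚ                              ≲⟨ square-nonneg _ ⟩
  expᴿ (ι ½ ⊗ x) ⊗ expᴿ (ι ½ ⊗ x)   ≈⟨ expᴿ-⊕ _ _ ⟨
  expᴿ (ι ½ ⊗ x ⊕ ι ½ ⊗ x)          ≈⟨ expᴿ-cong (solve 1 (λ x → con ½ :* x :+ con ½ :* x := x) ≃-refl x) ⟩
  expᴿ x                            ∎
  where
  open ≼-Reasoning
  open ℝ-Solver

expTermᴿ : ℝ → ℕ → ℝ
expTermᴿ x zero    = ι 1ℚ
expTermᴿ x (suc k) = ι (1/suc k) ⊗ (x ⊗ expTermᴿ x k)

expTerm-ρ : ∀ x k → expTerm (ρ x) k ≅ ρ (expTermᴿ x k)
expTerm-ρ x zero    = ≅-refl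
expTerm-ρ x (suc k) = ≅-trans
  (⊠-cong ≅-refl (≅-trans (⊠-cong ≅-refl (expTerm-ρ x k)) (≅-sym (ρ-⊗ _ _)))) (≅-sym (ρ-⊗ _ _))

expTermᴿ-nonneg : ∀ {x} → ι 0ℚ ≼ x → ∀ k → ι 0ℚ ≼ expTermᴿ x k
expTermᴿ-nonneg h zero    = ι-nonneg (ℚP.<⇒≤ 0<1)
expTermᴿ-nonneg h (suc k) = ⊗-nonneg (ι-nonneg (0≤1/suc k)) (⊗-nonneg h (expTermᴿ-nonneg h k))

opaque
  unfolding _⊞_

  re-⊞ : ∀ z w → re (z ⊞ w) ≃ re z ⊕ re w
  re-⊞ z w = ≃-refl

-- For x ≥ 0 all terms are nonnegative, and 1 + x is the sum of the first two, so the bound holds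
-- for every partial sum from index 2 on.
1+x≼expᴿ : ∀ {x} → ι 0ℚ ≼ x → ι 1ℚ ⊕ x ≼ expᴿ x
1+x≼expᴿ {x} h = re-⇝-lower (expSum-⇝ (ρ x)) (2 , λ { (suc (suc n)) _ → partial n ; (suc zero) (s≤s ()) })
  where
  open ≼-Reasoning
  open ℝ-Solver
  step : ∀ n → re (expSum (ρ x) (suc n)) ≃ re (expSum (ρ x) n) ⊕ expTermᴿ x n
  step n = ≃-trans (re-⊞ _ _) (⊕-cong ≃-refl (≃-trans (re≃ (expTerm-ρ x n)) (re-ρ _)))
  partial : ∀ n → ι 1ℚ ⊕ x ≼ re (expSum (ρ x) (suc (suc n)))
  partial zero = begin
    ι 1ℚ ⊕ x  ≈⟨ solve 1 (λ x → con 1ℚ :+ x := con 0ℚ :+ con 1ℚ :+ con 1ℚ :* (x :* con 1ℚ)) ≃-refl x ⟩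
    ι 0ℚ ⊕ expTermᴿ x 0 ⊕ expTermᴿ x 1
      ≈⟨ ≃-trans (step 1) (⊕-cong (≃-trans (step 0) (⊕-cong (re-ρ (ι 0ℚ)) ≃-refl)) ≃-refl) ⟨
    re (expSum (ρ x) 2) ∎
  partial (suc n) = begin
    ι 1ℚ ⊕ x         ≲⟨ partial n ⟩
    re (expSum (ρ x) (suc (suc n)))   ≈⟨ solve 1 (λ a → a := a :+ con 0ℚ) ≃-refl _ ⟩
    re (expSum (ρ x) (suc (suc n))) ⊕ ι 0ℚ ≲⟨ ⊕-monoˡ _ (expTermᴿ-nonneg h (suc (suc n))) ⟩
    re (expSum (ρ x) (suc (suc n))) ⊕ expTermᴿ x (suc (suc n)) ≈⟨ step (suc (suc n)) ⟨
    re (expSum (ρ x) (suc (suc (suc n)))) ∎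

-- The relative form of e^t ≥ 1 + t, at t = y - x. Both monotonicity and the decay of n^(-τ) are
-- drawn from it.
expᴿ-grow : ∀ {x y} → x ≼ y → expᴿ x ⊗ (ι 1ℚ ⊕ (y ⊝ x)) ≼ expᴿ y
expᴿ-grow {x} {y} h = begin
  expᴿ x ⊗ (ι 1ℚ ⊕ (y ⊝ x))  ≲⟨ ⊗-monoˡ (expᴿ-nonneg x) (1+x≼expᴿ (0≼⊝ h)) ⟩
  expᴿ x ⊗ expᴿ (y ⊝ x)      ≈⟨ expᴿ-⊕ x (y ⊝ x) ⟨
  expᴿ (x ⊕ (y ⊝ x))         ≈⟨ expᴿ-cong (solve 2 (λ x y → x :+ (y :- x) := y) ≃-refl x y) ⟩
  expᴿ y                     ∎
  where
  open ≼-Reasoning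
  open ℝ-Solver

expᴿ-mono : ∀ {x y} → x ≼ y → expᴿ x ≼ expᴿ y
expᴿ-mono {x} {y} h = begin
  expᴿ x                     ≈⟨ solve 1 (λ e → e := e :* (con 1ℚ :+ con 0ℚ)) ≃-refl (expᴿ x) ⟩
  expᴿ x ⊗ (ι 1ℚ ⊕ ι 0ℚ)     ≲⟨ ⊗-monoˡ (expᴿ-nonneg x) (⊕-monoˡ _ (0≼⊝ h)) ⟩
  expᴿ x ⊗ (ι 1ℚ ⊕ (y ⊝ x))  ≲⟨ expᴿ-grow h ⟩
  expᴿ y                     ∎
  where
  open ≼-Reasoning
  open ℝ-Solver

-- Conjugation negates w, so that u times its conjugate is `Exp-inverse`. Each part of u then has
-- square at most 1, and bounding the two parts separately gives 2.
norm-Exp-imaginary : ∀ {w} → re w ≃ ι 0ℚ → norm (Exp w) ≼ ι 1ℚ ⊕ ι 1ℚ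
norm-Exp-imaginary {w} h = norm-parts (abs-≤-1 (≼-trans (left _ _) unit)) (abs-≤-1 (≼-trans (right _ _) unit))
  where
  open ≼-Reasoning
  open ℝ-Solver
  u : ℂ
  u = Exp w
  unit : re u ⊗ re u ⊕ im u ⊗ im u ≼ ι 1ℚ
  unit = begin
    re u ⊗ re u ⊕ im u ⊗ im u   ≈⟨ re-⊠-conj u ⟨
    re (u ⊠ conj u)             ≈⟨ re≃ (⊠-cong ≅-refl (≅-trans (≅-sym (Exp-conj w)) (Exp-cong (conj-imaginary h)))) ⟩
    re (u ⊠ Exp (⊟ w))          ≈⟨ re≃ (≅-trans (⊠-comm _ _) (Exp-inverse w)) ⟩
    re (κ 1ℚ)                   ≈⟨ re-ρ (ι 1ℚ) ⟩
    ι 1ℚ                        ∎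
  left : ∀ x y → x ⊗ x ≼ x ⊗ x ⊕ y ⊗ y
  left x y = ≼-trans (≼-reflexive (solve 1 (λ a → a := a :+ con 0ℚ) ≃-refl (x ⊗ x))) (⊕-monoˡ _ (square-nonneg y))
  right : ∀ x y → y ⊗ y ≼ x ⊗ x ⊕ y ⊗ y
  right x y = ≼-trans (left y x) (≼-reflexive (⊕-comm _ _))

norm-Exp : ∀ z → norm (Exp z) ≼ expᴿ (re z) ⊗ (ι 1ℚ ⊕ ι 1ℚ)
norm-Exp z = begin
  norm (Exp z)
    ≈⟨ norm-cong (≅-trans (Exp-cong (recombine z (ρ (re z)))) (Exp-⊞ (ρ (re z)) (z ⊟ ρ (re z)))) ⟩
  norm (Exp (ρ (re z)) ⊠ Exp (z ⊟ ρ (re z)))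
    ≲⟨ norm-⊠ _ _ ⟩
  norm (Exp (ρ (re z))) ⊗ norm (Exp (z ⊟ ρ (re z)))
    ≲⟨ ⊗-mono (norm-nonneg _) (⊕-nonneg 0≼1 0≼1)
         (≼-reflexive (≃-trans (norm-cong (Exp-ρ (re z)))
           (≃-trans (norm-ρ _) (abs-nonneg-≃ (expᴿ-nonneg (re z))))))
         (norm-Exp-imaginary (≃-trans (re-⊟ z (ρ (re z))) (≃-trans (⊕-cong ≃-refl (⊖-cong (re-ρ (re z))))
           (solve 1 (λ x → x :- x := con 0ℚ) ≃-refl (re z))))) ⟩
  expᴿ (re z) ⊗ (ι 1ℚ ⊕ ι 1ℚ) ∎
  where
  open ≼-Reasoning
  open ℝ-Solver
  recombine : ∀ z w → z ≅ w ⊞ (z ⊟ w)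
  recombine = solveᶜ 2 (λ z w → z :=ᶜ w :+ᶜ (z :-ᶜ w)) ≅-refl
    where open ℂ-Solver renaming (solve to solveᶜ; _:+_ to _:+ᶜ_; _:-_ to _:-ᶜ_; _:=_ to _:=ᶜ_)

-- Logarithms and the decay of n^(-τ)

HB-nonneg : ∀ c k → 0ℚ ≤ HB c k
HB-nonneg c = ∑ℚ-nonneg (λ i → 0≤1/suc (c ℕ.+ i))

-- The additional block is the right-endpoint sum of 1/t over [n + 1, n + 2], where 1/t ≥ 1/(n + 2).
-- The inequality holds at every mesh, with no error term.
logApprox-suc : ∀ n k → logApprox (suc n) k + 1/suc (suc n) ≤ logApprox (suc (suc n)) k
logApprox-suc n k = begin
  HB (suc k) (n ℕ.* suc k) + 1/suc (suc n)
    ≤⟨ ℚP.+-monoʳ-≤ (HB (suc k) (n ℕ.* suc k)) (HB-lower k (suc n)) ⟩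
  HB (suc k) (n ℕ.* suc k) + HB (suc n ℕ.* suc k) (suc k)
    ≡⟨ HB-++ (suc k) (n ℕ.* suc k) (suc k) ⟨
  HB (suc k) (n ℕ.* suc k ℕ.+ suc k)
    ≡⟨ cong (HB (suc k)) (ℕP.+-comm (n ℕ.* suc k) (suc k)) ⟩
  HB (suc k) (suc n ℕ.* suc k) ∎
  where open ℚP.≤-Reasoning

-- With a and b for the two successors, the integral from 1 to ab splits at b. The block X over
-- [b, ab] with mesh 1/(k + 1) is, after the substitution t = bu, the sum over [1, a] with the mesh
-- refined b times; `HB-refine` places it between la and la + 1/(k + 1).
logApprox-* : ∀ a b k → ∣ logApprox (suc a ℕ.* suc b) k - (logApprox (suc a) k + logApprox (suc b) k) ∣ ≤ 1/suc k
logApprox-* a b k = ∣∣≤ {lab - (la + lb)}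
  (p-q≤ (begin
    lab                          ≡⟨ split ⟩
    lb + X                       ≤⟨ ℚP.+-monoʳ-≤ lb (p≤p+q X (0≤1/suc (k ℕ.+ a ℕ.* suc k))) ⟩
    lb + (X + 1/suc (k ℕ.+ a ℕ.* suc k)) ≤⟨ ℚP.+-monoʳ-≤ lb (proj₂ refine) ⟩
    lb + (la + 1/suc k)          ≡⟨ solve 3 (λ x y z → y :+ (x :+ z) := z :+ (x :+ y)) refl la lb (1/suc k) ⟩
    1/suc k + (la + lb)          ∎))
  (subst (_≤ 1/suc k) (solve 2 (λ x y → y :+ :- x := :- (x :+ :- y)) refl lab (la + lb))
    (p-q≤ (begin
      la + lb                    ≤⟨ ℚP.+-monoˡ-≤ lb (proj₁ refine) ⟩
      X + lb                     ≡⟨ trans (ℚP.+-comm X lb) (sym split) ⟩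
      lab                        ≤⟨ p≤p+q lab (0≤1/suc k) ⟩
      lab + 1/suc k              ≡⟨ ℚP.+-comm lab (1/suc k) ⟩
      1/suc k + lab              ∎)))
  where
  open ℚP.≤-Reasoning
  open +-*-Solver
  la lb lab X : ℚ
  la = logApprox (suc a) k
  lb = logApprox (suc b) k
  lab = logApprox (suc a ℕ.* suc b) k
  X = HB (suc k ℕ.* suc b) (a ℕ.* suc k ℕ.* suc b)
  refine : la ≤ X × X + 1/suc (k ℕ.+ a ℕ.* suc k) ≤ la + 1/suc k
  refine = HB-refine b k (a ℕ.* suc k)
  split : lab ≡ lb + X
  split = trans (cong (HB (suc k)) (ℕP.*-distribʳ-+ (suc k) b (a ℕ.* suc b)))
    (trans (HB-++ (suc k) (b ℕ.* suc k) (a ℕ.* suc b ℕ.* suc k))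
      (cong₂ (λ c l → lb + HB c l) (ℕP.*-comm (suc b) (suc k))
        (trans (ℕP.*-assoc a (suc b) (suc k))
          (trans (cong (a ℕ.*_) (ℕP.*-comm (suc b) (suc k))) (sym (ℕP.*-assoc a (suc k) (suc b)))))))

opaque
  Log : ℕ → ℝ
  Log = log

opaque
  unfolding Log _⊕_ ι

  Log-1 : Log 1 ≃ ι 0ℚ
  Log-1 = pointwise λ _ → refl

  Log-nonneg : ∀ n → ι 0ℚ ≼ Log n
  Log-nonneg n = ≼-pointwise (always λ k → HB-nonneg (suc k) ((n ℕ.∸ 1) ℕ.* suc k))

  Log-suc : ∀ n → Log (suc n) ⊕ ι (1/suc (suc n)) ≼ Log (suc (suc n))
  Log-suc n = ≼-pointwise (always (logApprox-suc n))

  Log-* : ∀ a b → Log (suc a ℕ.* suc b) ≃ Log (suc a) ⊕ Log (suc b)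
  Log-* a b = mk≃ λ ε 0<ε → eventually-map (λ k → ℚP.≤-trans (logApprox-* a b k)) (archimedean ε 0<ε)

-- This is 2^(j + 1) - 2, so that `HB 2 (doubling j)` is 1/3 + ... + 1/2^(j + 1).
doubling : ℕ → ℕ
doubling zero    = 0
doubling (suc j) = doubling j ℕ.+ (2 ℕ.+ doubling j)

-- Oresme's argument: the block from 1/(q + 1) to 1/(2q) is at least ½, here with q = 2 + n by
-- `HB-lower`.
HB-doubling : ∀ j → ½ * nat j ≤ HB 2 (doubling j)
HB-doubling zero    = ℚP.≤-reflexive (ℚP.*-zeroʳ ½)
HB-doubling (suc j) = begin
  ½ * (nat j + 1ℚ)                          ≡⟨ ℚP.*-distribˡ-+ ½ (nat j) 1ℚ ⟩
  ½ * nat j + 1/suc 1                       ≤⟨ ℚP.+-mono-≤ (HB-doubling j) (HB-lower (suc n) 1) ⟩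
  HB 2 n + HB (1 ℕ.* (2 ℕ.+ n)) (2 ℕ.+ n)   ≡⟨ cong (λ c → HB 2 n + HB c (2 ℕ.+ n)) (ℕP.*-identityˡ (2 ℕ.+ n)) ⟩
  HB 2 n + HB (2 ℕ.+ n) (2 ℕ.+ n)           ≡⟨ HB-++ 2 n (2 ℕ.+ n) ⟨
  HB 2 (doubling (suc j))                   ∎
  where
  open ℚP.≤-Reasoning
  n : ℕ
  n = doubling j

0≤nat : ∀ n → 0ℚ ≤ nat n
0≤nat = ∑ℚ-nonneg (λ _ → ℚP.<⇒≤ 0<1)

nat-unbounded : ∀ {K} → 0ℚ < K → ∃[ n ] K ≤ nat n
nat-unbounded {K} 0<K = go (quotient 0<1 0<K)
  where
  go : ∃[ δ ] (0ℚ < δ × K * δ ≡ 1ℚ) → ∃[ n ] K ≤ nat n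
  go (δ , 0<δ , eq) = go₂ (archimedean δ 0<δ)
    where
    open ℚP.≤-Reasoning
    go₂ : ∃[ M ] (∀ n → M ℕ.≤ n → 1/suc n ≤ δ) → ∃[ n ] K ≤ nat n
    go₂ (M , h) = suc M , (begin
      K                                  ≡⟨ ℚP.*-identityʳ K ⟨
      K * 1ℚ                             ≡⟨ cong (K *_) (1/suc*nat M) ⟨
      K * (1/suc M * nat (suc M))
        ≤⟨ ℚP.*-monoˡ-≤-nonNeg K {{nonNegative (ℚP.<⇒≤ 0<K)}}
             (ℚP.*-monoʳ-≤-nonNeg (nat (suc M)) {{nonNegative (0≤nat (suc M))}} (h M ℕP.≤-refl)) ⟩
      K * (δ * nat (suc M))              ≡⟨ ℚP.*-assoc K δ (nat (suc M)) ⟨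
      K * δ * nat (suc M)                ≡⟨ cong (_* nat (suc M)) eq ⟩
      1ℚ * nat (suc M)                   ≡⟨ ℚP.*-identityˡ (nat (suc M)) ⟩
      nat (suc M)                        ∎)

HB-unbounded : ∀ {K} → 0ℚ < K → ∃[ m ] K ≤ HB 2 m
HB-unbounded {K} 0<K = go (nat-unbounded (0<+ 0<K 0<K))
  where
  go : ∃[ n ] K + K ≤ nat n → ∃[ m ] K ≤ HB 2 m
  go (n , h) = doubling n , ℚP.≤-trans
    (ℚP.≤-reflexive (trans (sym (½+½ K)) (sym (ℚP.*-distribˡ-+ ½ K K))))
    (ℚP.≤-trans (ℚP.*-monoˡ-≤-nonNeg ½ h) (HB-doubling n))

module Decay (δ : ℚ) (0<δ : 0ℚ < δ) where

  τ : ℚ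
  τ = 1ℚ + δ

  0≤τ : 0ℚ ≤ τ
  0≤τ = ℚP.<⇒≤ (0<+ 0<1 0<δ)

  -- n^(-τ)
  E : ℕ → ℝ
  E n = expᴿ (⊖ (ι τ ⊗ Log n))

  E-nonneg : ∀ n → ι 0ℚ ≼ E n
  E-nonneg n = expᴿ-nonneg _

  -- (n + 1) n^(-τ) at n = m + 1
  F : ℕ → ℝ
  F m = ι (nat (suc (suc m))) ⊗ E (suc m)

  F-nonneg : ∀ m → ι 0ℚ ≼ F m
  F-nonneg m = ⊗-nonneg (ι-nonneg (0≤nat (suc (suc m)))) (E-nonneg (suc m))

  -- `expᴿ-grow` is applied from the exponent -τ log (m + 2) up to -τ log (m + 1). The gap between
  -- them is at least τ/(m + 2), which also shows that they are in this order.
  E-suc : ∀ m → E (suc (suc m)) ⊗ (ι 1ℚ ⊕ ι τ ⊗ ι (1/suc (suc m))) ≼ E (suc m)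
  E-suc m = begin
    E (suc (suc m)) ⊗ (ι 1ℚ ⊕ ι τ ⊗ ι h)
      ≲⟨ ⊗-monoˡ (E-nonneg (suc (suc m))) (⊕-monoˡ _ gap) ⟩
    E (suc (suc m)) ⊗ (ι 1ℚ ⊕ (⊖ (ι τ ⊗ l) ⊝ ⊖ (ι τ ⊗ l′)))
      ≲⟨ expᴿ-grow (0≼⊝⇒≼ (≼-trans (⊗-nonneg (ι-nonneg 0≤τ) (ι-nonneg (0≤1/suc (suc m)))) gap)) ⟩
    E (suc m) ∎
    where
    open ≼-Reasoning
    open ℝ-Solver
    h : ℚ
    h = 1/suc (suc m)
    l l′ : ℝ
    l = Log (suc m)
    l′ = Log (suc (suc m))
    gap : ι τ ⊗ ι h ≼ ⊖ (ι τ ⊗ l) ⊝ ⊖ (ι τ ⊗ l′)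
    gap = begin
      ι τ ⊗ ι h               ≈⟨ solve 3 (λ t h l → t :* h := t :* (l :+ h :- l)) ≃-refl (ι τ) (ι h) l ⟩
      ι τ ⊗ (l ⊕ ι h ⊝ l)     ≲⟨ ⊗-monoˡ (ι-nonneg 0≤τ) (⊕-monoʳ (⊖ l) (Log-suc m)) ⟩
      ι τ ⊗ (l′ ⊝ l)
        ≈⟨ solve 3 (λ t l l′ → t :* (l′ :- l) := :- (t :* l) :- :- (t :* l′)) ≃-refl (ι τ) l l′ ⟩
      ⊖ (ι τ ⊗ l) ⊝ ⊖ (ι τ ⊗ l′) ∎

  -- With n = m + 2, the weights δ and n + 1 of e add up to n + τ = n (1 + τ/n), and 1 + τ/n is the
  -- factor absorbed by `E-suc`.
  F-suc : ∀ m → ι δ ⊗ E (suc (suc m)) ⊕ F (suc m) ≼ F m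
  F-suc m = begin
    ι δ ⊗ e ⊕ ι (n + 1ℚ) ⊗ e
      ≈⟨ ⊕-cong ≃-refl (⊗-cong (ι-+ n 1ℚ) ≃-refl) ⟩
    ι δ ⊗ e ⊕ (ι n ⊕ ι 1ℚ) ⊗ e
      ≈⟨ solve 3 (λ d e n → d :* e :+ (n :+ con 1ℚ) :* e := (n :+ (con 1ℚ :+ d)) :* e) ≃-refl (ι δ) e (ι n) ⟩
    (ι n ⊕ (ι 1ℚ ⊕ ι δ)) ⊗ e
      ≈⟨ ⊗-cong (⊕-cong ≃-refl (≃-trans (≃-sym (ι-+ 1ℚ δ)) one)) ≃-refl ⟩
    (ι n ⊕ (ι τ ⊗ (ι h ⊗ ι n))) ⊗ e
      ≈⟨ solve 4 (λ n t h e → (n :+ t :* (h :* n)) :* e := n :* (e :* (con 1ℚ :+ t :* h))) ≃-refl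
           (ι n) (ι τ) (ι h) e ⟩
    ι n ⊗ (e ⊗ (ι 1ℚ ⊕ ι τ ⊗ ι h))
      ≲⟨ ⊗-monoˡ (ι-nonneg (0≤nat (suc (suc m)))) (E-suc m) ⟩
    ι n ⊗ E (suc m) ∎
    where
    open ≼-Reasoning
    open ℝ-Solver
    e : ℝ
    e = E (suc (suc m))
    n h : ℚ
    n = nat (suc (suc m))
    h = 1/suc (suc m)
    one : ι τ ≃ ι τ ⊗ (ι h ⊗ ι n)
    one = ≃-trans (ι-cong (trans (sym (ℚP.*-identityʳ τ)) (cong (τ *_) (sym (1/suc*nat (suc m))))))
      (≃-trans (ι-* τ (h * n)) (⊗-cong ≃-refl (ι-* h n)))

  F-antitone : ∀ m d → F (m ℕ.+ d) ≼ F m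
  F-antitone m zero    = ≼-reflexive (≡⇒≃ (cong F (ℕP.+-identityʳ m)))
  F-antitone m (suc d) = subst (λ k → F k ≼ F m) (sym (ℕP.+-suc m d)) (≼-trans (begin
    F (suc (m ℕ.+ d))               ≈⟨ ⊕-identityˡ _ ⟨
    ι 0ℚ ⊕ F (suc (m ℕ.+ d))
      ≲⟨ ⊕-monoʳ _ (⊗-nonneg (ι-nonneg (ℚP.<⇒≤ 0<δ)) (E-nonneg (suc (suc (m ℕ.+ d))))) ⟩
    ι δ ⊗ E (suc (suc (m ℕ.+ d))) ⊕ F (suc (m ℕ.+ d))  ≲⟨ F-suc (m ℕ.+ d) ⟩
    F (m ℕ.+ d)                     ∎) (F-antitone m d))
    where open ≼-Reasoning

  -- Since F (m + 1)/(m + 3) = E (m + 2), `F-suc` reads (1 + δ/(m + 3)) F (m + 1) ≤ F m. The factors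
  -- multiply up, and (1 + δh)(1 + δH) ≥ 1 + δ(H + h) because the term δ²Hh is nonnegative.
  F-harmonic : ∀ m → F m ⊗ ι (1ℚ + δ * HB 2 m) ≼ F 0
  F-harmonic zero = ≼-reflexive (≃-trans
    (⊗-cong ≃-refl (ι-cong (trans (cong (1ℚ +_) (ℚP.*-zeroʳ δ)) (ℚP.+-identityʳ 1ℚ))))
    (≃-trans (⊗-comm _ _) (⊗-identityˡ _)))
  F-harmonic (suc m) = begin
    F (suc m) ⊗ ι (1ℚ + δ * (H + h))
      ≲⟨ ⊗-monoˡ (F-nonneg (suc m)) (ι-mono (ℚP.≤-trans
           (p≤p+q (1ℚ + δ * (H + h)) (0≤* (0≤* 0≤δ 0≤δ) (0≤* (HB-nonneg 2 m) (0≤1/suc (2 ℕ.+ m)))))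
           (ℚP.≤-reflexive (+-*-Solver.solve 3 (λ d H h →
             con′ 1ℚ +′ d *′ (H +′ h) +′ d *′ d *′ (H *′ h) =′ (con′ 1ℚ +′ d *′ h) *′ (con′ 1ℚ +′ d *′ H))
             refl δ H h)))) ⟩
    F (suc m) ⊗ ι ((1ℚ + δ * h) * (1ℚ + δ * H))
      ≈⟨ ⊗-cong ≃-refl (≃-trans (ι-* (1ℚ + δ * h) (1ℚ + δ * H))
           (⊗-cong (≃-trans (ι-+ 1ℚ (δ * h)) (⊕-cong ≃-refl (ι-* δ h))) ≃-refl)) ⟩
    F (suc m) ⊗ ((ι 1ℚ ⊕ ι δ ⊗ ι h) ⊗ ι (1ℚ + δ * H))
      ≈⟨ solve 4 (λ f d h r → f :* ((con 1ℚ :+ d :* h) :* r) := (d :* (h :* f) :+ f) :* r) ≃-refl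
           (F (suc m)) (ι δ) (ι h) (ι (1ℚ + δ * H)) ⟩
    (ι δ ⊗ (ι h ⊗ F (suc m)) ⊕ F (suc m)) ⊗ ι (1ℚ + δ * H)
      ≈⟨ ⊗-cong (⊕-cong (⊗-cong ≃-refl undo) ≃-refl) ≃-refl ⟩
    (ι δ ⊗ E (suc (suc m)) ⊕ F (suc m)) ⊗ ι (1ℚ + δ * H)
      ≲⟨ ⊗-monoʳ (ι-nonneg (ℚP.≤-trans (ℚP.<⇒≤ 0<1) (p≤p+q 1ℚ (0≤* 0≤δ (HB-nonneg 2 m))))) (F-suc m) ⟩
    F m ⊗ ι (1ℚ + δ * H)
      ≲⟨ F-harmonic m ⟩
    F 0 ∎
    where
    open ≼-Reasoning
    open ℝ-Solver
    open +-*-Solver using () renaming (con to con′; _:+_ to _+′_; _:*_ to _*′_; _:=_ to _=′_)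
    0≤δ : 0ℚ ≤ δ
    0≤δ = ℚP.<⇒≤ 0<δ
    H h : ℚ
    H = HB 2 m
    h = 1/suc (2 ℕ.+ m)
    undo : ι h ⊗ F (suc m) ≃ E (suc (suc m))
    undo = ≃-trans (≃-sym (⊗-assoc _ _ _)) (≃-trans
      (⊗-cong (≃-trans (≃-sym (ι-* h (nat (3 ℕ.+ m)))) (ι-cong (1/suc*nat (2 ℕ.+ m)))) ≃-refl)
      (⊗-identityˡ _))

  F-null : Null F
  F-null ε 0<ε = bound (abs-bound (F 0))
    where
    bound : ∃[ C ] (0ℚ < C × abs (F 0) ≼ ι C) → Eventually λ m → F m ≼ ι ε
    -- K = C/(δε): once the harmonic block reaches K, ε (1 + δ HB) is at least the bound C of F 0.
    -- `F-antitone` then covers all later indices.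
    bound (C , 0<C , hC) = scale (quotient 0<C (ℚP.positive⁻¹ (δ * ε) {{ℚP.pos*pos⇒pos δ {{positive 0<δ}} ε {{positive 0<ε}}}}))
      where
      scale : ∃[ K ] (0ℚ < K × δ * ε * K ≡ C) → Eventually λ m → F m ≼ ι ε
      scale (K , 0<K , eq) = reach (HB-unbounded 0<K)
        where
        reach : ∃[ m ] K ≤ HB 2 m → Eventually λ m → F m ≼ ι ε
        reach (m , hm) = m , λ n m≤n → subst (λ k → F k ≼ ι ε) (ℕP.m+[n∸m]≡n m≤n)
          (≼-trans (F-antitone m (n ℕ.∸ m)) (divide-out (quotient 0<1 0<M)))
          where
          open ≼-Reasoning
          M : ℚ
          M = 1ℚ + δ * HB 2 m
          0<M : 0ℚ < M
          0<M = ℚP.<-≤-trans 0<1 (p≤p+q 1ℚ (0≤* (ℚP.<⇒≤ 0<δ) (HB-nonneg 2 m)))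
          C≤ : C ≤ ε * M
          C≤ = ℚP.≤-trans (ℚP.≤-reflexive (trans (sym eq) (+-*-Solver.solve 3 (λ d e k → d :* e :* k := e :* (d :* k)) refl δ ε K)))
            (ℚP.*-monoˡ-≤-nonNeg ε {{nonNegative (ℚP.<⇒≤ 0<ε)}}
              (ℚP.≤-trans (ℚP.*-monoˡ-≤-nonNeg δ {{nonNegative (ℚP.<⇒≤ 0<δ)}} hm)
                (ℚP.≤-trans (p≤p+q (δ * HB 2 m) (ℚP.<⇒≤ 0<1)) (ℚP.≤-reflexive (ℚP.+-comm (δ * HB 2 m) 1ℚ)))))
            where open +-*-Solver using (_:*_; _:=_)
          divide-out : ∃[ i ] (0ℚ < i × M * i ≡ 1ℚ) → F m ≼ ι ε
          divide-out (i , 0<i , eqᵢ) = begin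
            F m                    ≈⟨ ≃-trans (⊗-comm _ _) (⊗-identityˡ _) ⟨
            F m ⊗ ι 1ℚ             ≈⟨ ⊗-cong ≃-refl (≃-trans (ι-cong (sym eqᵢ)) (ι-* M i)) ⟩
            F m ⊗ (ι M ⊗ ι i)      ≈⟨ ⊗-assoc _ _ _ ⟨
            F m ⊗ ι M ⊗ ι i        ≲⟨ ⊗-monoʳ (ι-nonneg (ℚP.<⇒≤ 0<i))
                                        (≼-trans (F-harmonic m) (≼-trans (x≼abs _) (≼-trans hC (ι-mono C≤)))) ⟩
            ι (ε * M) ⊗ ι i        ≈⟨ ι-* (ε * M) i ⟨
            ι (ε * M * i)          ≈⟨ ι-cong (trans (ℚP.*-assoc ε M i) (trans (cong (ε *_) eqᵢ) (ℚP.*-identityʳ ε))) ⟩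
            ι ε                    ∎

-- Sieving by primes

-- sifted N n: no prime ≤ N divides n.
sifted : ℕ → ℕ → Bool
sifted zero    n = true
sifted (suc N) n = sifted N n ∧ not (does (prime? (suc N)) ∧ does (suc N ∣? n))

sifted-suc-prime : ∀ {N} → Prime (suc N) → ∀ n → sifted (suc N) n ≡ sifted N n ∧ not (does (suc N ∣? n))
sifted-suc-prime {N} pr n =
  cong (λ b → sifted N n ∧ not (b ∧ does (suc N ∣? n))) (dec-true (prime? (suc N)) pr)

sifted-suc-composite : ∀ {N} → ¬ Prime (suc N) → ∀ n → sifted (suc N) n ≡ sifted N n
sifted-suc-composite {N} ¬pr n = trans
  (cong (λ b → sifted N n ∧ not (b ∧ does (suc N ∣? n))) (dec-false (prime? (suc N)) ¬pr))
  (BoolP.∧-identityʳ (sifted N n))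

sifted-1 : ∀ N → sifted N 1 ≡ true
sifted-1 zero    = refl
sifted-1 (suc N) = go (prime? (suc N))
  where
  go : Dec (Prime (suc N)) → sifted (suc N) 1 ≡ true
  go (yes pr) = trans (sifted-suc-prime pr 1) (cong₂ (λ b c → b ∧ not c) (sifted-1 N)
    (dec-false (suc N ∣? 1) λ d → ¬prime[1] (subst Prime (∣1⇒≡1 d) pr)))
  go (no ¬pr) = trans (sifted-suc-composite ¬pr 1) (sifted-1 N)

sifted-factor : ∀ {N r n} → Prime r → r ℕ.≤ N → r ∣ n → sifted N n ≡ false
sifted-factor {zero}  {r} pr z≤n _ = contradiction (prime⇒nonZero pr) λ ()
sifted-factor {suc N} {r} {n} pr r≤ d with ℕP.m≤n⇒m<n∨m≡n r≤
... | inj₁ r<  = cong (_∧ not (does (prime? (suc N)) ∧ does (suc N ∣? n))) (sifted-factor pr (ℕP.≤-pred r<) d)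
... | inj₂ refl = trans (sifted-suc-prime pr n)
  (trans (cong (λ c → sifted N n ∧ not c) (dec-true (suc N ∣? n) d)) (BoolP.∧-zeroʳ (sifted N n)))

primeFactor : ∀ {n} → 1 ℕ.< n → ∃[ r ] (Prime r × r ∣ n)
primeFactor {suc n} 1<n = go (factorise (suc n))
  where
  go : PrimeFactorisation (suc n) → ∃[ r ] (Prime r × r ∣ suc n)
  go record { factors = []     ; isFactorisation = eq } = contradiction (sym eq) (ℕP.<⇒≢ 1<n)
  go record { factors = r ∷ rs ; isFactorisation = eq ; factorsPrime = pr ∷ _ } =
    r , pr , subst (r ∣_) (sym eq) (m∣m*n _)

sifted-small : ∀ {N n} → 1 ℕ.< n → n ℕ.≤ N → sifted N n ≡ false
sifted-small {N} {suc n} 1<n n≤N with primeFactor 1<n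
... | r , pr , d = sifted-factor pr (ℕP.≤-trans (∣⇒≤ d) n≤N) d

-- A prime at most N is smaller than the prime p and so does not divide it; by Euclid's lemma it
-- divides k p exactly when it divides k.
sifted-*-prime : ∀ {p} → Prime p → ∀ N → N ℕ.< p → ∀ k → sifted N (k ℕ.* p) ≡ sifted N k
sifted-*-prime {p} pr zero    _   k = refl
sifted-*-prime {p} pr (suc N) N<p k = go (prime? (suc N))
  where
  IH : sifted N (k ℕ.* p) ≡ sifted N k
  IH = sifted-*-prime pr N (ℕP.<-trans ℕP.≤-refl N<p) k

  descend : Prime (suc N) → suc N ∣ k ℕ.* p → suc N ∣ k
  descend pr′ d with euclidsLemma k p pr′ d
  ... | inj₁ N∣k = N∣k
  ... | inj₂ N∣p with prime⇒irreducible pr N∣p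
  ...   | inj₁ refl = contradiction pr′ ¬prime[1]
  ...   | inj₂ refl = contradiction N<p (ℕP.<-irrefl refl)

  go : Dec (Prime (suc N)) → sifted (suc N) (k ℕ.* p) ≡ sifted (suc N) k
  go (yes pr′) = trans (sifted-suc-prime pr′ (k ℕ.* p)) (trans
    (cong₂ (λ b c → b ∧ not c) IH
      (does-⇔ (mk⇔ (descend pr′) (∣m⇒∣m*n p)) (suc N ∣? k ℕ.* p) (suc N ∣? k)))
    (sym (sifted-suc-prime pr′ k)))
  go (no ¬pr′) = trans (sifted-suc-composite ¬pr′ (k ℕ.* p)) (trans IH (sym (sifted-suc-composite ¬pr′ k)))

-- The Euler product

⇝-shift : ∀ {f z} D → (λ e → f (D ℕ.+ e)) ⇝ z → f ⇝ z
⇝-shift {f} {z} D (mk⇝ h) = mk⇝ λ ε 0<ε → go (h ε 0<ε)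
  where
  go : ∀ {ε} → Eventually (λ e → norm (f (D ℕ.+ e) ⊟ z) ≼ ι ε) → Eventually (λ n → norm (f n ⊟ z) ≼ ι ε)
  go {ε} (N , p) = D ℕ.+ N , λ n hn → subst (λ k → norm (f k ⊟ z) ≼ ι ε)
    (ℕP.m+[n∸m]≡n (ℕP.m+n≤o⇒m≤o D hn))
    (p (n ℕ.∸ D) (subst (ℕ._≤ n ℕ.∸ D) (ℕP.m+n∸m≡n D N) (ℕP.∸-monoˡ-≤ D hn)))

cauchy-from : ∀ {f b} → Null b → Eventually (λ n → ∀ d → norm (f (n ℕ.+ d) ⊟ f n) ≼ b n) → Cauchyᶜ f
cauchy-from {f} {b} hb h ε 0<ε =
  go (eventually-∃ (eventually-zip (λ _ → _,_) (hb _ (0<½* 0<ε)) h))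
  where
  open ≼-Reasoning
  go : ∃[ N ] (b N ≼ ι (½ * ε) × ∀ d → norm (f (N ℕ.+ d) ⊟ f N) ≼ b N) →
    ∃[ N ] ∀ m n → N ℕ.≤ m → N ℕ.≤ n → norm (f m ⊟ f n) ≼ ι ε
  go (N , bN , hN) = N , λ m n hm hn → begin
    norm (f m ⊟ f n)                       ≲⟨ norm-triangle (f m) (f N) (f n) ⟩
    norm (f m ⊟ f N) ⊕ norm (f N ⊟ f n)
      ≲⟨ ⊕-mono (near m hm) (≼-trans (≼-reflexive (norm-dist-comm (f N) (f n))) (near n hn)) ⟩
    ι (½ * ε) ⊕ ι (½ * ε)                  ≲⟨ ι-½+½ ε ⟩
    ι ε                                    ∎
    where
    near : ∀ m → N ℕ.≤ m → norm (f m ⊟ f N) ≼ ι (½ * ε)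
    near m hm = ≼-trans (subst (λ k → norm (f k ⊟ f N) ≼ b N) (ℕP.m+[n∸m]≡n hm) (hN (m ℕ.∸ N))) bN

⊕-nonneg-≼ : ∀ {x y z} → ι 0ℚ ≼ y → x ⊕ y ≼ z → x ≼ z
⊕-nonneg-≼ {x} {y} {z} 0≼y h = ≼-trans
  (≼-reflexive (solve 1 (λ x → x := x :+ con 0ℚ) ≃-refl x)) (≼-trans (⊕-monoˡ x 0≼y) h)
  where open ℝ-Solver

sel : Bool → ℂ → ℂ
sel true  z = z
sel false z = κ 0ℚ

sel-cong : ∀ {b c z w} → b ≡ c → z ≅ w → sel b z ≅ sel c w
sel-cong {true}  refl h = h
sel-cong {false} refl h = ≅-refl

sel-split : ∀ b c z → sel b z ≅ sel (b ∧ not c) z ⊞ sel (b ∧ c) z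
sel-split true  true  z = ≅-sym (⊞-identityˡ z)
sel-split true  false z = ≅-sym (≅-trans (⊞-comm z (κ 0ℚ)) (⊞-identityˡ z))
sel-split false c     z = ≅-sym (⊞-identityˡ (κ 0ℚ))

norm-sel : ∀ b z → norm (sel b z) ≼ norm z
norm-sel true  z = ≼-refl
norm-sel false z = ≼-trans norm-0 (norm-nonneg z)

primeProduct primeSum : ℕ → (ℕ → ℂ) → ℂ
primeProduct zero    f = κ 1ℚ
primeProduct (suc N) f = if does (prime? (suc N)) then primeProduct N f ⊠ f (suc N) else primeProduct N f
primeSum zero    f = κ 0ℚ
primeSum (suc N) f = if does (prime? (suc N)) then primeSum N f ⊞ f (suc N) else primeSum N f

-- `G-suc` and `G-nonneg` make G m a bound for the sum of `norm (a n)` over n ≥ m + 2. The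
-- assumptions on a speak of n ≥ 1 only, as log 0 is junk.
module EulerProduct
  (a : ℕ → ℂ) (a-1 : a 1 ≅ κ 1ℚ)
  (a-* : ∀ m n → a (suc m ℕ.* suc n) ≅ a (suc m) ⊠ a (suc n))
  (G : ℕ → ℝ) (G-suc : ∀ m → norm (a (suc (suc m))) ⊕ G (suc m) ≼ G m)
  (G-nonneg : ∀ m → ι 0ℚ ≼ G m) (G-null : Null G)
  where

  S : (ℕ → Bool) → ℕ → ℂ
  S χ M = sum M (λ i → sel (χ (suc i)) (a (suc i)))

  -- Keeping G (m + d) on the left lets the induction on d telescope. The bound is uniform in χ,
  -- since selecting terms can only lower their norms; the sieve relies on this uniformity.
  S-tail : ∀ χ m d → norm (S χ (suc m ℕ.+ d) ⊟ S χ (suc m)) ⊕ G (m ℕ.+ d) ≼ G m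
  S-tail χ m zero = begin
    norm (S χ (suc m ℕ.+ 0) ⊟ S χ (suc m)) ⊕ G (m ℕ.+ 0)
      ≲⟨ ⊕-monoʳ _ (≼-trans (≼-reflexive (norm-cong (≅-trans
           (≡⇒≅ (cong (λ k → S χ (suc k) ⊟ S χ (suc m)) (ℕP.+-identityʳ m)))
           (solve 1 (λ x → x :- x := con 0ℚ) ≅-refl (S χ (suc m)))))) norm-0) ⟩
    ι 0ℚ ⊕ G (m ℕ.+ 0)   ≈⟨ ⊕-identityˡ _ ⟩
    G (m ℕ.+ 0)          ≈⟨ ≡⇒≃ (cong G (ℕP.+-identityʳ m)) ⟩
    G m                  ∎
    where
    open ≼-Reasoning
    open ℂ-Solver
  S-tail χ m (suc d) = subst
    (λ k → norm (S χ (suc k) ⊟ S χ (suc m)) ⊕ G k ≼ G m) (sym (ℕP.+-suc m d)) (begin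
    norm (S χ (suc n) ⊞ u ⊟ S χ (suc m)) ⊕ G (suc n)
      ≲⟨ ⊕-monoʳ _ (≼-trans (≼-reflexive (norm-cong
           (solveᶜ 3 (λ x y z → x +ᶜ′ y -ᶜ′ z =ᶜ (x -ᶜ′ z) +ᶜ′ y) ≅-refl (S χ (suc n)) u (S χ (suc m)))))
           (norm-⊞ _ _)) ⟩
    norm (S χ (suc n) ⊟ S χ (suc m)) ⊕ norm u ⊕ G (suc n)
      ≈⟨ ⊕-assoc _ _ _ ⟩
    norm (S χ (suc n) ⊟ S χ (suc m)) ⊕ (norm u ⊕ G (suc n))
      ≲⟨ ⊕-monoˡ _ (≼-trans (⊕-monoʳ _ (norm-sel (χ (suc (suc n))) (a (suc (suc n))))) (G-suc n)) ⟩
    norm (S χ (suc n) ⊟ S χ (suc m)) ⊕ G n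
      ≲⟨ S-tail χ m d ⟩
    G m ∎)
    where
    open ≼-Reasoning
    open ℂ-Solver using () renaming (solve to solveᶜ; _:+_ to _+ᶜ′_; _:-_ to _-ᶜ′_; _:=_ to _=ᶜ_)
    n : ℕ
    n = m ℕ.+ d
    u : ℂ
    u = sel (χ (suc (suc n))) (a (suc (suc n)))

  S-near : ∀ χ m d → norm (S χ (suc m ℕ.+ d) ⊟ S χ (suc m)) ≼ G m
  S-near χ m d = ⊕-nonneg-≼ (G-nonneg (m ℕ.+ d)) (S-tail χ m d)

  pred-null : Null (λ n → G (ℕ.pred n))
  pred-null ε 0<ε = go (G-null ε 0<ε)
    where
    go : Eventually (λ n → G n ≼ ι ε) → Eventually (λ n → G (ℕ.pred n) ≼ ι ε)
    go (N , p) = suc N , λ { (suc n) (s≤s hn) → p n hn }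

  opaque
    sums-converge : ∃[ z ] S (λ _ → true) ⇝ z
    sums-converge = complete (cauchy-from pred-null (1 , λ { (suc m) _ d → S-near (λ _ → true) m d }))

    ζ : ℂ
    ζ = proj₁ sums-converge

    ζ-sum : S (λ _ → true) ⇝ ζ
    ζ-sum = proj₂ sums-converge

  -- The value 1 off the primes turns products over primes into products over intervals, which can
  -- be split at any point.
  factor : ℕ → ℂ
  factor n = if does (prime? n) then κ 1ℚ ⊟ a n else κ 1ℚ

  factor-prime : ∀ {n} → Prime n → factor n ≡ κ 1ℚ ⊟ a n
  factor-prime {n} pr = cong (λ b → if b then κ 1ℚ ⊟ a n else κ 1ℚ) (dec-true (prime? n) pr)

  factor-composite : ∀ {n} → ¬ Prime n → factor n ≡ κ 1ℚ
  factor-composite {n} ¬pr = cong (λ b → if b then κ 1ℚ ⊟ a n else κ 1ℚ) (dec-false (prime? n) ¬pr)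

  norm-factor-1 : ∀ n → norm (factor n ⊟ κ 1ℚ) ≼ norm (a n)
  norm-factor-1 n = go (prime? n)
    where
    open ℂ-Solver
    go : Dec (Prime n) → norm (factor n ⊟ κ 1ℚ) ≼ norm (a n)
    go (yes pr) = ≼-reflexive (≃-trans (norm-cong (≅-trans (⊞-cong (≡⇒≅ (factor-prime pr)) ≅-refl)
      (solve 1 (λ x → con 1ℚ :- x :- con 1ℚ := :- x) ≅-refl (a n)))) (norm-⊟ (a n)))
    go (no ¬pr) = ≼-trans (≼-reflexive (norm-cong (≅-trans (⊞-cong (≡⇒≅ (factor-composite ¬pr)) ≅-refl)
      (solve 0 (con 1ℚ :- con 1ℚ := con 0ℚ) ≅-refl)))) (≼-trans norm-0 (norm-nonneg (a n)))

  -- The product of the Euler factors over N < n ≤ N + d.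
  B : ℕ → ℕ → ℂ
  B N zero    = κ 1ℚ
  B N (suc d) = B N d ⊠ factor (suc (N ℕ.+ d))

  B-split : ∀ N d e → B N (d ℕ.+ e) ≅ B N d ⊠ B (N ℕ.+ d) e
  B-split N d zero = ≅-trans (≡⇒≅ (cong (B N) (ℕP.+-identityʳ d)))
    (≅-sym (≅-trans (⊠-comm _ _) (⊠-identityˡ _)))
  B-split N d (suc e) = ≅-trans (≡⇒≅ (cong (B N) (ℕP.+-suc d e)))
    (≅-trans (⊠-cong (B-split N d e) (≡⇒≅ (cong (λ k → factor (suc k)) (sym (ℕP.+-assoc N d e)))))
      (⊠-assoc _ _ _))

  primeProduct≅B : ∀ N → primeProduct N (λ p → κ 1ℚ ⊟ a p) ≅ B 0 N
  primeProduct≅B zero    = ≅-refl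
  primeProduct≅B (suc N) = ≅-trans (go (does (prime? (suc N)))) (⊠-cong (primeProduct≅B N) ≅-refl)
    where
    go : ∀ c → (if c then primeProduct N (λ p → κ 1ℚ ⊟ a p) ⊠ (κ 1ℚ ⊟ a (suc N)) else primeProduct N (λ p → κ 1ℚ ⊟ a p))
      ≅ primeProduct N (λ p → κ 1ℚ ⊟ a p) ⊠ (if c then κ 1ℚ ⊟ a (suc N) else κ 1ℚ)
    go true  = ≅-refl
    go false = ≅-sym (≅-trans (⊠-comm _ _) (⊠-identityˡ _))

  2ᴿ : ℝ
  2ᴿ = ι 1ℚ ⊕ ι 1ℚ

  2G-nonneg : ∀ m → ι 0ℚ ≼ 2ᴿ ⊗ G m
  2G-nonneg m = ⊗-nonneg (⊕-nonneg 0≼1 0≼1) (G-nonneg m)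

  norm-≼-1+ : ∀ z {x} → norm (z ⊟ κ 1ℚ) ≼ x → norm z ≼ ι 1ℚ ⊕ x
  norm-≼-1+ z {x} h = begin
    norm z                                ≈⟨ norm-cong (solve 1 (λ z → z := con 1ℚ :+ (z :- con 1ℚ)) ≅-refl z) ⟩
    norm (κ 1ℚ ⊞ (z ⊟ κ 1ℚ))              ≲⟨ norm-⊞ _ _ ⟩
    norm (κ 1ℚ) ⊕ norm (z ⊟ κ 1ℚ)         ≲⟨ ⊕-mono (≼-reflexive (norm-κ (ℚP.<⇒≤ 0<1))) h ⟩
    ι 1ℚ ⊕ x                              ∎
    where
    open ≼-Reasoning
    open ℂ-Solver

  2G≼1 : ∀ {m} → G m ≼ ι ½ → 2ᴿ ⊗ G m ≼ ι 1ℚ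
  2G≼1 small = ≼-trans (⊗-monoˡ (⊕-nonneg 0≼1 0≼1) small)
    (≼-reflexive (solve 0 ((con 1ℚ :+ con 1ℚ) :* con ½ := con 1ℚ) ≃-refl))
    where open ℝ-Solver

  -- The partial products stay below 2, so each factor moves them by at most twice its distance to 1.
  B-tail : ∀ {m} → G m ≼ ι ½ → ∀ d → norm (B (suc m) d ⊟ κ 1ℚ) ⊕ 2ᴿ ⊗ G (m ℕ.+ d) ≼ 2ᴿ ⊗ G m
  B-tail {m} small zero = begin
    norm (κ 1ℚ ⊟ κ 1ℚ) ⊕ 2ᴿ ⊗ G (m ℕ.+ 0)
      ≲⟨ ⊕-monoʳ _ (≼-trans (≼-reflexive (norm-cong (solve 0 (con 1ℚ :- con 1ℚ := con 0ℚ) ≅-refl))) norm-0) ⟩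
    ι 0ℚ ⊕ 2ᴿ ⊗ G (m ℕ.+ 0)   ≈⟨ ⊕-identityˡ _ ⟩
    2ᴿ ⊗ G (m ℕ.+ 0)          ≈⟨ ≡⇒≃ (cong (λ k → 2ᴿ ⊗ G k) (ℕP.+-identityʳ m)) ⟩
    2ᴿ ⊗ G m                  ∎
    where
    open ≼-Reasoning
    open ℂ-Solver
  B-tail {m} small (suc d) = subst
    (λ k → norm (B (suc m) (suc d) ⊟ κ 1ℚ) ⊕ 2ᴿ ⊗ G k ≼ 2ᴿ ⊗ G m) (sym (ℕP.+-suc m d)) (begin
    norm (b ⊠ f ⊟ κ 1ℚ) ⊕ 2ᴿ ⊗ G (suc n)
      ≲⟨ ⊕-monoʳ _ (≼-trans (≼-reflexive (norm-cong (solveᶜ 2 (λ b f →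
           b ×ᶜ f -ᶜ′ conᶜ 1ℚ =ᶜ (b -ᶜ′ conᶜ 1ℚ) +ᶜ′ b ×ᶜ (f -ᶜ′ conᶜ 1ℚ)) ≅-refl b f))) (norm-⊞ _ _)) ⟩
    norm (b ⊟ κ 1ℚ) ⊕ norm (b ⊠ (f ⊟ κ 1ℚ)) ⊕ 2ᴿ ⊗ G (suc n)
      ≲⟨ ⊕-monoʳ _ (⊕-monoˡ _ (≼-trans (norm-⊠ _ _)
           (⊗-mono (norm-nonneg b) (norm-nonneg _) bounded (norm-factor-1 (suc (suc n)))))) ⟩
    norm (b ⊟ κ 1ℚ) ⊕ 2ᴿ ⊗ norm (a (suc (suc n))) ⊕ 2ᴿ ⊗ G (suc n)
      ≈⟨ solve 4 (λ x t u g → x :+ t :* u :+ t :* g := x :+ t :* (u :+ g)) ≃-refl _ _ _ _ ⟩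
    norm (b ⊟ κ 1ℚ) ⊕ 2ᴿ ⊗ (norm (a (suc (suc n))) ⊕ G (suc n))
      ≲⟨ ⊕-monoˡ _ (⊗-monoˡ (⊕-nonneg 0≼1 0≼1) (G-suc n)) ⟩
    norm (b ⊟ κ 1ℚ) ⊕ 2ᴿ ⊗ G n
      ≲⟨ B-tail small d ⟩
    2ᴿ ⊗ G m ∎)
    where
    open ≼-Reasoning
    open ℝ-Solver
    open ℂ-Solver using () renaming
      (solve to solveᶜ; _:+_ to _+ᶜ′_; _:-_ to _-ᶜ′_; _:*_ to _×ᶜ_; _:=_ to _=ᶜ_; con to conᶜ)
    n : ℕ
    n = m ℕ.+ d
    b f : ℂ
    b = B (suc m) d
    f = factor (suc (suc n))
    bounded : norm b ≼ 2ᴿ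
    bounded = norm-≼-1+ b (≼-trans (⊕-nonneg-≼ (2G-nonneg n) (B-tail small d)) (2G≼1 small))

  B-near : ∀ {m} → G m ≼ ι ½ → ∀ d → norm (B (suc m) d ⊟ κ 1ℚ) ≼ 2ᴿ ⊗ G m
  B-near {m} small d = ⊕-nonneg-≼ (2G-nonneg (m ℕ.+ d)) (B-tail small d)

  G-antitone : ∀ m → G (suc m) ≼ G m
  G-antitone m = ⊕-nonneg-≼ (norm-nonneg _) (≼-trans (≼-reflexive (⊕-comm _ _)) (G-suc m))

  G-small : ∀ {m} → G m ≼ ι ½ → ∀ d → G (m ℕ.+ d) ≼ ι ½
  G-small {m} small zero    = subst (λ k → G k ≼ ι ½) (sym (ℕP.+-identityʳ m)) small
  G-small {m} small (suc d) = subst (λ k → G k ≼ ι ½) (sym (ℕP.+-suc m d))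
    (≼-trans (G-antitone (m ℕ.+ d)) (G-small small d))

  2G-null : ∀ k → Null (λ n → abs k ⊗ (2ᴿ ⊗ G n))
  2G-null k = null-⊗ {x = k} (null-≼ (always λ n → ⊗-monoʳ (G-nonneg n) (x≼abs 2ᴿ)) (null-⊗ {x = 2ᴿ} G-null))

  -- The threshold ½ keeps all partial products within distance 1 of 1, hence of norm at most 2. Two
  -- partial products differ by the shorter one times the distance of the block between them from 1,
  -- and `B-near` bounds that distance.
  B-converges-small : ∀ {m} → G m ≼ ι ½ → ∃[ z ] B (suc m) ⇝ z
  B-converges-small {m} small = complete (cauchy-from {b = λ d → abs 2ᴿ ⊗ (2ᴿ ⊗ G d)} (2G-null 2ᴿ) (always near))
    where
    open ≼-Reasoning
    open ℂ-Solver
    near : ∀ d e → norm (B (suc m) (d ℕ.+ e) ⊟ B (suc m) d) ≼ abs 2ᴿ ⊗ (2ᴿ ⊗ G d)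
    near d e = begin
      norm (B (suc m) (d ℕ.+ e) ⊟ B (suc m) d)
        ≈⟨ norm-cong (≅-trans (⊞-cong (B-split (suc m) d e) ≅-refl)
             (solve 2 (λ x y → x :* y :- x := x :* (y :- con 1ℚ)) ≅-refl (B (suc m) d) _)) ⟩
      norm (B (suc m) d ⊠ (B (suc (m ℕ.+ d)) e ⊟ κ 1ℚ))
        ≲⟨ norm-⊠ _ _ ⟩
      norm (B (suc m) d) ⊗ norm (B (suc (m ℕ.+ d)) e ⊟ κ 1ℚ)
        ≲⟨ ⊗-mono (norm-nonneg _) (2G-nonneg d)
             (≼-trans (norm-≼-1+ _ (≼-trans (B-near small d) (2G≼1 small))) (x≼abs 2ᴿ))
             (≼-trans (B-near (G-small small d) e) (⊗-monoˡ (⊕-nonneg 0≼1 0≼1) (shift d))) ⟩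
      abs 2ᴿ ⊗ (2ᴿ ⊗ G d) ∎
      where
      shift : ∀ d → G (m ℕ.+ d) ≼ G d
      shift d = go m
        where
        go : ∀ m → G (m ℕ.+ d) ≼ G d
        go zero    = ≼-refl
        go (suc m) = ≼-trans (G-antitone (m ℕ.+ d)) (go m)

  small-index : ∃[ m ] (∀ n → m ℕ.≤ n → G n ≼ ι ½)
  small-index = G-null ½ (ℚP.positive⁻¹ ½)

  opaque
    -- G need not be small at N. A finite product of m + 1 factors is split off, and the remaining
    -- one starts at N + m + 1, where the small case applies.
    B-converges : ∀ N → ∃[ z ] B N ⇝ z
    B-converges N = go small-index
      where
      go : ∃[ m ] (∀ n → m ℕ.≤ n → G n ≼ ι ½) → ∃[ z ] B N ⇝ z
      go (m , small) = glue (B-converges-small (small (N ℕ.+ m) (ℕP.m≤n+m m N)))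
        where
        glue : ∃[ z ] B (suc (N ℕ.+ m)) ⇝ z → ∃[ z ] B N ⇝ z
        glue (z , h) = B N (suc m) ⊠ z , ⇝-shift (suc m) (⇝-cong
          (always λ e → ≅-trans (⊠-cong ≅-refl (≡⇒≅ (cong (λ k → B k e) (sym (ℕP.+-suc N m)))))
            (≅-sym (B-split N (suc m) e)))
          ≅-refl (⇝-⊠ˡ (B N (suc m)) h))

    b : ℕ → ℂ
    b N = proj₁ (B-converges N)

    b-limit : ∀ N → B N ⇝ b N
    b-limit N = proj₂ (B-converges N)

  b-suc : ∀ N → b N ≅ factor (suc N) ⊠ b (suc N)
  b-suc N = ⇝-unique (b-limit N) (⇝-shift 1 (⇝-cong
    (always λ e → ≅-sym (≅-trans (B-split N 1 e)
      (⊠-cong (≅-trans (⊠-identityˡ _) (≡⇒≅ (cong (λ k → factor (suc k)) (ℕP.+-identityʳ N))))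
        (≡⇒≅ (cong (λ k → B k e) (ℕP.+-comm N 1))))))
    ≅-refl (⇝-⊠ˡ (factor (suc N)) (b-limit (suc N)))))

  B⊠b : ∀ N → B 0 N ⊠ b N ≅ b 0
  B⊠b N = ⇝-unique (⇝-shift N (⇝-cong (always λ e → ≅-sym (B-split 0 N e)) ≅-refl
    (⇝-⊠ˡ (B 0 N) (b-limit N)))) (b-limit 0)

  -- `B-near` is uniform in the number of factors, so it passes to the infinite product.
  b-⇝-1 : b ⇝ κ 1ℚ
  b-⇝-1 = go small-index
    where
    go : ∃[ m ] (∀ n → m ℕ.≤ n → G n ≼ ι ½) → b ⇝ κ 1ℚ
    go (m , small) = ⇝-shift 1 (⇝-squeeze {b = λ n → abs (ι 1ℚ) ⊗ (2ᴿ ⊗ G n)} (2G-null (ι 1ℚ)) (m , λ n hn →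
      ≼-trans (⇝-norm (b-limit (suc n)) (always (B-near (small n hn))))
        (≼-trans (≼-reflexive (≃-sym (⊗-identityˡ _))) (⊗-monoʳ (2G-nonneg n) (x≼abs (ι 1ℚ))))))

  module Sieve (N : ℕ) (pr : Prime (suc N)) where

    p : ℕ
    p = suc N

    divisible : ℕ → Bool
    divisible n = sifted N n ∧ does (p ∣? n)

    S-sieve : ∀ M → S (sifted N) M ≅ S (sifted p) M ⊞ S divisible M
    S-sieve M = ≅-trans (sum-cong M λ i _ → ≅-trans
      (sel-split (sifted N (suc i)) (does (p ∣? suc i)) (a (suc i)))
      (⊞-cong (sel-cong (sym (sifted-suc-prime pr (suc i))) ≅-refl) ≅-refl))
      (sum-⊞ M (λ i → sel (sifted p (suc i)) (a (suc i))) (λ i → sel (divisible (suc i)) (a (suc i))))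

    -- Below r + q p only the multiples k p with k ≤ q contribute; `a-*` takes a p out, and k p
    -- survives the primes ≤ N exactly when k does. Writing the bound as r + q p lets the induction
    -- step through residues.
    S-divisible : ∀ q r → r ℕ.< p → S divisible (r ℕ.+ q ℕ.* p) ≅ a p ⊠ S (sifted N) q
    S-divisible zero    zero    _   = ≅-sym (solve 1 (λ x → x :* con 0ℚ := con 0ℚ) ≅-refl (a p))
      where open ℂ-Solver
    -- `suc q * p` unfolds to `suc (N + q * p)`: the last term is the multiple of p, and the sum
    -- before it ends at residue N = p - 1.
    S-divisible (suc q) zero    _   = begin
      S divisible (N ℕ.+ q ℕ.* p) ⊞ sel (divisible (suc q ℕ.* p)) (a (suc q ℕ.* p))
        ≈⟨ ⊞-cong (S-divisible q N ℕP.≤-refl) (≅-trans (sel-cong kept (a-* q N)) (pull (sifted N (suc q)))) ⟩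
      a p ⊠ S (sifted N) q ⊞ a p ⊠ sel (sifted N (suc q)) (a (suc q))
        ≈⟨ ⊠-distribˡ-⊞ _ _ _ ⟨
      a p ⊠ S (sifted N) (suc q) ∎
      where
      open ≅-Reasoning
      open ℂ-Solver
      kept : divisible (suc q ℕ.* p) ≡ sifted N (suc q)
      kept = trans (cong₂ _∧_ (sifted-*-prime pr N ℕP.≤-refl (suc q))
        (dec-true (p ∣? suc q ℕ.* p) (n∣m*n (suc q)))) (BoolP.∧-identityʳ (sifted N (suc q)))
      pull : ∀ c → sel c (a (suc q) ⊠ a p) ≅ a p ⊠ sel c (a (suc q))
      pull true  = ⊠-comm _ _
      pull false = ≅-sym (solve 1 (λ x → x :* con 0ℚ := con 0ℚ) ≅-refl (a p))
    S-divisible q       (suc r) r<p = ≅-trans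
      (⊞-cong (S-divisible q r (ℕP.<-trans ℕP.≤-refl r<p)) (sel-cong dropped ≅-refl))
      (solve 1 (λ x → x :+ con 0ℚ := x) ≅-refl _)
      where
      open ℂ-Solver
      indivisible : p ∤ suc (r ℕ.+ q ℕ.* p)
      indivisible d = ℕP.<⇒≱ r<p (∣⇒≤ (∣m+n∣m⇒∣n {p} {q ℕ.* p} {suc r}
        (subst (p ∣_) (ℕP.+-comm (suc r) (q ℕ.* p)) d) (n∣m*n q)))
      dropped : divisible (suc (r ℕ.+ q ℕ.* p)) ≡ false
      dropped = trans (cong (sifted N (suc (r ℕ.+ q ℕ.* p)) ∧_) (dec-false (p ∣? suc (r ℕ.+ q ℕ.* p)) indivisible))
        (BoolP.∧-zeroʳ (sifted N (suc (r ℕ.+ q ℕ.* p))))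

    sieve : ∀ M → S (sifted p) M ≅ S (sifted N) M ⊟ a p ⊠ S (sifted N) (M ℕ./ p)
    sieve M = begin
      S (sifted p) M                                     ≈⟨ solve 2 (λ x y → x := x :+ y :- y) ≅-refl _ _ ⟩
      S (sifted p) M ⊞ S divisible M ⊟ S divisible M     ≈⟨ ⊞-cong (≅-sym (S-sieve M)) (⊟-cong (≅-trans
        (≡⇒≅ (cong (S divisible) (m≡m%n+[m/n]*n M p))) (S-divisible (M ℕ./ p) (M ℕ.% p) (m%n<n M p)))) ⟩
      S (sifted N) M ⊟ a p ⊠ S (sifted N) (M ℕ./ p)      ∎
      where
      open ≅-Reasoning
      open ℂ-Solver

    quotient→∞ : ∀ K → Eventually λ M → K ℕ.≤ M ℕ./ p
    quotient→∞ K = K ℕ.* p , λ M h → subst (ℕ._≤ M ℕ./ p) (m*n/n≡m K p) (/-monoˡ-≤ p h)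

    -- As M / p also tends to infinity, both sums on the right of `sieve` have the limit z. The
    -- identity is between finite sums, so no series is rearranged.
    sieve-limit : ∀ {z} → S (sifted N) ⇝ z → S (sifted p) ⇝ (κ 1ℚ ⊟ a p) ⊠ z
    sieve-limit {z} h = ⇝-cong (always λ M → ≅-trans (solve 3 (λ x y w → x :+ (:- y) :* w := x :- y :* w) ≅-refl _ _ _) (≅-sym (sieve M)))
      (solve 2 (λ y z → z :+ (:- y) :* z := (con 1ℚ :- y) :* z) ≅-refl (a p) z)
      (⇝-⊞ h (⇝-⊠ˡ (⊟ a p) (⇝-subsequence (ℕ._/ p) quotient→∞ h)))
      where open ℂ-Solver

  sifted-limit : ∀ N → S (sifted N) ⇝ B 0 N ⊠ ζ
  sifted-limit zero    = ⇝-cong (always λ _ → ≅-refl) (≅-sym (⊠-identityˡ ζ)) ζ-sum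
  sifted-limit (suc N) = go (prime? (suc N))
    where
    open ℂ-Solver
    go : Dec (Prime (suc N)) → S (sifted (suc N)) ⇝ B 0 (suc N) ⊠ ζ
    go (yes pr) = ⇝-cong (always λ _ → ≅-refl)
      (≅-trans (solve 3 (λ f b z → f :* (b :* z) := b :* f :* z) ≅-refl _ _ _)
        (⊠-cong (⊠-cong ≅-refl (≡⇒≅ (sym (factor-prime pr)))) ≅-refl))
      (Sieve.sieve-limit N pr (sifted-limit N))
    go (no ¬pr) = ⇝-cong
      (always λ M → sum-cong M λ i _ → sel-cong (sym (sifted-suc-composite ¬pr (suc i))) ≅-refl)
      (≅-trans (solve 2 (λ b z → b :* z := b :* con 1ℚ :* z) ≅-refl _ _)
        (⊠-cong (⊠-cong ≅-refl (≡⇒≅ (sym (factor-composite ¬pr)))) ≅-refl))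
      (sifted-limit N)

  S-sifted-small : ∀ N M → suc M ℕ.≤ N → S (sifted N) (suc M) ≅ κ 1ℚ
  S-sifted-small N zero    _ = ≅-trans (⊞-identityˡ _) (≅-trans (sel-cong (sifted-1 N) ≅-refl) a-1)
  S-sifted-small N (suc M) h = ≅-trans
    (⊞-cong (S-sifted-small N M (ℕP.<⇒≤ h)) (sel-cong (sifted-small {N} (s≤s (s≤s z≤n)) h) ≅-refl))
    (solve 0 (con 1ℚ :+ con 0ℚ := con 1ℚ) ≅-refl)
    where open ℂ-Solver

  -- The sum sifted by the primes ≤ N equals 1 when cut at N, as only n = 1 remains. What comes
  -- after is at most G (N - 1), uniformly in the sifting, and this bound survives the limit in M.
  B⊠ζ-⇝-1 : (λ N → B 0 N ⊠ ζ) ⇝ κ 1ℚ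
  B⊠ζ-⇝-1 = ⇝-squeeze pred-null (1 , λ { (suc m) _ → ⇝-norm (sifted-limit (suc m))
    (suc m , λ M hM → subst (λ k → norm (S (sifted (suc m)) k ⊟ κ 1ℚ) ≼ G m) (ℕP.m+[n∸m]≡n hM)
      (≼-trans (≼-reflexive (norm-cong (⊞-cong ≅-refl (⊟-cong (≅-sym (S-sifted-small (suc m) m ℕP.≤-refl))))))
        (S-near (sifted (suc m)) m (M ℕ.∸ suc m)))) })

  ζ⊠P : ζ ⊠ b 0 ≅ κ 1ℚ
  ζ⊠P = ≅-trans (⊠-comm _ _) (⇝-unique (⇝-⊠ (b-limit 0) ⇝-const) B⊠ζ-⇝-1)

  -- b p is the tail ∏_{r > p} (1 - a r), so that ζ b p inverts ∏_{r ≤ p} (1 - a r).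
  t : ℕ → ℂ
  t p = a p ⊠ (ζ ⊠ b p)

  -- Regrouping gives (a p w)(ζ (B 0 p b p)), and `B⊠b` replaces the inner product by b 0. The
  -- inverse w of a p will be p^s.
  t-inverse : ∀ p {w} → a p ⊠ w ≅ κ 1ℚ → t p ⊠ (w ⊠ B 0 p) ≅ κ 1ℚ
  t-inverse p {w} h = begin
    a p ⊠ (ζ ⊠ b p) ⊠ (w ⊠ B 0 p)
      ≈⟨ solve 5 (λ a z b w B → a :* (z :* b) :* (w :* B) := (a :* w) :* (z :* (B :* b))) ≅-refl _ _ _ _ _ ⟩
    (a p ⊠ w) ⊠ (ζ ⊠ (B 0 p ⊠ b p))  ≈⟨ ⊠-cong h (≅-trans (⊠-cong ≅-refl (B⊠b p)) ζ⊠P) ⟩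
    κ 1ℚ ⊠ κ 1ℚ                      ≈⟨ ⊠-identityˡ _ ⟩
    κ 1ℚ                             ∎
    where
    open ≅-Reasoning
    open ℂ-Solver

  -- t p = ζ b p − ζ b (p − 1) since b (p − 1) = (1 − a p) b p.
  primeSum-telescopes : ∀ N → primeSum N t ≅ ζ ⊠ b N ⊟ κ 1ℚ
  primeSum-telescopes zero = ≅-sym (≅-trans (⊞-cong ζ⊠P ≅-refl) (solve 0 (con 1ℚ :- con 1ℚ := con 0ℚ) ≅-refl))
    where open ℂ-Solver
  primeSum-telescopes (suc N) = go (prime? (suc N))
    where
    open ≅-Reasoning
    open ℂ-Solver
    unfold : ∀ {c} → does (prime? (suc N)) ≡ c →
      primeSum (suc N) t ≡ (if c then primeSum N t ⊞ t (suc N) else primeSum N t)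
    unfold = cong (λ c → if c then primeSum N t ⊞ t (suc N) else primeSum N t)
    go : Dec (Prime (suc N)) → primeSum (suc N) t ≅ ζ ⊠ b (suc N) ⊟ κ 1ℚ
    go (yes pr) = begin
      primeSum (suc N) t                 ≈⟨ ≡⇒≅ (unfold (dec-true (prime? (suc N)) pr)) ⟩
      primeSum N t ⊞ t (suc N)           ≈⟨ ⊞-cong (primeSum-telescopes N) ≅-refl ⟩
      ζ ⊠ b N ⊟ κ 1ℚ ⊞ t (suc N)
        ≈⟨ ⊞-cong (⊞-cong (⊠-cong ≅-refl (≅-trans (b-suc N) (⊠-cong (≡⇒≅ (factor-prime pr)) ≅-refl))) ≅-refl) ≅-refl ⟩
      ζ ⊠ ((κ 1ℚ ⊟ a (suc N)) ⊠ b (suc N)) ⊟ κ 1ℚ ⊞ t (suc N)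
        ≈⟨ solve 3 (λ z a b → z :* ((con 1ℚ :- a) :* b) :- con 1ℚ :+ a :* (z :* b) := z :* b :- con 1ℚ) ≅-refl _ _ _ ⟩
      ζ ⊠ b (suc N) ⊟ κ 1ℚ             ∎
    go (no ¬pr) = begin
      primeSum (suc N) t                 ≈⟨ ≡⇒≅ (unfold (dec-false (prime? (suc N)) ¬pr)) ⟩
      primeSum N t                       ≈⟨ primeSum-telescopes N ⟩
      ζ ⊠ b N ⊟ κ 1ℚ
        ≈⟨ ⊞-cong (⊠-cong ≅-refl (≅-trans (b-suc N) (≅-trans (⊠-cong (≡⇒≅ (factor-composite ¬pr)) ≅-refl) (⊠-identityˡ _)))) ≅-refl ⟩
      ζ ⊠ b (suc N) ⊟ κ 1ℚ             ∎

  primeSum-⇝ : (λ N → primeSum N t) ⇝ ζ ⊟ κ 1ℚ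
  primeSum-⇝ = ⇝-cong (always λ N → ≅-sym (primeSum-telescopes N))
    (⊞-cong (≅-trans (⊠-comm _ _) (⊠-identityˡ ζ)) ≅-refl)
    (⇝-⊞ (⇝-⊠ˡ ζ b-⇝-1) ⇝-const)

-- The zeta function

≅⇒≈ : ∀ z w → z ≅ w → z ≈ w
≅⇒≈ _ _ (mk≅ (mk≃ h) (mk≃ k)) = h , k

≅⇒≈1/ : ∀ w z → w ⊠ z ≅ κ 1ℚ → w ≈1/ z
≅⇒≈1/ w z h = ≅⇒≈ (w *ᶜ z) 1ᶜ (≅-trans (≡⇒≅ (*ᶜ≡⊠ w z)) (≅-trans h (≡⇒≅ (sym (fromℚ≡κ 1ℚ)))))

≅⇒≈1/-* : ∀ w x y {v} → y ≅ v → w ⊠ (x ⊠ v) ≅ κ 1ℚ → w ≈1/ (x *ᶜ y)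
≅⇒≈1/-* w x y y≅v h = ≅⇒≈1/ w (x *ᶜ y)
  (≅-trans (⊠-cong ≅-refl (≅-trans (≡⇒≅ (*ᶜ≡⊠ x y)) (⊠-cong ≅-refl y≅v))) h)

opaque
  unfolding Exp Log

  exp≡Exp : ∀ z → exp z ≡ Exp z
  exp≡Exp z = refl

  log≡Log : ∀ n → log n ≡ Log n
  log≡Log n = refl

^≡Exp : ∀ n s → n ^ s ≡ Exp (s ⊠ ρ (Log n))
^≡Exp n s = trans (exp≡Exp (s *ᶜ fromℝ (log n))) (cong Exp (trans (*ᶜ≡⊠ s (fromℝ (log n)))
  (cong (s ⊠_) (trans (fromℝ≡ρ (log n)) (cong ρ (log≡Log n))))))

∏ℙ≡primeProduct : ∀ {f g} → (∀ p → f p ≡ g p) → ∀ N → ∏ℙ N f ≡ primeProduct N g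
∏ℙ≡primeProduct h zero    = fromℚ≡κ 1ℚ
∏ℙ≡primeProduct {f} {g} h (suc N) = cong₂ (λ x y → if does (prime? (suc N)) then x else y)
  (trans (*ᶜ≡⊠ (∏ℙ N f) (f (suc N))) (cong₂ _⊠_ (∏ℙ≡primeProduct h N) (h (suc N))))
  (∏ℙ≡primeProduct h N)

∑ℙ≡primeSum : ∀ f N → ∑ℙ N f ≡ primeSum N f
∑ℙ≡primeSum f zero    = fromℚ≡κ 0ℚ
∑ℙ≡primeSum f (suc N) = cong₂ (λ x y → if does (prime? (suc N)) then x else y)
  (trans (+ᶜ≡⊞ (∑ℙ N f) (f (suc N))) (cong (_⊞ f (suc N)) (∑ℙ≡primeSum f N))) (∑ℙ≡primeSum f N)

module Zeta (s : ℂ) (δ : ℚ) (0<δ : 0ℚ < δ) (τ≼ : ι (1ℚ + δ) ≼ re s)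
  (c : ℚ) (0<c : 0ℚ < c) (δc≡2 : δ * c ≡ 1ℚ + 1ℚ) where

  open Decay δ 0<δ

  rpow : ℕ → ℂ
  rpow n = Exp (⊟ s ⊠ ρ (Log n))

  rpow⊠^ : ∀ n → rpow n ⊠ n ^ s ≅ κ 1ℚ
  rpow⊠^ n = ≅-trans (⊠-cong (Exp-cong (solve 2 (λ s l → (:- s) :* l := :- (s :* l)) ≅-refl s (ρ (Log n))))
    (≡⇒≅ (^≡Exp n s))) (Exp-inverse (s ⊠ ρ (Log n)))
    where open ℂ-Solver

  rpow-1 : rpow 1 ≅ κ 1ℚ
  rpow-1 = ≅-trans (Exp-cong (≅-trans (⊠-cong ≅-refl (ρ-cong Log-1))
    (solve 1 (λ s → (:- s) :* con 0ℚ := con 0ℚ) ≅-refl s))) Exp-0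
    where open ℂ-Solver

  rpow-* : ∀ m n → rpow (suc m ℕ.* suc n) ≅ rpow (suc m) ⊠ rpow (suc n)
  rpow-* m n = ≅-trans (Exp-cong (≅-trans (⊠-cong ≅-refl (≅-trans (ρ-cong (Log-* m n)) (ρ-⊕ _ _)))
    (⊠-distribˡ-⊞ _ _ _))) (Exp-⊞ _ _)

  -- Since log n ≥ 0, the bound τ ≤ Re s gives -Re s log n ≤ -τ log n, and the exponential is
  -- monotone.
  norm-rpow : ∀ n → norm (rpow n) ≼ E n ⊗ (ι 1ℚ ⊕ ι 1ℚ)
  norm-rpow n = ≼-trans (norm-Exp (⊟ s ⊠ ρ (Log n))) (⊗-monoʳ (⊕-nonneg 0≼1 0≼1)
    (expᴿ-mono (≼-trans (≼-reflexive (re-⊟ρ⊠ s (Log n))) (⊖-anti (⊗-monoʳ (Log-nonneg n) τ≼)))))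

  0≼c : ι 0ℚ ≼ ι c
  0≼c = ι-nonneg (ℚP.<⇒≤ 0<c)

  -- Here c = 2/δ: the 2 is the constant of `norm-Exp`, and 1/δ cancels the weight δ that `F-suc`
  -- puts on E.
  G : ℕ → ℝ
  G m = ι c ⊗ F m

  G-suc : ∀ m → norm (rpow (suc (suc m))) ⊕ G (suc m) ≼ G m
  G-suc m = begin
    norm (rpow (suc (suc m))) ⊕ ι c ⊗ F (suc m)
      ≲⟨ ⊕-monoʳ _ (norm-rpow (suc (suc m))) ⟩
    e ⊗ (ι 1ℚ ⊕ ι 1ℚ) ⊕ ι c ⊗ F (suc m)
      ≈⟨ ⊕-cong (⊗-cong ≃-refl (≃-trans (≃-sym (ι-+ 1ℚ 1ℚ)) (≃-trans (ι-cong (sym δc≡2)) (ι-* δ c)))) ≃-refl ⟩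
    e ⊗ (ι δ ⊗ ι c) ⊕ ι c ⊗ F (suc m)
      ≈⟨ solve 4 (λ e d c f → e :* (d :* c) :+ c :* f := c :* (d :* e :+ f)) ≃-refl e (ι δ) (ι c) (F (suc m)) ⟩
    ι c ⊗ (ι δ ⊗ e ⊕ F (suc m))
      ≲⟨ ⊗-monoˡ 0≼c (F-suc m) ⟩
    ι c ⊗ F m ∎
    where
    open ≼-Reasoning
    open ℝ-Solver
    e : ℝ
    e = E (suc (suc m))

  G-null : Null G
  G-null = null-≼ (always λ m → ⊗-monoʳ (F-nonneg m) (x≼abs (ι c))) (null-⊗ {x = ι c} F-null)

  open EulerProduct rpow rpow-1 rpow-* G G-suc (λ m → ⊗-nonneg 0≼c (F-nonneg m)) G-null

  ζ-partial : ∀ N → S (λ _ → true) N ≅ ∑ N (λ n → rpow (suc n))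
  ζ-partial N = ≡⇒≅ (sym (∑≡sum N (λ n → rpow (suc n))))

  ∏ℙ≅B : ∀ N → ∏ℙ N (λ p → 1ᶜ -ᶜ rpow p) ≅ B 0 N
  ∏ℙ≅B N = ≅-trans (≡⇒≅ (∏ℙ≡primeProduct
    (λ p → trans (-ᶜ≡⊟ 1ᶜ (rpow p)) (cong (_⊟ rpow p) (fromℚ≡κ 1ℚ))) N)) (primeProduct≅B N)

  t-reciprocal : ∀ p → t p ≈1/ (p ^ s *ᶜ ∏ℙ p (λ r → 1ᶜ -ᶜ rpow r))
  t-reciprocal p = ≅⇒≈1/-* (t p) (p ^ s) (∏ℙ p (λ r → 1ᶜ -ᶜ rpow r)) (∏ℙ≅B p) (t-inverse p (rpow⊠^ p))

  conclusion :
    Σ[ ζ ∈ ℂ ] Σ[ rpow ∈ (ℕ → ℂ) ]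
        (∀ (n : ℕ) .{{_ : NonZero n}} → rpow n ≈1/ (n ^ s))
      × (λ N → ∑ N (λ n → rpow (suc n))) ⟶ ζ
      × (Σ[ P ∈ ℂ ] (λ N → ∏ℙ N (λ p → 1ᶜ -ᶜ rpow p)) ⟶ P × ζ ≈1/ P)
      × (Σ[ t ∈ (ℕ → ℂ) ] Σ[ T ∈ ℂ ]
            (∀ (p : ℕ) → Prime p → t p ≈1/ (p ^ s *ᶜ ∏ℙ p (λ r → 1ᶜ -ᶜ rpow r)))
          × (λ N → ∑ℙ N t) ⟶ T
          × ζ ≈ 1ᶜ +ᶜ T)
  conclusion = ζ , rpow , (λ n → ≅⇒≈1/ (rpow n) (n ^ s) (rpow⊠^ n)) ,
    ⇝⇒⟶ (⇝-cong (always ζ-partial) ≅-refl ζ-sum) ,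
    (b 0 , ⇝⇒⟶ (⇝-cong (always λ N → ≅-sym (∏ℙ≅B N)) ≅-refl (b-limit 0)) , ≅⇒≈1/ ζ (b 0) ζ⊠P) ,
    (t , ζ ⊟ κ 1ℚ , (λ p _ → t-reciprocal p) ,
      ⇝⇒⟶ (⇝-cong (always λ N → ≡⇒≅ (sym (∑ℙ≡primeSum t N))) ≅-refl primeSum-⇝) ,
      ≅⇒≈ ζ (1ᶜ +ᶜ (ζ ⊟ κ 1ℚ)) (≅-trans (solve 1 (λ z → z := con 1ℚ :+ (z :- con 1ℚ)) ≅-refl ζ)
        (≡⇒≅ (sym (trans (+ᶜ≡⊞ 1ᶜ (ζ ⊟ κ 1ℚ)) (cong (_⊞ (ζ ⊟ κ 1ℚ)) (fromℚ≡κ 1ℚ)))))))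
    where open ℂ-Solver

opaque
  unfolding ι

  -- The rational gap stored in the strict inequality is the δ of the whole argument; it separates
  -- the approximants from some index on.
  <ᴿ⇒≼ : ∀ q x → fromℚ q <ᴿ x → ∃[ δ ] (0ℚ < δ × ι (q + δ) ≼ x)
  <ᴿ⇒≼ q x (δ , 0<δ , h) = δ , 0<δ , ≼-pointwise h

corollary1p3 :
  ∀ (s : ℂ) → fromℚ 1ℚ <ᴿ re s →
  Σ[ ζ ∈ ℂ ] Σ[ rpow ∈ (ℕ → ℂ) ]
      -- rpow n = 1/nˢ for n ≥ 1, and ζ is the sum of these
      (∀ (n : ℕ) .{{_ : NonZero n}} → rpow n ≈1/ (n ^ s))
    × (λ N → ∑ N (λ n → rpow (suc n))) ⟶ ζ
      -- ζ is the reciprocal of the Euler product P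
    × (Σ[ P ∈ ℂ ] (λ N → ∏ℙ N (λ p → 1ᶜ -ᶜ rpow p)) ⟶ P × ζ ≈1/ P)
      -- ζ is 1 plus the sum T of the terms t p over all primes p
    × (Σ[ t ∈ (ℕ → ℂ) ] Σ[ T ∈ ℂ ]
          (∀ (p : ℕ) → Prime p → t p ≈1/ (p ^ s *ᶜ ∏ℙ p (λ r → 1ᶜ -ᶜ rpow r)))
        × (λ N → ∑ℙ N t) ⟶ T
        × ζ ≈ 1ᶜ +ᶜ T)
corollary1p3 s h =
  let δ , 0<δ , τ≼ = <ᴿ⇒≼ 1ℚ (re s) h
      c , 0<c , δc≡2 = quotient (0<+ 0<1 0<1) 0<δ
  in Zeta.conclusion s δ 0<δ τ≼ c 0<c δc≡2
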